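{- Let $n\ge 5$ and $s$ be integers with $1<s<n/2$, and let $q=\lfloor n/s\rfloor$ and $r=n-qs$ (so $0\le r<s$, $q\ge 2$). For an integer $x$ let $\epsilon(x)=1$ if $x$ is odd and $\epsilon(x)=0$ if $x$ is even. Then: (a) if $2\le s\le \sqrt{n}-1$, then $$\frac{n^2-\epsilon(n)}{8(s+1)}\le \frac{\pi(C_n(1,s))}{2}\le \overrightarrow{\pi}(C_n(1,s))\le \frac{(n-r)(n+r+2)+s^2}{8s};$$ (b) if $s=\sqrt{n}$, then $$\frac{\sqrt{n}\,(n-1)}{8}\le \frac{\pi(C_n(1,s))}{2}\le \overrightarrow{\pi}(C_n(1,s))\le \frac{\sqrt{n}\,(n-\epsilon(s))}{8};$$ (c) if $\sqrt{n}+1\le s<n/2$, then $$\max\left\{\frac{n^2-\epsilon(n)}{8(s+1)},\ \frac{(n-1)(\sqrt{2n}-7)^3}{24n}\right\}\le \frac{\pi(C_n(1,s))}{2}\le \overrightarrow{\pi}(C_n(1,s))\le \frac{s^2(n+r+2)-\epsilon(s)(n-r)}{8s}.$$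
   Context: For $n\ge 3$, $\mathbb{Z}_n$ is the additive group of integers mod $n$. The circulant graph $C_n(1,s)$ has vertex set $\mathbb{Z}_n$, with $i,j$ adjacent iff $i-j\in\{\pm1,\pm s\}$ (mod $n$). An arc is an ordered pair of adjacent vertices. An all-to-all routing $R$ of a graph $G$ is a set of oriented paths containing exactly one path $P_{x,y}$ from $x$ to $y$ for each ordered pair $(x,y)$ of distinct vertices. The load of an edge $e$ under $R$ is the number of paths of $R$ using $e$ (in either direction); the load of an arc $a$ is the number of paths of $R$ traversing $a$ in its direction. $\pi(G,R)$ (resp. $\overrightarrow{\pi}(G,R)$) is the maximum edge load (resp. maximum arc load) under $R$; the edge-forwarding index is $\pi(G)=\min_R\pi(G,R)$ and the arc-forwarding index is $\overrightarrow{\pi}(G)=\min_R\overrightarrow{\pi}(G,R)$, minima over all all-to-all routings $R$. -}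

module Defs where

open import Data.Nat using (ℕ; zero; suc; _+_; _*_; _∸_; _≤_; _<_; _⊔_)
open import Data.Nat.DivMod using (_%_)
open import Data.Fin using (Fin; toℕ; _≟_)
open import Data.List using (List; []; _∷_; map; foldr; allFin)
open import Data.Nat.ListAction using (sum)
open import Data.List.Relation.Unary.Unique.Propositional using (Unique)
open import Data.Bool using (Bool; true; false; _∧_; _∨_; if_then_else_)
open import Data.Product using (Σ; _×_)
open import Data.Sum using (_⊎_)
open import Relation.Nullary using (¬_)
open import Relation.Nullary.Decidable using (⌊_⌋)
open import Relation.Binary.PropositionalEquality using (_≡_)

ε : ℕ → ℕ
ε x = x % 2

-- For i j : Fin n and d : ℕ (with d < n):  j ≡ i + d (mod n).
Step : (n d : ℕ) → Fin n → Fin n → Set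
Step n d i j = (toℕ i + d ≡ toℕ j) ⊎ (toℕ i + d ≡ toℕ j + n)

Adj : (n s : ℕ) → Fin n → Fin n → Set
Adj n s i j = Step n 1 i j ⊎ Step n 1 j i ⊎ Step n s i j ⊎ Step n s j i

data Walk (n s : ℕ) : Fin n → Fin n → List (Fin n) → Set where
  single : ∀ {x} → Walk n s x x (x ∷ [])
  step   : ∀ {u v y p} → Adj n s u v → Walk n s v y p → Walk n s u y (u ∷ p)

IsPath : (n s : ℕ) → Fin n → Fin n → List (Fin n) → Set
IsPath n s x y p = Walk n s x y p × Unique p

-- An all-to-all routing: a choice of path R x y from x to y for each
-- ordered pair of distinct vertices (the value on x = y is irrelevant).
Routing : ℕ → Set
Routing n = Fin n → Fin n → List (Fin n)

IsRouting : (n s : ℕ) → Routing n → Set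
IsRouting n s R = ∀ x y → ¬ (x ≡ y) → IsPath n s x y (R x y)

usesArc : ∀ {n} → List (Fin n) → Fin n → Fin n → Bool
usesArc (a ∷ b ∷ rest) u v = (⌊ a ≟ u ⌋ ∧ ⌊ b ≟ v ⌋) ∨ usesArc (b ∷ rest) u v
usesArc _ u v = false

usesEdge : ∀ {n} → List (Fin n) → Fin n → Fin n → Bool
usesEdge p u v = usesArc p u v ∨ usesArc p v u

countPaths : ∀ {n} → Routing n → (List (Fin n) → Bool) → ℕ
countPaths {n} R f =
  sum (map (λ x → sum (map (λ y →
    if ⌊ x ≟ y ⌋ then 0 else (if f (R x y) then 1 else 0)) (allFin n))) (allFin n))

arcLoad : ∀ {n} → Routing n → Fin n → Fin n → ℕ
arcLoad R u v = countPaths R (λ p → usesArc p u v)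

edgeLoad : ∀ {n} → Routing n → Fin n → Fin n → ℕ
edgeLoad R u v = countPaths R (λ p → usesEdge p u v)

-- maximum over all ordered pairs (u,v) of vertices of f u v
-- (non-adjacent pairs carry load 0 for a genuine routing)
maxOver : ∀ {n} → (Fin n → Fin n → ℕ) → ℕ
maxOver {n} f = foldr _⊔_ 0 (map (λ u → foldr _⊔_ 0 (map (λ v → f u v) (allFin n))) (allFin n))

edgeπ : ∀ {n} → Routing n → ℕ
edgeπ R = maxOver (edgeLoad R)

arcπ : ∀ {n} → Routing n → ℕ
arcπ R = maxOver (arcLoad R)

IsEdgeForwardingIndex : (n s : ℕ) → ℕ → Set
IsEdgeForwardingIndex n s p =
  Σ (Routing n) (λ R → IsRouting n s R × edgeπ R ≡ p)
  × (∀ R → IsRouting n s R → p ≤ edgeπ R)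

IsArcForwardingIndex : (n s : ℕ) → ℕ → Set
IsArcForwardingIndex n s a =
  Σ (Routing n) (λ R → IsRouting n s R × arcπ R ≡ a)
  × (∀ R → IsRouting n s R → a ≤ arcπ R)

{-# OPTIONS --safe #-}
module Submission where

-- Lower bounds. Let F : ℤₙ → ℕ vanish at 0 and be w₁-Lipschitz for the steps ±1 and wₛ-Lipschitz for
-- the steps ±s. A path from x to y has weighted length at least F (y - x), so summing over all pairs
-- and counting the edges used gives ∑ F ≤ (w₁ + wₛ) π. The three bounds come from F z = ∥z∥ₙ, the
-- distance to 0 in the n-cycle (weights 1, s); from the graph distance when n = s²; and from the graph
-- distance truncated at ⌊√(n/2)⌋, whose sum is controlled by the sizes of balls in ℤ².
--
-- Upper bounds. In the translation-invariant routing that covers a displacement z ≤ n/2 by the nearest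
-- multiple of s and then by ±1-steps, and z > n/2 by reflection, an arc of type ±s has load at most
-- ∑_{z ≤ n/2} β z and an arc of type ±1 has load at most ∑_{z ≤ n/2} |z - s β z|, where β z is the
-- integer nearest to z/s. Both sums are computed exactly.

-- The load sums are about `n s / 8` on `±1`-arcs and `n² / (8 s)` on `±s`-arcs. They balance at
-- `s = √n`, so the larger one decides each side of that threshold, and what remains is control of
-- lower-order terms, which depend on the parities of `q`, `s` and `r`. Hence the factor 8
-- throughout and the case analysis at the end. The cyclic bound decays like `n² / (8 s)` and
-- becomes weak for `s` well above `√n`. The truncated distance gives order `n √n` whatever `s` is,
-- because a ball of the graph is never larger than a ball of ℤ². The two indices are asserted to
-- exist, so the minima have to be found: simple paths between two vertices form a finite list, and
-- a routing is optimised one pair at a time. Roots never occur in the code: conditions on `√n` are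
-- compared by squares, and the cubic bound is expanded, rearranged and squared.

open import Defs
open import Data.Nat hiding (_≟_)
open import Data.Nat.Properties hiding (_≟_)
import Data.Nat.Properties as ℕ
open import Data.Nat.Divisibility using (n∣m*n)
open import Data.Nat.DivMod
open import Data.Nat.ListAction using () renaming (sum to sumₗ)
open import Data.Nat.ListAction.Properties using (sum-++)
open import Data.Nat.Tactic.RingSolver using (solve-∀)
open import Algebra.Properties.CommutativeMonoid.Sum +-0-commutativeMonoid using (sum; sum-cong-≗; ∑-distrib-+; ∑-comm)
open import Data.Bool using (Bool; true; false; _∧_; _∨_; if_then_else_)
open import Data.Bool.Properties using (∨-zeroʳ; ∧-zeroʳ)
open import Data.Fin as Fin using (Fin; toℕ; fromℕ<; _≟_)
open import Data.Fin.Properties as Fin using (toℕ<n; toℕ-fromℕ<; toℕ-injective; injective⇒≤; all?)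
open import Data.List as List using (List; []; _∷_; _++_; map; foldr; filter; length; replicate; allFin; tabulate; cartesianProductWith)
open import Data.List.Extrema ≤-totalOrder using (argmin; argmin-all; f[argmin]≤f[xs])
open import Data.List.Membership.Propositional using (_∈_)
open import Data.List.Membership.Propositional.Properties using (∈-lookup; ∈-allFin; ∈-filter⁺; ∈-cartesianProductWith⁺)
open import Data.List.Properties using (map-tabulate; map-++; map-id)
open import Data.List.Relation.Unary.All as All using (All; []; _∷_)
open import Data.List.Relation.Unary.All.Properties using (all-filter; ¬Any⇒All¬; ++⁺; replicate⁺)
open import Data.List.Relation.Unary.AllPairs using ([]; _∷_; allPairs?)
open import Data.List.Relation.Unary.Any using (here; there; any?)
open import Data.List.Relation.Unary.Unique.Propositional using (Unique)
open import Data.Product using (Σ; ∃; _×_; _,_; proj₁; proj₂)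
open import Data.Sum using (_⊎_; inj₁; inj₂; [_,_]′)
open import Data.Unit using (tt)
import Data.Vec.Functional as Vector
open import Function using (_∘_; id)
open import Relation.Binary.Definitions using (tri<; tri≈; tri>)
open import Relation.Binary.PropositionalEquality
open import Relation.Nullary using (Dec; yes; no; ¬_; contradiction)
open import Relation.Nullary.Decidable using (⌊_⌋; toWitness; _×-dec_; _⊎-dec_; ¬?)

-- Sums and the distance to 0 in a cycle

sum-mono : ∀ {n} {f g : Fin n → ℕ} → (∀ i → f i ≤ g i) → sum f ≤ sum g
sum-mono {zero} h = z≤n
sum-mono {suc n} h = +-mono-≤ (h Fin.zero) (sum-mono (h ∘ Fin.suc))

sum-mono-< : ∀ {n} {f g : Fin n → ℕ} → (∀ i → f i ≤ g i) → ∀ i → f i < g i → sum f < sum g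
sum-mono-< h Fin.zero p = +-mono-<-≤ p (sum-mono (h ∘ Fin.suc))
sum-mono-< h (Fin.suc i) p = +-mono-≤-< (h Fin.zero) (sum-mono-< (h ∘ Fin.suc) i p)

sum-const : ∀ n c → sum {n} (λ _ → c) ≡ n * c
sum-const zero c = refl
sum-const (suc n) c = cong (c +_) (sum-const n c)

sum-*ˡ : ∀ {n} c (f : Fin n → ℕ) → sum (λ i → c * f i) ≡ c * sum f
sum-*ˡ {zero} c f = sym (*-zeroʳ c)
sum-*ˡ {suc n} c f = trans (cong (c * f Fin.zero +_) (sum-*ˡ c (f ∘ Fin.suc))) (sym (*-distribˡ-+ c _ _))

∑< : ℕ → (ℕ → ℕ) → ℕ
∑< n f = sum {n} (λ i → f (toℕ i))

∑<-cong : ∀ n {f g : ℕ → ℕ} → (∀ i → i < n → f i ≡ g i) → ∑< n f ≡ ∑< n g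
∑<-cong n h = sum-cong-≗ {n} (λ i → h (toℕ i) (toℕ<n i))

∑<-mono : ∀ n {f g : ℕ → ℕ} → (∀ i → i < n → f i ≤ g i) → ∑< n f ≤ ∑< n g
∑<-mono n h = sum-mono {n} (λ i → h (toℕ i) (toℕ<n i))

∑<-+ : ∀ n (f g : ℕ → ℕ) → ∑< n (λ i → f i + g i) ≡ ∑< n f + ∑< n g
∑<-+ n f g = ∑-distrib-+ {n} (f ∘ toℕ) (g ∘ toℕ)

∑<-const : ∀ n c → ∑< n (λ _ → c) ≡ n * c
∑<-const = sum-const

∑<-split : ∀ m n f → ∑< (m + n) f ≡ ∑< m f + ∑< n (λ i → f (m + i))
∑<-split zero n f = refl
∑<-split (suc m) n f = trans (cong (f 0 +_) (∑<-split m n (f ∘ suc))) (sym (+-assoc (f 0) _ _))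

∑<-last : ∀ n f → ∑< (suc n) f ≡ ∑< n f + f n
∑<-last zero f = +-identityʳ (f 0)
∑<-last (suc n) f = trans (cong (f 0 +_) (∑<-last n (f ∘ suc))) (sym (+-assoc (f 0) _ _))

∑<-reverse : ∀ n f → ∑< n (λ i → f (n ∸ suc i)) ≡ ∑< n f
∑<-reverse zero f = refl
∑<-reverse (suc n) f = trans (cong (f n +_) (∑<-reverse n f)) (trans (+-comm (f n) _) (sym (∑<-last n f)))

-- Moving the window by one drops `f c` and adds `f (c + n)`, which agree by periodicity. This lets
-- displacements replace target vertices as the summation variable.
∑<-shift : ∀ n f → (∀ z → f (z + n) ≡ f z) → ∀ c → ∑< n (λ i → f (c + i)) ≡ ∑< n f
∑<-shift n f per zero = refl
∑<-shift n f per (suc c) = trans (+-cancelˡ-≡ (f (c + 0)) _ _ eq) (∑<-shift n f per c)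
  where
  g : ℕ → ℕ
  g i = f (c + i)
  eq : f (c + 0) + ∑< n (λ i → f (suc c + i)) ≡ f (c + 0) + ∑< n g
  eq = begin
    g 0 + ∑< n (λ i → f (suc c + i)) ≡⟨ cong (g 0 +_) (∑<-cong n (λ i _ → cong f (sym (+-suc c i)))) ⟩
    ∑< (suc n) g                     ≡⟨ ∑<-last n g ⟩
    ∑< n g + g n                     ≡⟨ cong (∑< n g +_) (trans (per c) (cong f (sym (+-identityʳ c)))) ⟩
    ∑< n g + g 0                     ≡⟨ +-comm _ (g 0) ⟩
    g 0 + ∑< n g                     ∎
    where open ≡-Reasoning

∑<-* : ∀ m n f → ∑< (m * n) f ≡ ∑< m (λ i → ∑< n (λ j → f (i * n + j)))
∑<-* zero n f = refl
∑<-* (suc m) n f = trans (∑<-split n (m * n) f) (cong (∑< n f +_) (trans (∑<-* m n (λ i → f (n + i)))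
  (∑<-cong m (λ i _ → ∑<-cong n (λ j _ → cong f (sym (+-assoc n (i * n) j)))))))

∥_∥ : ℕ → ∀ n .{{_ : NonZero n}} → ℕ
∥ z ∥ n = (z % n) ⊓ (n ∸ z % n)

module _ (n : ℕ) .{{_ : NonZero n}} where

  ∥∥-cong : ∀ {y z} → y % n ≡ z % n → ∥ y ∥ n ≡ ∥ z ∥ n
  ∥∥-cong eq = cong (λ m → m ⊓ (n ∸ m)) eq

  ∥∥-periodic : ∀ z → ∥ z + n ∥ n ≡ ∥ z ∥ n
  ∥∥-periodic z = ∥∥-cong ([m+n]%n≡m%n z n)

  ∥∥-< : ∀ {z} → z < n → ∥ z ∥ n ≡ z ⊓ (n ∸ z)
  ∥∥-< z<n = cong (λ m → m ⊓ (n ∸ m)) (m<n⇒m%n≡m z<n)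

  %-suc : ∀ z → (z + 1) % n ≡ (z % n + 1) % n
  %-suc z = begin
    (z + 1) % n                         ≡⟨ cong (λ x → (x + 1) % n) (m≡m%n+[m/n]*n z n) ⟩
    (z % n + z / n * n + 1) % n         ≡⟨ cong (_% n) (solve (z % n) (z / n * n)) ⟩
    (z % n + 1 + z / n * n) % n         ≡⟨ [m+kn]%n≡m%n (z % n + 1) (z / n) n ⟩
    (z % n + 1) % n                     ∎
    where
    open ≡-Reasoning
    solve : ∀ a b → a + b + 1 ≡ a + 1 + b
    solve = solve-∀

  private
    step< : ∀ m → m < n → ∥ m ∥ n ≤ 1 + ∥ m + 1 ∥ n × ∥ m + 1 ∥ n ≤ 1 + ∥ m ∥ n
    step< m m<n with m + 1 <? n
    ... | yes m+1<n rewrite m<n⇒m%n≡m m<n | m<n⇒m%n≡m m+1<n | +-comm m 1 =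
          ⊓-mono-≤ (≤-trans (n≤1+n m) (n≤1+n (suc m))) (≤-reflexive (sym (trans (sym (+-∸-assoc 1 m+1<n′)) refl)))
        , ⊓-mono-≤ ≤-refl (≤-trans (∸-monoʳ-≤ n (n≤1+n m)) (n≤1+n _))
      where
      m+1<n′ : suc m ≤ n
      m+1<n′ = m<n
    -- Wrap-around: `m` is the last residue, at distance at most 1, and its successor is 0.
    ... | no m+1≮n =
        ≤-trans (≤-reflexive (∥∥-< m<n)) (≤-trans (m⊓n≤n m (n ∸ m)) (≤-trans (≤-reflexive n∸m≡1) (s≤s z≤n)))
      , ≤-trans (m⊓n≤m _ _) (≤-trans (≤-reflexive (trans (cong (_% n) m+1≡n) (n%n≡0 n))) z≤n)
      where
      m+1≡n : m + 1 ≡ n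
      m+1≡n = ≤-antisym (subst (_≤ n) (+-comm 1 m) m<n) (≮⇒≥ m+1≮n)
      n∸m≡1 : n ∸ m ≡ 1
      n∸m≡1 = trans (cong (_∸ m) (sym m+1≡n)) (m+n∸m≡n m 1)

    step± : ∀ z → ∥ z ∥ n ≤ 1 + ∥ z + 1 ∥ n × ∥ z + 1 ∥ n ≤ 1 + ∥ z ∥ n
    step± z with step< (z % n) (m%n<n z n)
    ... | p , q = subst₂ (λ a b → a ≤ 1 + b) e₁ e₂ p , subst₂ (λ a b → a ≤ 1 + b) e₂ e₁ q
      where
      e₁ : ∥ z % n ∥ n ≡ ∥ z ∥ n
      e₁ = ∥∥-cong (m%n%n≡m%n z n)
      e₂ : ∥ z % n + 1 ∥ n ≡ ∥ z + 1 ∥ n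
      e₂ = ∥∥-cong (sym (%-suc z))

  ∥∥-lip↑ : ∀ z → ∥ z ∥ n ≤ 1 + ∥ z + 1 ∥ n
  ∥∥-lip↑ = proj₁ ∘ step±

  ∥∥-lip↓ : ∀ z → ∥ z + 1 ∥ n ≤ 1 + ∥ z ∥ n
  ∥∥-lip↓ = proj₂ ∘ step±

  ∥∥-lip*↑ : ∀ d z → ∥ z ∥ n ≤ d + ∥ z + d ∥ n
  ∥∥-lip*↑ zero z = ≤-reflexive (cong (λ x → ∥ x ∥ n) (sym (+-identityʳ z)))
  ∥∥-lip*↑ (suc d) z = ≤-trans (∥∥-lip↑ z) (s≤s (≤-trans (∥∥-lip*↑ d (z + 1))
    (≤-reflexive (cong (λ x → d + ∥ x ∥ n) (+-assoc z 1 d)))))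

  ∥∥-lip*↓ : ∀ d z → ∥ z + d ∥ n ≤ d + ∥ z ∥ n
  ∥∥-lip*↓ zero z = ≤-reflexive (cong (λ x → ∥ x ∥ n) (+-identityʳ z))
  ∥∥-lip*↓ (suc d) z = ≤-trans (≤-reflexive (cong (λ x → ∥ x ∥ n) (sym (+-assoc z 1 d))))
    (≤-trans (∥∥-lip*↓ d (z + 1)) (≤-trans (+-monoʳ-≤ d (∥∥-lip↓ z)) (≤-reflexive (+-suc d _))))

-- Dropping the initial 0 and lowering the other `suc n` values by one leaves the sum for `n`
-- followed by a 0. So the induction goes by two, and `ε n` is constant along it.
∑-⊓ : ∀ n → 4 * ∑< n (λ z → z ⊓ (n ∸ z)) + ε n ≡ n * n
∑-⊓ 0 = refl
∑-⊓ 1 = refl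
∑-⊓ (suc (suc n)) = begin
  4 * T (2 + n) + ε n           ≡⟨ cong (λ x → 4 * x + ε n) T-step ⟩
  4 * (T n + suc n) + ε n       ≡⟨ rearr (T n) n (ε n) ⟩
  (4 * T n + ε n) + 4 * suc n   ≡⟨ cong (_+ 4 * suc n) (∑-⊓ n) ⟩
  n * n + 4 * suc n             ≡⟨ square n ⟩
  (2 + n) * (2 + n)             ∎
  where
  open ≡-Reasoning
  T : ℕ → ℕ
  T n = ∑< n (λ z → z ⊓ (n ∸ z))
  rearr : ∀ t n e → 4 * (t + suc n) + e ≡ (4 * t + e) + 4 * suc n
  rearr = solve-∀
  square : ∀ n → n * n + 4 * suc n ≡ (2 + n) * (2 + n)
  square = solve-∀
  T-step : T (2 + n) ≡ T n + suc n
  T-step = begin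
    ∑< (suc n) (λ i → suc i ⊓ (suc n ∸ i))             ≡⟨ ∑<-cong (suc n) (λ i i<n → cong (suc i ⊓_) (+-∸-assoc 1 (s≤s⁻¹ i<n))) ⟩
    ∑< (suc n) (λ i → 1 + (i ⊓ (n ∸ i)))               ≡⟨ ∑<-+ (suc n) (λ _ → 1) (λ i → i ⊓ (n ∸ i)) ⟩
    ∑< (suc n) (λ _ → 1) + ∑< (suc n) (λ i → i ⊓ (n ∸ i))
      ≡⟨ cong₂ _+_ (trans (∑<-const (suc n) 1) (*-identityʳ (suc n))) (∑<-last n (λ i → i ⊓ (n ∸ i))) ⟩
    suc n + (T n + (n ⊓ (n ∸ n)))                      ≡⟨ cong (λ x → suc n + (T n + (n ⊓ x))) (n∸n≡0 n) ⟩
    suc n + (T n + (n ⊓ 0))                            ≡⟨ cong (λ x → suc n + (T n + x)) (⊓-zeroʳ n) ⟩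
    suc n + (T n + 0)                                  ≡⟨ trans (cong (suc n +_) (+-identityʳ (T n))) (+-comm (suc n) (T n)) ⟩
    T n + suc n                                        ∎

∑-∥∥ : ∀ n .{{_ : NonZero n}} → 4 * ∑< n (λ z → ∥ z ∥ n) + ε n ≡ n * n
∑-∥∥ n = trans (cong (λ x → 4 * x + ε n) (∑<-cong n (λ z z<n → ∥∥-< n z<n))) (∑-⊓ n)

-- `J * J` is `J` plus twice the triangle `1 + ... + (J - 1)`; a small `n` cuts the triangle off,
-- hence only an inequality.
∑-∸-suc : ∀ n J → J + 2 * ∑< n (λ i → J ∸ suc i) ≤ J * J
∑-∸-suc n zero = ≤-reflexive (cong (2 *_) (trans (∑<-const n 0) (*-zeroʳ n)))
∑-∸-suc zero (suc J) = ≤-trans (≤-reflexive (+-identityʳ (suc J))) (m≤m*n (suc J) (suc J))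
∑-∸-suc (suc n) (suc J) = begin
  suc J + 2 * (J + S)         ≡⟨ eq₁ J S ⟩
  1 + 2 * J + (J + 2 * S)     ≤⟨ +-monoʳ-≤ (1 + 2 * J) (∑-∸-suc n J) ⟩
  1 + 2 * J + J * J           ≡⟨ eq₂ J ⟩
  suc J * suc J               ∎
  where
  open ≤-Reasoning
  S : ℕ
  S = ∑< n (λ i → J ∸ suc i)
  eq₁ : ∀ J S → suc J + 2 * (J + S) ≡ 1 + 2 * J + (J + 2 * S)
  eq₁ = solve-∀
  eq₂ : ∀ J → 1 + 2 * J + J * J ≡ suc J * suc J
  eq₂ = solve-∀

-- Each slope of a cone of height `J` around 0 is a triangle. Where the slopes meet on the far side
-- of the cycle their maximum is replaced by their sum, which makes the bound independent of `n`.
∑-∸-∥∥ : ∀ n .{{_ : NonZero n}} J → ∑< n (λ z → J ∸ ∥ z ∥ n) ≤ J * J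
∑-∸-∥∥ (suc n) J = begin
  ∑< (suc n) (λ z → J ∸ ∥ z ∥ (suc n))          ≡⟨ ∑<-cong (suc n) (λ z z<n → cong (J ∸_) (∥∥-< (suc n) z<n)) ⟩
  J + ∑< n (λ i → J ∸ (suc i ⊓ (n ∸ i)))        ≤⟨ +-monoʳ-≤ J (∑<-mono n (λ i _ → ≤-trans (≤-reflexive (∸-distribˡ-⊓-⊔ J (suc i) (n ∸ i))) (m⊔n≤m+n (J ∸ suc i) (J ∸ (n ∸ i))))) ⟩
  J + ∑< n (λ i → (J ∸ suc i) + (J ∸ (n ∸ i)))  ≡⟨ cong (J +_) (∑<-+ n (λ i → J ∸ suc i) (λ i → J ∸ (n ∸ i))) ⟩
  J + (S + ∑< n (λ i → J ∸ (n ∸ i)))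
    ≡⟨ cong (λ x → J + (S + x)) (trans (∑<-cong n (λ i i<n → cong (J ∸_) (aux i<n))) (∑<-reverse n (λ i → J ∸ suc i))) ⟩
  J + (S + S)                                   ≡⟨ cong (λ x → J + (S + x)) (sym (+-identityʳ S)) ⟩
  J + 2 * S                                     ≤⟨ ∑-∸-suc n J ⟩
  J * J                                         ∎
  where
  open ≤-Reasoning
  S : ℕ
  S = ∑< n (λ i → J ∸ suc i)
  aux : ∀ {n i} → i < n → n ∸ i ≡ suc (n ∸ suc i)
  aux {suc n} {i} (s≤s i≤n) = +-∸-assoc 1 i≤n

-- Potentials bound the edge load from below

sumₗ-allFin : ∀ {n} (f : Fin n → ℕ) → sumₗ (map f (allFin n)) ≡ sum f
sumₗ-allFin {n} f = trans (cong sumₗ (map-tabulate id f)) (go f)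
  where
  go : ∀ {n} (f : Fin n → ℕ) → sumₗ (tabulate f) ≡ sum f
  go {zero} f = refl
  go {suc n} f = cong (f Fin.zero +_) (go (f ∘ Fin.suc))

𝟙 : Bool → ℕ
𝟙 b = if b then 1 else 0

offDiag : ∀ {n} → Fin n → Fin n → ℕ → ℕ
offDiag x y k = if ⌊ x ≟ y ⌋ then 0 else k

countPaths-sum : ∀ {n} (R : Routing n) f →
  countPaths R f ≡ sum (λ x → sum (λ y → offDiag x y (𝟙 (f (R x y)))))
countPaths-sum R f = trans
  (sumₗ-allFin (λ x → sumₗ (map (λ y → offDiag x y (𝟙 (f (R x y)))) (allFin _))))
  (sum-cong-≗ (λ x → sumₗ-allFin (λ y → offDiag x y (𝟙 (f (R x y))))))

module _ {n : ℕ} (f : Fin n → ℕ) where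

  private
    go≤ : ∀ {m} (g : Fin m → ℕ) i → g i ≤ foldr _⊔_ 0 (tabulate g)
    go≤ g Fin.zero = m≤m⊔n _ _
    go≤ g (Fin.suc i) = ≤-trans (go≤ (g ∘ Fin.suc) i) (m≤n⊔m (g Fin.zero) _)

    go-lub : ∀ {m k} (g : Fin m → ℕ) → (∀ i → g i ≤ k) → foldr _⊔_ 0 (tabulate g) ≤ k
    go-lub {zero} g h = z≤n
    go-lub {suc m} g h = ⊔-lub (h Fin.zero) (go-lub (g ∘ Fin.suc) (h ∘ Fin.suc))

  ≤-max-allFin : ∀ i → f i ≤ foldr _⊔_ 0 (map f (allFin n))
  ≤-max-allFin i = subst (λ l → f i ≤ foldr _⊔_ 0 l) (sym (map-tabulate id f)) (go≤ f i)

  max-allFin-lub : ∀ {k} → (∀ i → f i ≤ k) → foldr _⊔_ 0 (map f (allFin n)) ≤ k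
  max-allFin-lub h = subst (λ l → foldr _⊔_ 0 l ≤ _) (sym (map-tabulate id f)) (go-lub f h)

module _ {n : ℕ} (f : Fin n → Fin n → ℕ) where

  ≤-maxOver : ∀ u v → f u v ≤ maxOver f
  ≤-maxOver u v = ≤-trans (≤-max-allFin (f u) v) (≤-max-allFin (λ u → foldr _⊔_ 0 (map (f u) (allFin n))) u)

  maxOver-lub : ∀ {k} → (∀ u v → f u v ≤ k) → maxOver f ≤ k
  maxOver-lub h = max-allFin-lub (λ u → foldr _⊔_ 0 (map (f u) (allFin n))) (λ u → max-allFin-lub (f u) (h u))

≟-refl : ∀ {n} (u : Fin n) → ⌊ u ≟ u ⌋ ≡ true
≟-refl u with u ≟ u
... | yes _ = refl
... | no u≢u = contradiction refl u≢u

≟-≢ : ∀ {n} {u v : Fin n} → ¬ u ≡ v → ⌊ u ≟ v ⌋ ≡ false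
≟-≢ {u = u} {v} u≢v with u ≟ v
... | yes u≡v = contradiction u≡v u≢v
... | no _ = refl

𝟙-∨≤+ : ∀ a b → 𝟙 (a ∨ b) ≤ 𝟙 a + 𝟙 b
𝟙-∨≤+ true b = s≤s z≤n
𝟙-∨≤+ false b = ≤-refl

𝟙-∨ʳ : ∀ a b → 𝟙 b ≤ 𝟙 (a ∨ b)
𝟙-∨ʳ true true = ≤-refl
𝟙-∨ʳ true false = z≤n
𝟙-∨ʳ false b = ≤-refl

𝟙-∨-mono : ∀ {a b c d} → 𝟙 a ≤ 𝟙 c → 𝟙 b ≤ 𝟙 d → 𝟙 (a ∨ b) ≤ 𝟙 (c ∨ d)
𝟙-∨-mono {true} {b} {true} p q = ≤-refl
𝟙-∨-mono {false} {b} {c} {d} p q = ≤-trans q (𝟙-∨ʳ c d)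

usesArc-head : ∀ {n} (u v : Fin n) p → usesArc (u ∷ v ∷ p) u v ≡ true
usesArc-head u v p rewrite ≟-refl u | ≟-refl v = refl

usesArc-∷ : ∀ {n} (a : Fin n) p u v → 𝟙 (usesArc p u v) ≤ 𝟙 (usesArc (a ∷ p) u v)
usesArc-∷ a [] u v = z≤n
usesArc-∷ a (b ∷ p) u v = 𝟙-∨ʳ _ _

usesArc-∉ˡ : ∀ {n} {u : Fin n} {p} → All (λ w → ¬ u ≡ w) p → ∀ v → usesArc p u v ≡ false
usesArc-∉ˡ [] v = refl
usesArc-∉ˡ (h ∷ []) v = refl
usesArc-∉ˡ {p = a ∷ b ∷ _} (h ∷ hs@(_ ∷ _)) v =
  cong₂ (λ c d → (c ∧ ⌊ b ≟ v ⌋) ∨ d) (≟-≢ (h ∘ sym)) (usesArc-∉ˡ hs v)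

usesArc-∉ʳ : ∀ {n} {u : Fin n} {p} → All (λ w → ¬ u ≡ w) p → ∀ v → usesArc p v u ≡ false
usesArc-∉ʳ [] v = refl
usesArc-∉ʳ (h ∷ []) v = refl
usesArc-∉ʳ {p = a ∷ b ∷ _} (_ ∷ hs@(h ∷ _)) v =
  cong₂ _∨_ (trans (cong (⌊ a ≟ v ⌋ ∧_) (≟-≢ (h ∘ sym))) (∧-zeroʳ _)) (usesArc-∉ʳ hs v)

edgeLoad≤edgeπ : ∀ {n} (R : Routing n) u v → edgeLoad R u v ≤ edgeπ R
edgeLoad≤edgeπ R = ≤-maxOver (edgeLoad R)

arcLoad≤arcπ : ∀ {n} (R : Routing n) u v → arcLoad R u v ≤ arcπ R
arcLoad≤arcπ R = ≤-maxOver (arcLoad R)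

offDiag-mono : ∀ {n} (x y : Fin n) {j k} → (¬ x ≡ y → j ≤ k) → offDiag x y j ≤ offDiag x y k
offDiag-mono x y h with x ≟ y
... | yes _ = z≤n
... | no x≢y = h x≢y

offDiag-+ : ∀ {n} (x y : Fin n) j k → offDiag x y (j + k) ≡ offDiag x y j + offDiag x y k
offDiag-+ x y j k with x ≟ y
... | yes _ = refl
... | no _ = refl

-- A path uses an edge through one of its two arcs. This yields the middle inequality of all three
-- cases.
edgeπ≤2arcπ : ∀ {n} (R : Routing n) → edgeπ R ≤ 2 * arcπ R
edgeπ≤2arcπ {n} R = maxOver-lub (edgeLoad R) λ u v → begin
  edgeLoad R u v
    ≡⟨ countPaths-sum R (λ p → usesEdge p u v) ⟩
  sum (λ x → sum (λ y → offDiag x y (𝟙 (usesEdge (R x y) u v))))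
    ≤⟨ sum-mono (λ x → sum-mono (λ y → ≤-trans (offDiag-mono x y (λ _ → 𝟙-∨≤+ (usesArc (R x y) u v) _)) (≤-reflexive (offDiag-+ x y _ _)))) ⟩
  sum (λ x → sum (λ y → a u v x y + a v u x y))
    ≡⟨ sum-cong-≗ (λ x → ∑-distrib-+ (a u v x) (a v u x)) ⟩
  sum (λ x → sum (a u v x) + sum (a v u x))
    ≡⟨ ∑-distrib-+ (λ x → sum (a u v x)) (λ x → sum (a v u x)) ⟩
  sum (λ x → sum (a u v x)) + sum (λ x → sum (a v u x))
    ≡⟨ cong₂ _+_ (countPaths-sum R (λ p → usesArc p u v)) (countPaths-sum R (λ p → usesArc p v u)) ⟨
  arcLoad R u v + arcLoad R v u
    ≤⟨ +-mono-≤ (arcLoad≤arcπ R u v) (arcLoad≤arcπ R v u) ⟩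
  arcπ R + arcπ R
    ≡⟨ cong (arcπ R +_) (+-identityʳ (arcπ R)) ⟨
  2 * arcπ R ∎
  where
  open ≤-Reasoning
  a : Fin n → Fin n → Fin n → Fin n → ℕ
  a u v x y = offDiag x y (𝟙 (usesArc (R x y) u v))

module _ {n : ℕ} .{{_ : NonZero n}} where

  shift : ℕ → Fin n → Fin n
  shift d x = (toℕ x + d) mod n

  toℕ-shift : ∀ d x → toℕ (shift d x) ≡ (toℕ x + d) % n
  toℕ-shift d x = toℕ-fromℕ< _

  Step⇒shift : ∀ {d i j} → Step n d i j → shift d i ≡ j
  Step⇒shift {d} {i} {j} st = toℕ-injective (trans (toℕ-shift d i) (eq st))
    where
    eq : Step n d i j → (toℕ i + d) % n ≡ toℕ j
    eq (inj₁ e) = trans (cong (_% n) e) (m<n⇒m%n≡m (toℕ<n j))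
    eq (inj₂ e) = trans (cong (_% n) e) (trans ([m+n]%n≡m%n (toℕ j) n) (m<n⇒m%n≡m (toℕ<n j)))

  -- The index `i` stands for the edge between `i` and `i + d` and counts once however often `p`
  -- traverses it, so this measures length only along simple paths.
  usage : ℕ → List (Fin n) → ℕ
  usage d p = sum (λ i → 𝟙 (usesEdge p i (shift d i)))

  usage-∷ : ∀ d a p → usage d p ≤ usage d (a ∷ p)
  usage-∷ d a p = sum-mono (λ i → 𝟙-∨-mono {usesArc p i _} (usesArc-∷ a p i _) (usesArc-∷ a p _ i))

  -- Simplicity enters here: `u` does not recur, so the tail uses no edge at `u`, and the new arc
  -- raises the count at index `u` from 0 to 1.
  usage-forward : ∀ {d u v p} → Step n d u v → Unique (u ∷ v ∷ p) → usage d (v ∷ p) < usage d (u ∷ v ∷ p)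
  usage-forward {d} {u} {v} {p} st (u∉ ∷ _) =
    sum-mono-< (λ i → 𝟙-∨-mono {usesArc (v ∷ p) i _} (usesArc-∷ u (v ∷ p) i _) (usesArc-∷ u (v ∷ p) _ i)) u
      (subst (λ w → 𝟙 (usesEdge (v ∷ p) u w) < 𝟙 (usesEdge (u ∷ v ∷ p) u w)) (sym (Step⇒shift {d} st))
        (subst₂ (λ b c → 𝟙 b < 𝟙 c)
          (sym (cong₂ _∨_ (usesArc-∉ˡ u∉ v) (usesArc-∉ʳ u∉ v)))
          (sym (cong (_∨ usesArc (u ∷ v ∷ p) v u) (usesArc-head u v p)))
          ≤-refl))

  -- Now `u = v + d`, so the new edge is listed at index `v`.
  usage-backward : ∀ {d u v p} → Step n d v u → Unique (u ∷ v ∷ p) → usage d (v ∷ p) < usage d (u ∷ v ∷ p)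
  usage-backward {d} {u} {v} {p} st (u∉ ∷ _) =
    sum-mono-< (λ i → 𝟙-∨-mono {usesArc (v ∷ p) i _} (usesArc-∷ u (v ∷ p) i _) (usesArc-∷ u (v ∷ p) _ i)) v
      (subst (λ w → 𝟙 (usesEdge (v ∷ p) v w) < 𝟙 (usesEdge (u ∷ v ∷ p) v w)) (sym (Step⇒shift {d} st))
        (subst₂ (λ b c → 𝟙 b < 𝟙 c)
          (sym (cong₂ _∨_ (usesArc-∉ʳ u∉ v) (usesArc-∉ˡ u∉ v)))
          (sym (trans (cong (usesArc (u ∷ v ∷ p) v u ∨_) (usesArc-head u v p)) (∨-zeroʳ _)))
          ≤-refl))

walk-head : ∀ {n s x y p} → Walk n s x y p → ∃ λ q → p ≡ x ∷ q
walk-head single = _ , refl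
walk-head (step _ _) = _ , refl

-- A Lipschitz function on ℤₙ is presented as a periodic function on ℕ, so that a step is plain
-- addition; an inverse step is the opposite inequality.
record Potential (n s w₁ wₛ : ℕ) : Set where
  field
    F : ℕ → ℕ
    F-periodic : ∀ z → F (z + n) ≡ F z
    F-zero : F 0 ≡ 0
    F-1↑ : ∀ z → F z ≤ w₁ + F (z + 1)
    F-1↓ : ∀ z → F (z + 1) ≤ w₁ + F z
    F-s↑ : ∀ z → F z ≤ wₛ + F (z + s)
    F-s↓ : ∀ z → F (z + s) ≤ wₛ + F z

module _ {n s w₁ wₛ : ℕ} .{{_ : NonZero n}} (Φ : Potential n s w₁ wₛ) where
  open Potential Φ

  private
    displacement : Fin n → Fin n → ℕ
    displacement u y = toℕ y + (n ∸ toℕ u)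

    -- If `v = u + d` then `y - u = (y - v) + d`; a step that wraps around shifts this by one
    -- period.
    F-step : ∀ {d u v} → Step n d u v → ∀ y → F (displacement u y) ≡ F (displacement v y + d)
    F-step {d} {u} {v} (inj₁ e) y = cong F (trans (cong (toℕ y +_) eq) (sym (+-assoc (toℕ y) _ d)))
      where
      eq : n ∸ toℕ u ≡ n ∸ toℕ v + d
      eq = +-cancelˡ-≡ (toℕ u) _ _ (begin
        toℕ u + (n ∸ toℕ u)       ≡⟨ m+[n∸m]≡n (<⇒≤ (toℕ<n u)) ⟩
        n                         ≡⟨ m+[n∸m]≡n (<⇒≤ (toℕ<n v)) ⟨
        toℕ v + (n ∸ toℕ v)       ≡⟨ cong (_+ (n ∸ toℕ v)) e ⟨
        toℕ u + d + (n ∸ toℕ v)   ≡⟨ trans (+-assoc (toℕ u) d _) (cong (toℕ u +_) (+-comm d _)) ⟩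
        toℕ u + (n ∸ toℕ v + d)   ∎)
        where open ≡-Reasoning
    F-step {d} {u} {v} (inj₂ e) y = trans (sym (F-periodic _)) (cong F (trans (+-assoc (toℕ y) _ n) (trans (cong (toℕ y +_) eq) (sym (+-assoc (toℕ y) _ d)))))
      where
      eq : n ∸ toℕ u + n ≡ n ∸ toℕ v + d
      eq = +-cancelˡ-≡ (toℕ u) _ _ (begin
        toℕ u + (n ∸ toℕ u + n)      ≡⟨ +-assoc (toℕ u) _ n ⟨
        toℕ u + (n ∸ toℕ u) + n      ≡⟨ cong (_+ n) (m+[n∸m]≡n (<⇒≤ (toℕ<n u))) ⟩
        n + n                        ≡⟨ cong (_+ n) (m+[n∸m]≡n (<⇒≤ (toℕ<n v))) ⟨
        toℕ v + (n ∸ toℕ v) + n      ≡⟨ trans (+-assoc (toℕ v) _ n) (trans (cong (toℕ v +_) (+-comm _ n)) (sym (+-assoc (toℕ v) n _))) ⟩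
        toℕ v + n + (n ∸ toℕ v)      ≡⟨ cong (_+ (n ∸ toℕ v)) e ⟨
        toℕ u + d + (n ∸ toℕ v)      ≡⟨ trans (+-assoc (toℕ u) d _) (cong (toℕ u +_) (+-comm d _)) ⟩
        toℕ u + (n ∸ toℕ v + d)      ∎)
        where open ≡-Reasoning

    weightedLength : List (Fin n) → ℕ
    weightedLength p = w₁ * usage 1 p + wₛ * usage s p

    raise₁ : ∀ {a b a′ b′} → a < a′ → b ≤ b′ → w₁ + (w₁ * a + wₛ * b) ≤ w₁ * a′ + wₛ * b′
    raise₁ {a} {b} {a′} {b′} p q = begin
      w₁ + (w₁ * a + wₛ * b)   ≡⟨ +-assoc w₁ _ _ ⟨
      w₁ + w₁ * a + wₛ * b     ≡⟨ cong (_+ wₛ * b) (*-suc w₁ a) ⟨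
      w₁ * suc a + wₛ * b      ≤⟨ +-mono-≤ (*-monoʳ-≤ w₁ p) (*-monoʳ-≤ wₛ q) ⟩
      w₁ * a′ + wₛ * b′        ∎
      where open ≤-Reasoning

    raiseₛ : ∀ {a b a′ b′} → a ≤ a′ → b < b′ → wₛ + (w₁ * a + wₛ * b) ≤ w₁ * a′ + wₛ * b′
    raiseₛ {a} {b} {a′} {b′} p q = begin
      wₛ + (w₁ * a + wₛ * b)   ≡⟨ trans (cong (wₛ +_) (+-comm _ (wₛ * b))) (sym (+-assoc wₛ _ _)) ⟩
      wₛ + wₛ * b + w₁ * a     ≡⟨ trans (cong (_+ w₁ * a) (sym (*-suc wₛ b))) (+-comm _ (w₁ * a)) ⟩
      w₁ * a + wₛ * suc b      ≤⟨ +-mono-≤ (*-monoʳ-≤ w₁ p) (*-monoʳ-≤ wₛ q) ⟩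
      w₁ * a′ + wₛ * b′        ∎
      where open ≤-Reasoning

  F≤weightedLength : ∀ {u y p} → Walk n s u y p → Unique p → F (displacement u y) ≤ weightedLength p
  F≤weightedLength {u} single _ = ≤-trans (≤-reflexive (trans (cong F (m+[n∸m]≡n (<⇒≤ (toℕ<n u)))) (trans (F-periodic 0) F-zero))) z≤n
  F≤weightedLength {u} {y} (step {v = v} adj w) (u∉ ∷ uniq) with walk-head w | F≤weightedLength w uniq
  ... | q , refl | ih = go adj
    where
    go : Adj n s u v → F (displacement u y) ≤ weightedLength (u ∷ v ∷ q)
    go (inj₁ st) = begin
      F (displacement u y)        ≡⟨ F-step st y ⟩
      F (displacement v y + 1)    ≤⟨ F-1↓ _ ⟩
      w₁ + F (displacement v y)   ≤⟨ +-monoʳ-≤ w₁ ih ⟩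
      w₁ + weightedLength (v ∷ q) ≤⟨ raise₁ (usage-forward st (u∉ ∷ uniq)) (usage-∷ s u (v ∷ q)) ⟩
      weightedLength (u ∷ v ∷ q)  ∎
      where open ≤-Reasoning
    go (inj₂ (inj₁ st)) = begin
      F (displacement u y)            ≤⟨ F-1↑ _ ⟩
      w₁ + F (displacement u y + 1)   ≡⟨ cong (w₁ +_) (F-step st y) ⟨
      w₁ + F (displacement v y)       ≤⟨ +-monoʳ-≤ w₁ ih ⟩
      w₁ + weightedLength (v ∷ q)     ≤⟨ raise₁ (usage-backward st (u∉ ∷ uniq)) (usage-∷ s u (v ∷ q)) ⟩
      weightedLength (u ∷ v ∷ q)      ∎
      where open ≤-Reasoning
    go (inj₂ (inj₂ (inj₁ st))) = begin
      F (displacement u y)        ≡⟨ F-step st y ⟩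
      F (displacement v y + s)    ≤⟨ F-s↓ _ ⟩
      wₛ + F (displacement v y)   ≤⟨ +-monoʳ-≤ wₛ ih ⟩
      wₛ + weightedLength (v ∷ q) ≤⟨ raiseₛ (usage-∷ 1 u (v ∷ q)) (usage-forward st (u∉ ∷ uniq)) ⟩
      weightedLength (u ∷ v ∷ q)  ∎
      where open ≤-Reasoning
    go (inj₂ (inj₂ (inj₂ st))) = begin
      F (displacement u y)            ≤⟨ F-s↑ _ ⟩
      wₛ + F (displacement u y + s)   ≡⟨ cong (wₛ +_) (F-step st y) ⟨
      wₛ + F (displacement v y)       ≤⟨ +-monoʳ-≤ wₛ ih ⟩
      wₛ + weightedLength (v ∷ q)     ≤⟨ raiseₛ (usage-∷ 1 u (v ∷ q)) (usage-backward st (u∉ ∷ uniq)) ⟩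
      weightedLength (u ∷ v ∷ q)      ∎
      where open ≤-Reasoning

  -- Double counting: the sum over pairs is exchanged with the sum over the `n` edges of type `d`,
  -- each of load at most `edgeπ R`.
  total-usage : ∀ (R : Routing n) d → sum (λ x → sum (λ y → offDiag x y (usage d (R x y)))) ≤ n * edgeπ R
  total-usage R d = begin
    sum (λ x → sum (λ y → offDiag x y (usage d (R x y))))
      ≡⟨ sum-cong-≗ (λ x → sum-cong-≗ (λ y → offDiag-sum x y (λ i → 𝟙 (usesEdge (R x y) i (shift d i))))) ⟩
    sum (λ x → sum (λ y → sum (λ i → e x y i)))
      ≡⟨ sum-cong-≗ (λ x → ∑-comm (e x)) ⟩
    sum (λ x → sum (λ i → sum (λ y → e x y i)))
      ≡⟨ ∑-comm (λ x i → sum (λ y → e x y i)) ⟩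
    sum (λ i → sum (λ x → sum (λ y → e x y i)))
      ≡⟨ sum-cong-≗ (λ i → countPaths-sum R (λ p → usesEdge p i (shift d i))) ⟨
    sum (λ i → edgeLoad R i (shift d i))
      ≤⟨ sum-mono (λ i → edgeLoad≤edgeπ R i (shift d i)) ⟩
    sum {n} (λ _ → edgeπ R)
      ≡⟨ sum-const n (edgeπ R) ⟩
    n * edgeπ R ∎
    where
    open ≤-Reasoning
    e : Fin n → Fin n → Fin n → ℕ
    e x y i = offDiag x y (𝟙 (usesEdge (R x y) i (shift d i)))
    offDiag-sum : ∀ x y (f : Fin n → ℕ) → offDiag x y (sum f) ≡ sum (λ i → offDiag x y (f i))
    offDiag-sum x y f with x ≟ y
    ... | yes _ = sym (trans (sum-const n 0) (*-zeroʳ n))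
    ... | no _ = refl

  -- From each source the displacements run once through a period, so all pairs together give
  -- `n * ∑< n F`. Each of the two edge types contributes `n` edges, and the factor `n` cancels.
  ∑F≤edgeπ : ∀ (R : Routing n) → IsRouting n s R → ∑< n F ≤ (w₁ + wₛ) * edgeπ R
  ∑F≤edgeπ R routing = *-cancelˡ-≤ n (begin
    n * ∑< n F
      ≡⟨ sum-const n (∑< n F) ⟨
    sum {n} (λ _ → ∑< n F)
      ≡⟨ sum-cong-≗ {n} (λ x → trans (∑<-cong n (λ z _ → cong F (+-comm z (n ∸ toℕ x)))) (∑<-shift n F F-periodic (n ∸ toℕ x))) ⟨
    sum (λ x → sum (λ y → F (displacement x y)))
      ≤⟨ sum-mono (λ x → sum-mono (λ y → bound x y)) ⟩
    sum (λ x → sum (λ y → w₁ * U 1 x y + wₛ * U s x y))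
      ≡⟨ sum-cong-≗ (λ x → trans (∑-distrib-+ (λ y → w₁ * U 1 x y) (λ y → wₛ * U s x y)) (cong₂ _+_ (sum-*ˡ w₁ (U 1 x)) (sum-*ˡ wₛ (U s x)))) ⟩
    sum (λ x → w₁ * sum (U 1 x) + wₛ * sum (U s x))
      ≡⟨ trans (∑-distrib-+ (λ x → w₁ * sum (U 1 x)) (λ x → wₛ * sum (U s x))) (cong₂ _+_ (sum-*ˡ w₁ (λ x → sum (U 1 x))) (sum-*ˡ wₛ (λ x → sum (U s x)))) ⟩
    w₁ * sum (λ x → sum (U 1 x)) + wₛ * sum (λ x → sum (U s x))
      ≤⟨ +-mono-≤ (*-monoʳ-≤ w₁ (total-usage R 1)) (*-monoʳ-≤ wₛ (total-usage R s)) ⟩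
    w₁ * (n * edgeπ R) + wₛ * (n * edgeπ R)
      ≡⟨ rearr w₁ wₛ n (edgeπ R) ⟩
    n * ((w₁ + wₛ) * edgeπ R) ∎)
    where
    open ≤-Reasoning
    rearr : ∀ a b n p → a * (n * p) + b * (n * p) ≡ n * ((a + b) * p)
    rearr = solve-∀
    U : ℕ → Fin n → Fin n → ℕ
    U d x y = offDiag x y (usage d (R x y))
    bound : ∀ x y → F (displacement x y) ≤ w₁ * U 1 x y + wₛ * U s x y
    bound x y with x ≟ y
    ... | yes refl = ≤-trans (≤-reflexive (trans (cong F (m+[n∸m]≡n (<⇒≤ (toℕ<n x)))) (trans (F-periodic 0) F-zero))) z≤n
    ... | no x≢y = F≤weightedLength (proj₁ (routing x y x≢y)) (proj₂ (routing x y x≢y))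

-- The three lower bounds

cyclicPotential : ∀ n s .{{_ : NonZero n}} → Potential n s 1 s
cyclicPotential n s = record
  { F = λ z → ∥ z ∥ n
  ; F-periodic = ∥∥-periodic n
  ; F-zero = ∥∥-< n (>-nonZero⁻¹ n)
  ; F-1↑ = ∥∥-lip↑ n
  ; F-1↓ = ∥∥-lip↓ n
  ; F-s↑ = ∥∥-lip*↑ n s
  ; F-s↓ = ∥∥-lip*↓ n s
  }

lower-bound-cyclic : ∀ n s .{{_ : NonZero n}} (R : Routing n) → IsRouting n s R →
  n * n ∸ ε n ≤ 4 * (s + 1) * edgeπ R
lower-bound-cyclic n s R routing = begin
  n * n ∸ ε n               ≡⟨ cong (_∸ ε n) (∑-∥∥ n) ⟨
  4 * W + ε n ∸ ε n         ≡⟨ m+n∸n≡m (4 * W) (ε n) ⟩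
  4 * W                     ≤⟨ *-monoʳ-≤ 4 (∑F≤edgeπ (cyclicPotential n s) R routing) ⟩
  4 * ((1 + s) * edgeπ R)   ≡⟨ *-assoc 4 (1 + s) (edgeπ R) ⟨
  4 * (1 + s) * edgeπ R     ≡⟨ cong (λ x → 4 * x * edgeπ R) (+-comm 1 s) ⟩
  4 * (s + 1) * edgeπ R     ∎
  where
  open ≤-Reasoning
  W : ℕ
  W = ∑< n (λ z → ∥ z ∥ n)

halve : ∀ s → ∃ λ k → s ≡ k + k ⊎ s ≡ suc (k + k)
halve zero = 0 , inj₁ refl
halve (suc s) with halve s
... | k , inj₁ refl = k , inj₂ refl
... | k , inj₂ refl = suc k , inj₁ (cong suc (sym (+-suc k k)))

ε-even : ∀ k → ε (k + k) ≡ 0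
ε-even k = trans (cong (_% 2) (lemma k)) (m*n%n≡0 k 2)
  where
  lemma : ∀ k → k + k ≡ k * 2
  lemma = solve-∀

ε-odd : ∀ k → ε (suc (k + k)) ≡ 1
ε-odd k = trans (cong (_% 2) (lemma k)) ([m+kn]%n≡m%n 1 k 2)
  where
  lemma : ∀ k → suc (k + k) ≡ 1 + k * 2
  lemma = solve-∀

%-unique : ∀ {n a} b .{{_ : NonZero n}} → a < n → (a + b * n) % n ≡ a
%-unique {n} {a} b a<n = trans ([m+kn]%n≡m%n a b n) (m<n⇒m%n≡m a<n)

/-unique : ∀ {n a} b .{{_ : NonZero n}} → a < n → (a + b * n) / n ≡ b
/-unique {n} {a} b a<n = trans (+-distrib-/-∣ʳ a (n∣m*n b)) (cong₂ _+_ (m<n⇒m/n≡0 a<n) (m*n/n≡m b n))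
  where open import Data.Nat.Divisibility using (n∣m*n)

-- Modulo s², a vertex x₀ + s x₁ is reached from 0 by x₀ steps +1 and ∥ x₁ ∥ s steps ±s, or by
-- s ∸ x₀ steps -1 and ∥ x₁ + 1 ∥ s steps ±s.
module Torus (s : ℕ) .{{_ : NonZero s}} where

  dist : ℕ → ℕ → ℕ
  dist a b = (a + ∥ b ∥ s) ⊓ (s ∸ a + ∥ b + 1 ∥ s)

  F : ℕ → ℕ
  F z = dist (z % s) (z / s)

  F-dist : ∀ {a} b → a < s → F (a + b * s) ≡ dist a b
  F-dist b a<s = cong₂ dist (%-unique b a<s) (/-unique b a<s)

  private
    coords : ∀ (P : ℕ → Set) → (∀ a b → a < s → P (a + b * s)) → ∀ z → P z
    coords P h z = subst P (sym (m≡m%n+[m/n]*n z s)) (h (z % s) (z / s) (m%n<n z s))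

    +s : ∀ a b s → a + b * s + s ≡ a + (b + 1) * s
    +s = solve-∀

    +1 : ∀ a b s → a + b * s + 1 ≡ a + 1 + b * s
    +1 = solve-∀

    ++1 : ∀ {a b c} → b ≤ 1 + c → a + b ≤ 1 + (a + c)
    ++1 {a} {b} {c} h = ≤-trans (+-monoʳ-≤ a h) (≤-reflexive (+-suc a c))

    wrap : ∀ {a} b → a + 1 ≡ s → a + b * s + 1 ≡ 0 + (b + 1) * s
    wrap {a} b e = trans (+1 a b s) (trans (cong (_+ b * s) e) (cong (_* s) (+-comm 1 b)))

    s∸a≡1 : ∀ {a} → a + 1 ≡ s → s ∸ a ≡ 1
    s∸a≡1 {a} e = trans (cong (_∸ a) (sym e)) (m+n∸m≡n a 1)

    a<s⇒ : ∀ {a} → a < s → a + 1 < s ⊎ a + 1 ≡ s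
    a<s⇒ {a} a<s = m≤n⇒m<n∨m≡n (subst (_≤ s) (+-comm 1 a) a<s)

    s∸ : ∀ {a} → a + 1 < s → s ∸ a ≡ 1 + (s ∸ (a + 1))
    s∸ {a} h rewrite +-comm a 1 = +-∸-assoc 1 (<⇒≤ h)

    1≤s : 1 ≤ s
    1≤s = >-nonZero⁻¹ s

    F-s↑ : ∀ z → F z ≤ 1 + F (z + s)
    F-s↑ = coords _ λ a b a<s →
      subst₂ (λ x y → x ≤ 1 + y) (sym (F-dist b a<s)) (sym (trans (cong F (+s a b s)) (F-dist (b + 1) a<s)))
        (⊓-mono-≤ (++1 {a} (∥∥-lip↑ s b)) (++1 {s ∸ a} (∥∥-lip↑ s (b + 1))))

    F-s↓ : ∀ z → F (z + s) ≤ 1 + F z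
    F-s↓ = coords _ λ a b a<s →
      subst₂ (λ x y → x ≤ 1 + y) (sym (trans (cong F (+s a b s)) (F-dist (b + 1) a<s))) (sym (F-dist b a<s))
        (⊓-mono-≤ (++1 {a} (∥∥-lip↓ s b)) (++1 {s ∸ a} (∥∥-lip↓ s (b + 1))))

    -- Only the carry from `a = s - 1` to 0 needs an argument: there the second alternative at the
    -- old point costs `1 + ∥ b + 1 ∥ s`, one more than the first alternative at the new point.
    F-1 : ∀ z → F z ≤ 1 + F (z + 1) × F (z + 1) ≤ 1 + F z
    F-1 = coords _ go
      where
      go : ∀ a b → a < s → F (a + b * s) ≤ 1 + F (a + b * s + 1) × F (a + b * s + 1) ≤ 1 + F (a + b * s)
      go a b a<s with a<s⇒ a<s
      ... | inj₁ a+1<s rewrite trans (cong F (+1 a b s)) (F-dist b a+1<s) | F-dist b a<s | s∸ a+1<s | +-comm a 1 =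
            ⊓-mono-≤ (≤-trans (n≤1+n _) (n≤1+n _)) ≤-refl
          , ⊓-mono-≤ ≤-refl (≤-trans (n≤1+n _) (n≤1+n _))
      ... | inj₂ a+1≡s rewrite trans (cong F (wrap b a+1≡s)) (F-dist (b + 1) 1≤s) | F-dist b a<s | s∸a≡1 a+1≡s =
            ≤-trans (m⊓n≤n (a + ∥ b ∥ s) (1 + ∥ b + 1 ∥ s))
              (s≤s (⊓-glb ≤-refl (≤-trans (∥∥-lip↑ s (b + 1)) (+-monoˡ-≤ _ 1≤s))))
          , ≤-trans (m⊓n≤m _ _) (⊓-glb {_} {suc (a + ∥ b ∥ s)}
              (≤-trans (∥∥-lip↓ s b) (s≤s (m≤n+m (∥ b ∥ s) a)))
              (≤-trans (n≤1+n _) (n≤1+n _)))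

  potential : Potential (s * s) s 1 1
  potential = record
    { F = F
    ; F-periodic = coords _ λ a b a<s → trans (cong F (+ss a b s)) (trans (F-dist (b + s) a<s)
        (trans (cong₂ (λ x y → (a + x) ⊓ (s ∸ a + y)) (∥∥-periodic s b)
          (trans (cong (λ x → ∥ x ∥ s) (comm b s)) (∥∥-periodic s (b + 1)))) (sym (F-dist b a<s))))
    ; F-zero = trans (F-dist {0} 0 1≤s) (cong (λ x → x ⊓ (s + ∥ 1 ∥ s)) (∥∥-< s 1≤s))
    ; F-1↑ = proj₁ ∘ F-1
    ; F-1↓ = proj₂ ∘ F-1
    ; F-s↑ = F-s↑
    ; F-s↓ = F-s↓
    }
    where
    +ss : ∀ a b s → a + b * s + s * s ≡ a + (b + s) * s
    +ss = solve-∀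
    comm : ∀ b s → b + s + 1 ≡ b + 1 + s
    comm = solve-∀

  W : ℕ
  W = ∑< s (λ z → ∥ z ∥ s)

  W-suc : ∑< s (λ z → ∥ z + 1 ∥ s) ≡ W
  W-suc = trans (∑<-cong s (λ z _ → cong (λ x → ∥ x ∥ s) (+-comm z 1))) (∑<-shift s (λ z → ∥ z ∥ s) (∥∥-periodic s) 1)

  row : ℕ → ℕ
  row a = ∑< s (dist a)

  ∑F-rows : ∑< (s * s) F ≡ ∑< s row
  ∑F-rows = begin
    ∑< (s * s) F                                ≡⟨ ∑<-* s s F ⟩
    ∑< s (λ b → ∑< s (λ a → F (b * s + a)))     ≡⟨ ∑<-cong s (λ b _ → ∑<-cong s (λ a a<s → trans (cong F (+-comm (b * s) a)) (F-dist b a<s))) ⟩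
    ∑< s (λ b → ∑< s (λ a → dist a b))          ≡⟨ ∑-comm {s} {s} (λ b a → dist (toℕ a) (toℕ b)) ⟩
    ∑< s row                                    ∎
    where open ≡-Reasoning

  private
    ∑-const+ : ∀ c f → ∑< s (λ b → c + f b) ≡ s * c + ∑< s f
    ∑-const+ c f = trans (∑<-+ s (λ _ → c) f) (cong (_+ ∑< s f) (∑<-const s c))

  -- Here `s ∸ a` exceeds `a` by at least one, which pays for the one that `∥ b + 1 ∥ s` can save
  -- over `∥ b ∥ s`.
  row≥-low : ∀ {a} → a + a < s → s * ∥ a ∥ s + W ≤ row a
  row≥-low {a} h = subst (_≤ row a) (∑-const+ (∥ a ∥ s) (λ b → ∥ b ∥ s))
    (∑<-mono s λ b _ → ⊓-glb (+-monoˡ-≤ _ norm≤)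
      (≤-trans (+-mono-≤ norm≤ (∥∥-lip↑ s b)) (≤-trans (≤-reflexive (+-suc a _)) (+-monoˡ-≤ _ a<s∸a))))
    where
    norm≤ : ∥ a ∥ s ≤ a
    norm≤ = ≤-trans (m⊓n≤m _ _) (m%n≤m a s)
    a<s∸a : a < s ∸ a
    a<s∸a = m+n≤o⇒m≤o∸n (suc a) h

  -- The mirror case: the second alternative dominates, and its norms `∥ b + 1 ∥ s` again sum to `W`
  -- by rotation.
  row≥-high : ∀ {a} → a < s → s < a + a → s * ∥ a ∥ s + W ≤ row a
  row≥-high {a} a<s h = subst (_≤ row a) (trans (∑-const+ (∥ a ∥ s) (λ b → ∥ b + 1 ∥ s)) (cong (s * ∥ a ∥ s +_) W-suc))
    (∑<-mono s λ b _ → ⊓-glb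
      (≤-trans (+-mono-≤ norm≤ (∥∥-lip↓ s b)) (≤-trans (≤-reflexive (+-suc (s ∸ a) _)) (+-monoˡ-≤ _ s∸a<a)))
      (+-monoˡ-≤ _ norm≤))
    where
    norm≤ : ∥ a ∥ s ≤ s ∸ a
    norm≤ = ≤-trans (≤-reflexive (∥∥-< s a<s)) (m⊓n≤n _ _)
    s∸a<a : s ∸ a < a
    s∸a<a = +-cancelʳ-< a (s ∸ a) a (≤-<-trans (≤-reflexive (m∸n+n≡m (<⇒≤ a<s))) h)

  -- At `a = s / 2` both alternatives agree in the first summand, so the smaller of `∥ b ∥ s` and
  -- `∥ b + 1 ∥ s` counts. For `b < k` the norm still increases and nothing is lost; each of the
  -- other `k` values of `b` loses at most one.
  row≥-middle : ∀ {k} → s ≡ k + k → s * ∥ k ∥ s + W ≤ row k + k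
  row≥-middle {k} s≡k+k = begin
    s * ∥ k ∥ s + W            ≡⟨ ∑-const+ (∥ k ∥ s) (λ b → ∥ b ∥ s) ⟨
    ∑< s g                     ≡⟨ split g ⟩
    ∑< k g + ∑< k (λ i → g (k + i))
      ≤⟨ +-mono-≤ (∑<-mono k first) (∑<-mono k λ i _ → second (k + i)) ⟩
    ∑< k (dist k) + ∑< k (λ i → dist k (k + i) + 1)
      ≡⟨ cong (∑< k (dist k) +_) (∑<-+ k (λ i → dist k (k + i)) (λ _ → 1)) ⟩
    ∑< k (dist k) + (∑< k (λ i → dist k (k + i)) + ∑< k (λ _ → 1))
      ≡⟨ +-assoc (∑< k (dist k)) _ _ ⟨
    ∑< k (dist k) + ∑< k (λ i → dist k (k + i)) + ∑< k (λ _ → 1)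
      ≡⟨ cong₂ _+_ (sym (split (dist k))) (trans (∑<-const k 1) (*-identityʳ k)) ⟩
    row k + k                  ∎
    where
    open ≤-Reasoning
    g : ℕ → ℕ
    g b = ∥ k ∥ s + ∥ b ∥ s
    split : ∀ f → ∑< s f ≡ ∑< k f + ∑< k (λ i → f (k + i))
    split f = trans (cong (λ m → ∑< m f) s≡k+k) (∑<-split k k f)
    norm≤ : ∥ k ∥ s ≤ k
    norm≤ = ≤-trans (m⊓n≤m _ _) (m%n≤m k s)
    s∸k≡k : s ∸ k ≡ k
    s∸k≡k = trans (cong (_∸ k) s≡k+k) (m+n∸m≡n k k)
    norm≤′ : ∥ k ∥ s ≤ s ∸ k
    norm≤′ = subst (∥ k ∥ s ≤_) (sym s∸k≡k) norm≤
    first : ∀ b → b < k → g b ≤ dist k b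
    first b b<k = ⊓-glb (+-monoˡ-≤ _ norm≤) (+-mono-≤ norm≤′
      (≤-trans (≤-trans (m⊓n≤m _ _) (m%n≤m b s)) (≤-trans (⊓-glb (m≤m+n b 1)
        (≤-trans (<⇒≤ b<k) (m+n≤o⇒m≤o∸n k (≤-trans (+-monoʳ-≤ k (subst (_≤ k) (+-comm 1 b) b<k)) (≤-reflexive (sym s≡k+k))))))
        (≤-reflexive (sym (∥∥-< s b+1<s))))))
      where
      b+1<s : b + 1 < s
      b+1<s = ≤-trans (+-mono-<-≤ b<k (≤-trans (s≤s z≤n) b<k)) (≤-reflexive (sym s≡k+k))
    second : ∀ b → g b ≤ dist k b + 1
    second b = ≤-trans (⊓-glb {_} {suc (k + ∥ b ∥ s)} (≤-trans (+-monoˡ-≤ _ norm≤) (n≤1+n _)) (≤-trans (++1 {∥ k ∥ s} (∥∥-lip↑ s b)) (s≤s (+-monoˡ-≤ _ norm≤′))))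
      (≤-reflexive (+-comm 1 (dist k b)))

  ∑-norm-rows : ∑< s (λ a → s * ∥ a ∥ s + W) ≡ 2 * s * W
  ∑-norm-rows = begin
    ∑< s (λ a → s * ∥ a ∥ s + W)          ≡⟨ ∑<-+ s (λ a → s * ∥ a ∥ s) (λ _ → W) ⟩
    ∑< s (λ a → s * ∥ a ∥ s) + ∑< s (λ _ → W)
      ≡⟨ cong₂ _+_ (sum-*ˡ {s} s (λ a → ∥ toℕ a ∥ s)) (∑<-const s W) ⟩
    s * W + s * W                         ≡⟨ double s W ⟩
    2 * s * W                             ∎
    where
    open ≡-Reasoning
    double : ∀ s W → s * W + s * W ≡ 2 * s * W
    double = solve-∀

  ∑-rows-odd : ∀ {k} → s ≡ suc (k + k) → 2 * s * W ≤ ∑< s row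
  ∑-rows-odd {k} e = subst (_≤ ∑< s row) ∑-norm-rows (∑<-mono s go)
    where
    go : ∀ a → a < s → s * ∥ a ∥ s + W ≤ row a
    go a a<s with a ≤? k
    ... | yes a≤k = row≥-low (subst (a + a <_) (sym e) (s≤s (+-mono-≤ a≤k a≤k)))
    ... | no a≰k = row≥-high a<s (subst (_< a + a) (sym e) (≤-trans (≤-reflexive (cong suc (sym (+-suc k k)))) (+-mono-≤ (≰⇒> a≰k) (≰⇒> a≰k))))

  ∑-rows-even : ∀ {k} → s ≡ k + k → 2 * s * W ≤ ∑< s row + k
  ∑-rows-even {k} e = begin
    2 * s * W                            ≡⟨ ∑-norm-rows ⟨
    ∑< s (λ a → s * ∥ a ∥ s + W)         ≤⟨ ∑<-mono s go ⟩
    ∑< s (λ a → row a + spike k k a)     ≡⟨ ∑<-+ s row (spike k k) ⟩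
    ∑< s row + ∑< s (spike k k)          ≤⟨ +-monoʳ-≤ _ (∑-spike s k k) ⟩
    ∑< s row + k                         ∎
    where
    open ≤-Reasoning
    -- The value `c` at position `k`, 0 elsewhere: it charges the deficit to the middle row alone.
    spike : ℕ → ℕ → ℕ → ℕ
    spike c k a = if a ≡ᵇ k then c else 0
    ∑-spike : ∀ n c k → ∑< n (spike c k) ≤ c
    ∑-spike zero c k = z≤n
    ∑-spike (suc n) c zero = ≤-reflexive (trans (cong (c +_) (trans (∑<-const n 0) (*-zeroʳ n))) (+-identityʳ c))
    ∑-spike (suc n) c (suc k) = ∑-spike n c k
    spike-self : ∀ c k → spike c k k ≡ c
    spike-self c zero = refl
    spike-self c (suc k) = spike-self c k
    go : ∀ a → a < s → s * ∥ a ∥ s + W ≤ row a + spike k k a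
    go a a<s with <-cmp a k
    ... | tri< a<k _ _ = ≤-trans (row≥-low (subst (a + a <_) (sym e) (+-mono-< a<k a<k))) (m≤m+n _ _)
    ... | tri≈ _ refl _ = subst (λ x → s * ∥ a ∥ s + W ≤ row a + x) (sym (spike-self a a)) (row≥-middle e)
    ... | tri> _ _ k<a = ≤-trans (row≥-high a<s (subst (_< a + a) (sym e) (+-mono-< k<a k<a))) (m≤m+n _ _)

  -- The summand `s` on the right has a different source in each parity: for odd `s` it is `s` times
  -- the `ε` in the closed form of `W`, for even `s` it is twice the deficit `k` of the middle row.
  cube≤ : s * (s * s) ≤ 2 * ∑< (s * s) F + s
  cube≤ rewrite ∑F-rows with halve s
  ... | k , inj₁ e = begin
    s * (s * s)              ≡⟨ cong (s *_) (trans (sym (∑-∥∥ s)) (trans (cong (4 * W +_) (trans (cong ε e) (ε-even k))) (+-identityʳ _))) ⟩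
    s * (4 * W)              ≡⟨ eq₁ s W ⟩
    2 * (2 * s * W)          ≤⟨ *-monoʳ-≤ 2 (∑-rows-even {k} e) ⟩
    2 * (∑< s row + k)       ≡⟨ eq₂ (∑< s row) k ⟩
    2 * ∑< s row + (k + k)   ≡⟨ cong (2 * ∑< s row +_) e ⟨
    2 * ∑< s row + s         ∎
    where
    open ≤-Reasoning
    eq₁ : ∀ s W → s * (4 * W) ≡ 2 * (2 * s * W)
    eq₁ = solve-∀
    eq₂ : ∀ r k → 2 * (r + k) ≡ 2 * r + (k + k)
    eq₂ = solve-∀
  ... | k , inj₂ e = begin
    s * (s * s)              ≡⟨ cong (s *_) (trans (sym (∑-∥∥ s)) (cong (4 * W +_) (trans (cong ε e) (ε-odd k)))) ⟩
    s * (4 * W + 1)          ≡⟨ eq₁ s W ⟩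
    2 * (2 * s * W) + s      ≤⟨ +-monoˡ-≤ s (*-monoʳ-≤ 2 (∑-rows-odd {k} e)) ⟩
    2 * ∑< s row + s         ∎
    where
    open ≤-Reasoning
    eq₁ : ∀ s W → s * (4 * W + 1) ≡ 2 * (2 * s * W) + s
    eq₁ = solve-∀

lower-bound-torus : ∀ n s .{{_ : NonZero s}} → s * s ≡ n → (R : Routing n) → IsRouting n s R →
  s * (n ∸ 1) ≤ 4 * edgeπ R
lower-bound-torus n s refl R routing = begin
  s * (s * s ∸ 1)             ≡⟨ trans (*-distribˡ-∸ s (s * s) 1) (cong (s * (s * s) ∸_) (*-identityʳ s)) ⟩
  s * (s * s) ∸ s             ≤⟨ ∸-monoˡ-≤ s cube≤ ⟩
  2 * ∑< (s * s) F + s ∸ s    ≡⟨ m+n∸n≡m _ s ⟩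
  2 * ∑< (s * s) F            ≤⟨ *-monoʳ-≤ 2 (∑F≤edgeπ {{m*n≢0 s s}} potential R routing) ⟩
  2 * (2 * edgeπ R)           ≡⟨ *-assoc 2 2 (edgeπ R) ⟨
  4 * edgeπ R                 ∎
  where
  open ≤-Reasoning
  open Torus s

-- Truncated distances and the size of balls

max< : ℕ → (ℕ → ℕ) → ℕ
max< zero f = 0
max< (suc m) f = f m ⊔ max< m f

≤-max< : ∀ m f {i} → i < m → f i ≤ max< m f
≤-max< (suc m) f {i} i≤m with i ℕ.≟ m
... | yes refl = m≤m⊔n _ _
... | no i≢m = ≤-trans (≤-max< m f (≤∧≢⇒< (s≤s⁻¹ i≤m) i≢m)) (m≤n⊔m (f m) _)

max<-lub : ∀ m f {k} → (∀ i → i < m → f i ≤ k) → max< m f ≤ k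
max<-lub zero f h = z≤n
max<-lub (suc m) f h = ⊔-lub (h m ≤-refl) (max<-lub m f (λ i i<m → h i (m≤n⇒m≤1+n i<m)))

max<≤∑< : ∀ m f → max< m f ≤ ∑< m f
max<≤∑< zero f = z≤n
max<≤∑< (suc m) f = begin
  f m ⊔ max< m f    ≤⟨ m⊔n≤m+n (f m) _ ⟩
  f m + max< m f    ≡⟨ +-comm (f m) _ ⟩
  max< m f + f m    ≤⟨ +-monoˡ-≤ (f m) (max<≤∑< m f) ⟩
  ∑< m f + f m      ≡⟨ ∑<-last m f ⟨
  ∑< (suc m) f      ∎
  where open ≤-Reasoning

∸-lip : ∀ M {a b} → a ≤ 1 + b → M ∸ b ≤ 1 + (M ∸ a)
∸-lip M {a} {b} h = m≤n+o⇒m∸n≤o M b (≤-trans (m≤n+m∸n M a) (≤-trans (+-monoˡ-≤ (M ∸ a) h) (≤-reflexive (sym (+-suc b (M ∸ a))))))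

∑-squares : ∀ M → 6 * ∑< M (λ i → i * i) + 3 * (M * M) ≡ 2 * (M * M * M) + M
∑-squares zero = refl
∑-squares (suc M) = begin
  6 * ∑< (suc M) (λ i → i * i) + 3 * (suc M * suc M)   ≡⟨ cong (λ x → 6 * x + 3 * (suc M * suc M)) (∑<-last M (λ i → i * i)) ⟩
  6 * (S + M * M) + 3 * (suc M * suc M)                ≡⟨ eq₁ S M ⟩
  6 * S + 3 * (M * M) + (6 * (M * M) + 6 * M + 3)      ≡⟨ cong (_+ (6 * (M * M) + 6 * M + 3)) (∑-squares M) ⟩
  2 * (M * M * M) + M + (6 * (M * M) + 6 * M + 3)      ≡⟨ eq₂ M ⟩
  2 * (suc M * suc M * suc M) + suc M                  ∎
  where
  open ≡-Reasoning
  S : ℕ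
  S = ∑< M (λ i → i * i)
  eq₁ : ∀ S M → 6 * (S + M * M) + 3 * (suc M * suc M) ≡ 6 * S + 3 * (M * M) + (6 * (M * M) + 6 * M + 3)
  eq₁ = solve-∀
  eq₂ : ∀ M → 2 * (M * M * M) + M + (6 * (M * M) + 6 * M + 3) ≡ 2 * (suc M * suc M * suc M) + suc M
  eq₂ = solve-∀

-- F z is the graph distance from 0 to z truncated at M, the distance being the minimum of
-- b + ∥ z ± b s ∥ over the number b of s-steps. The truncation makes ∑ F computable without
-- knowing the distances: M ∸ F is at most the sum over b of the contributions of the two signs.
module Ball (n s : ℕ) .{{_ : NonZero n}} (s≤n : s ≤ n) (M : ℕ) where

  term : ℕ → ℕ → ℕ → ℕ
  term d b z = M ∸ (b + ∥ z + b * d ∥ n)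

  s̄ : ℕ
  s̄ = n ∸ s

  -- Index `i` stands for `i + 1` steps in either direction, a step back being the addition of `s̄`.
  -- The number 0 is kept apart: the directions coincide there, and it must be counted once.
  both : ℕ → ℕ → ℕ
  both z i = term s (suc i) z ⊔ term s̄ (suc i) z

  height : ℕ → ℕ
  height z = term s 0 z ⊔ max< M (both z)

  F : ℕ → ℕ
  F z = M ∸ height z

  private
    term≥M : ∀ d {b} z → M ≤ b → term d b z ≤ 0
    term≥M d z M≤b = ≤-reflexive (m≤n⇒m∸n≡0 (≤-trans M≤b (m≤m+n _ _)))

    -- Beyond `M` steps the term is 0, so the finite maximum dominates every `b`. The Lipschitz
    -- proofs can thus change `b` by one without boundary cases.
    term-s≤ : ∀ b z → term s b z ≤ height z
    term-s≤ zero z = m≤m⊔n _ _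
    term-s≤ (suc b) z with b <? M
    ... | yes b<M = ≤-trans (m≤m⊔n _ _) (≤-trans (≤-max< M (both z) b<M) (m≤n⊔m (term s 0 z) _))
    ... | no b≮M = ≤-trans (term≥M s z (m≤n⇒m≤1+n (≮⇒≥ b≮M))) z≤n

    term-s̄≤ : ∀ b z → term s̄ b z ≤ height z
    term-s̄≤ zero z = m≤m⊔n _ _
    term-s̄≤ (suc b) z with b <? M
    ... | yes b<M = ≤-trans (m≤n⊔m (term s (suc b) z) _) (≤-trans (≤-max< M (both z) b<M) (m≤n⊔m (term s 0 z) _))
    ... | no b≮M = ≤-trans (term≥M s̄ z (m≤n⇒m≤1+n (≮⇒≥ b≮M))) z≤n

    height-lub : ∀ {z k} → (∀ b → term s b z ≤ k) → (∀ b → term s̄ b z ≤ k) → height z ≤ k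
    height-lub {z} p q = ⊔-lub (p 0) (max<-lub M (both z) (λ i _ → ⊔-lub (p (suc i)) (q (suc i))))

    height-cong : ∀ {y z} → (∀ c → ∥ y + c ∥ n ≡ ∥ z + c ∥ n) → height y ≡ height z
    height-cong {y} {z} h = ≤-antisym (le h) (le (sym ∘ h))
      where
      le : ∀ {y z} → (∀ c → ∥ y + c ∥ n ≡ ∥ z + c ∥ n) → height y ≤ height z
      le {y} {z} h = height-lub (λ b → subst (_≤ height z) (cong (λ x → M ∸ (b + x)) (sym (h (b * s)))) (term-s≤ b z))
                                (λ b → subst (_≤ height z) (cong (λ x → M ∸ (b + x)) (sym (h (b * s̄)))) (term-s̄≤ b z))

    term-lip : ∀ d b {y z} → ∥ z + b * d ∥ n ≤ 1 + ∥ y + b * d ∥ n → term d b y ≤ 1 + term d b z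
    term-lip d b h = ∸-lip M (≤-trans (+-monoʳ-≤ b h) (≤-reflexive (+-suc b _)))

    +1-comm : ∀ z c → z + c + 1 ≡ z + 1 + c
    +1-comm = solve-∀

    height-1↑ : ∀ z → height (z + 1) ≤ 1 + height z
    height-1↑ z = height-lub (λ b → ≤-trans (term-lip s b (lip (b * s))) (s≤s (term-s≤ b z)))
                             (λ b → ≤-trans (term-lip s̄ b (lip (b * s̄))) (s≤s (term-s̄≤ b z)))
      where
      lip : ∀ c → ∥ z + c ∥ n ≤ 1 + ∥ z + 1 + c ∥ n
      lip c = subst (λ x → ∥ z + c ∥ n ≤ 1 + ∥ x ∥ n) (+1-comm z c) (∥∥-lip↑ n (z + c))

    height-1↓ : ∀ z → height z ≤ 1 + height (z + 1)
    height-1↓ z = height-lub (λ b → ≤-trans (term-lip s b (lip (b * s))) (s≤s (term-s≤ b (z + 1))))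
                             (λ b → ≤-trans (term-lip s̄ b (lip (b * s̄))) (s≤s (term-s̄≤ b (z + 1))))
      where
      lip : ∀ c → ∥ z + 1 + c ∥ n ≤ 1 + ∥ z + c ∥ n
      lip c = subst (λ x → ∥ x ∥ n ≤ 1 + ∥ z + c ∥ n) (+1-comm z c) (∥∥-lip↓ n (z + c))

    term-suc : ∀ d b y z → ∥ z + suc b * d ∥ n ≡ ∥ y + b * d ∥ n → term d b y ≤ 1 + term d (suc b) z
    term-suc d b y z h = ∸-lip M (s≤s (+-monoʳ-≤ b (≤-reflexive h)))

    term-pred : ∀ d b y z → ∥ z + b * d ∥ n ≡ ∥ y + suc b * d ∥ n → term d (suc b) y ≤ 1 + term d b z
    term-pred d b y z h = ≤-trans (∸-monoʳ-≤ M (≤-trans (n≤1+n _) (s≤s (+-monoʳ-≤ b (≤-reflexive h))))) (n≤1+n (term d b z))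

    forth : ∀ z b → ∥ z + suc b * s ∥ n ≡ ∥ z + s + b * s ∥ n
    forth z b = cong (λ x → ∥ x ∥ n) (sym (+-assoc z s (b * s)))

    back : ∀ z b → ∥ z + s + suc b * s̄ ∥ n ≡ ∥ z + b * s̄ ∥ n
    back z b = trans (cong (λ x → ∥ x ∥ n) (trans (rearr z s s̄ (b * s̄)) (cong (z + b * s̄ +_) (m+[n∸m]≡n s≤n)))) (∥∥-periodic n _)
      where
      rearr : ∀ z s t c → z + s + (t + c) ≡ z + c + (s + t)
      rearr = solve-∀

    -- Replacing `z` by `z + s` trades one step: `b` goes up in the forward direction and down in
    -- the backward one. For `b = 0` the directions agree, so the backward case is borrowed from the
    -- forward one.
    height-s↑ : ∀ z → height (z + s) ≤ 1 + height z
    height-s↑ z = height-lub plus minus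
      where
      plus : ∀ b → term s b (z + s) ≤ 1 + height z
      plus b = ≤-trans (term-suc s b (z + s) z (forth z b)) (s≤s (term-s≤ (suc b) z))
      minus : ∀ b → term s̄ b (z + s) ≤ 1 + height z
      minus zero = plus zero
      minus (suc b) = ≤-trans (term-pred s̄ b (z + s) z (sym (back z b))) (s≤s (term-s̄≤ b z))

    height-s↓ : ∀ z → height z ≤ 1 + height (z + s)
    height-s↓ z = height-lub plus minus
      where
      minus : ∀ b → term s̄ b z ≤ 1 + height (z + s)
      minus b = ≤-trans (term-suc s̄ b z (z + s) (back z b)) (s≤s (term-s̄≤ (suc b) (z + s)))
      plus : ∀ b → term s b z ≤ 1 + height (z + s)
      plus zero = minus zero
      plus (suc b) = ≤-trans (term-pred s b z (z + s) (sym (forth z b))) (s≤s (term-s≤ b (z + s)))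

  potential : Potential n s 1 1
  potential = record
    { F = F
    ; F-periodic = λ z → cong (M ∸_) (height-cong (λ c → trans (cong (λ x → ∥ x ∥ n) (rearr z c)) (∥∥-periodic n (z + c))))
    ; F-zero = m≤n⇒m∸n≡0 (≤-trans (≤-reflexive (cong (M ∸_) (sym (∥∥-< n (>-nonZero⁻¹ n))))) (term-s≤ 0 0))
    ; F-1↑ = λ z → ∸-lip M (height-1↑ z)
    ; F-1↓ = λ z → ∸-lip M (height-1↓ z)
    ; F-s↑ = λ z → ∸-lip M (height-s↑ z)
    ; F-s↓ = λ z → ∸-lip M (height-s↓ z)
    }
    where
    rearr : ∀ z c → z + n + c ≡ z + c + n
    rearr z c = trans (+-assoc z n c) (trans (cong (z +_) (+-comm n c)) (sym (+-assoc z c n)))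

  -- For fixed `b` the terms form a rotated cone of height `M ∸ b` on the cycle.
  ∑-term : ∀ d b → ∑< n (term d b) ≤ (M ∸ b) * (M ∸ b)
  ∑-term d b = begin
    ∑< n (term d b)                            ≡⟨ ∑<-cong n (λ z _ → trans (sym (∸-+-assoc M b (∥ z + b * d ∥ n))) (cong (λ x → M ∸ b ∸ ∥ x ∥ n) (+-comm z (b * d)))) ⟩
    ∑< n (λ z → M ∸ b ∸ ∥ b * d + z ∥ n)       ≡⟨ ∑<-shift n (λ z → M ∸ b ∸ ∥ z ∥ n) (λ z → cong (M ∸ b ∸_) (∥∥-periodic n z)) (b * d) ⟩
    ∑< n (λ z → M ∸ b ∸ ∥ z ∥ n)               ≤⟨ ∑-∸-∥∥ n (M ∸ b) ⟩
    (M ∸ b) * (M ∸ b)                          ∎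
    where open ≤-Reasoning

  -- Bounding the maximum by the sum gives `M²` for `b = 0` and `2 (M - b)²` for each `b` from 1 to
  -- `M`: the volume of the cone of height `M` over a diamond in ℤ².
  ∑-height : 3 * ∑< n height ≤ 2 * (M * M * M) + M
  ∑-height = begin
    3 * ∑< n height
      ≤⟨ *-monoʳ-≤ 3 (∑<-mono n λ z _ → ≤-trans (m⊔n≤m+n (term s 0 z) _) (+-monoʳ-≤ (term s 0 z)
           (≤-trans (max<≤∑< M (both z)) (∑<-mono M λ i _ → m⊔n≤m+n (term s (suc i) z) (term s̄ (suc i) z))))) ⟩
    3 * ∑< n (λ z → term s 0 z + ∑< M (λ i → term s (suc i) z + term s̄ (suc i) z))
      ≡⟨ cong (3 *_) (trans (∑<-+ n (term s 0) (λ z → ∑< M (λ i → term s (suc i) z + term s̄ (suc i) z))) (cong (∑< n (term s 0) +_) (∑-comm {n} {M} (λ z i → term s (suc (toℕ i)) (toℕ z) + term s̄ (suc (toℕ i)) (toℕ z))))) ⟩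
    3 * (∑< n (term s 0) + ∑< M (λ i → ∑< n (λ z → term s (suc i) z + term s̄ (suc i) z)))
      ≤⟨ *-monoʳ-≤ 3 (+-mono-≤ (∑-term s 0) (∑<-mono M λ i _ → ≤-trans (≤-reflexive (∑<-+ n (term s (suc i)) (term s̄ (suc i)))) (+-mono-≤ (∑-term s (suc i)) (∑-term s̄ (suc i))))) ⟩
    3 * (M * M + ∑< M (λ i → sq (M ∸ suc i) + sq (M ∸ suc i)))
      ≡⟨ cong (λ x → 3 * (M * M + x)) (trans (∑<-reverse M (λ i → sq i + sq i)) (∑<-+ M sq sq)) ⟩
    3 * (M * M + (∑< M sq + ∑< M sq))
      ≡⟨ rearr (M * M) (∑< M sq) ⟩
    6 * ∑< M sq + 3 * (M * M)
      ≡⟨ ∑-squares M ⟩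
    2 * (M * M * M) + M ∎
    where
    open ≤-Reasoning
    sq : ℕ → ℕ
    sq i = i * i
    rearr : ∀ a b → 3 * (a + (b + b)) ≡ 6 * b + 3 * a
    rearr = solve-∀

  -- As `F z + height z` is at least `M`, `∑ F` is at least `n M - (2 M³ + M) / 3`. The main part
  -- `n M - 2 M³ / 3` is largest at `2 M² = n`, whence the later choice of `M`.
  edgeπ-ball : ∀ (R : Routing n) → IsRouting n s R → 3 * n * M ≤ 6 * edgeπ R + (2 * (M * M * M) + M)
  edgeπ-ball R routing = begin
    3 * n * M                                      ≡⟨ trans (*-assoc 3 n M) (cong (3 *_) (sym (∑<-const n M))) ⟩
    3 * ∑< n (λ _ → M)                             ≤⟨ *-monoʳ-≤ 3 (∑<-mono n (λ z _ → ≤-trans (m≤n+m∸n M (height z)) (≤-reflexive (+-comm (height z) (F z))))) ⟩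
    3 * ∑< n (λ z → F z + height z)                ≡⟨ trans (cong (3 *_) (∑<-+ n F height)) (*-distribˡ-+ 3 (∑< n F) _) ⟩
    3 * ∑< n F + 3 * ∑< n height                   ≤⟨ +-mono-≤ (*-monoʳ-≤ 3 (∑F≤edgeπ potential R routing)) ∑-height ⟩
    3 * (2 * edgeπ R) + (2 * (M * M * M) + M)      ≡⟨ cong (_+ (2 * (M * M * M) + M)) (*-assoc 3 2 (edgeπ R)) ⟨
    6 * edgeπ R + (2 * (M * M * M) + M)            ∎
    where open ≤-Reasoning

-- M = ⌊√(n/2)⌋ is about the radius of a ball of ℤ² with n points.
sqrt-half : ∀ n → ∃ λ M → 2 * (M * M) ≤ n × n < 2 * (suc M * suc M)
sqrt-half zero = 0 , z≤n , s≤s z≤n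
sqrt-half (suc n) with sqrt-half n
... | M , lo , hi with suc n <? 2 * (suc M * suc M)
... | yes hi′ = M , m≤n⇒m≤1+n lo , hi′
... | no ¬hi′ = suc M , ≮⇒≥ ¬hi′ , ≤-<-trans hi (*-monoʳ-< 2 (*-mono-< (n<1+n (suc M)) (n<1+n (suc M))))

-- For `w = √(2n)` one has `(w - 7)³ = w (2n + 147) - (42n + 343)`. So
-- `(n - 1)(w - 7)³ / (24n) ≤ p / 2` reads `w (n - 1)(2n + 147) ≤ 12np + (n - 1)(42n + 343)`; both
-- sides are nonnegative and may be squared.
SquaredBound : ℕ → ℕ → Set
SquaredBound n p = 2 * n * ((n ∸ 1) * (2 * n + 147)) * ((n ∸ 1) * (2 * n + 147))
  ≤ (12 * n * p + (n ∸ 1) * (42 * n + 343)) * (12 * n * p + (n ∸ 1) * (42 * n + 343))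

SquaredBound-mono : ∀ n {p p′} → p ≤ p′ → SquaredBound n p → SquaredBound n p′
SquaredBound-mono n p≤p′ h = ≤-trans h (*-mono-≤ le le)
  where
  le = +-monoˡ-≤ ((n ∸ 1) * (42 * n + 343)) (*-monoʳ-≤ (12 * n) p≤p′)

squaredBound? : ∀ n p → Dec (SquaredBound n p)
squaredBound? n p = _ ≤? _

-- For `n < 32` the root `√(2n)` is below 8, the cube below 1, and the index 1 is more than enough.
-- The 32 instances are decided by evaluation.
squaredBound-small : ∀ {n} → n < 32 → SquaredBound n 1
squaredBound-small n<32 = subst (λ n → SquaredBound n 1) (toℕ-fromℕ< n<32)
  (toWitness {a? = all? (λ (i : Fin 32) → squaredBound? (toℕ i) 1)} tt (fromℕ< n<32))

-- Since `√(2n) < 2M + 2`, the unsquared inequality with `2M + 2` in place of the root suffices.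
squaredBound-large : ∀ {n M} p → 4 ≤ M → 2 * (M * M) ≤ n → n < 2 * (suc M * suc M) →
  3 * n * M ≤ 6 * p + (2 * (M * M * M) + M) → SquaredBound n p
squaredBound-large {zero} {M} p _ _ _ _ = z≤n
squaredBound-large {n@(suc n′)} {M} p 4≤M lo hi h = begin
  2 * n * Y * Y
    ≤⟨ *-monoˡ-≤ Y (*-monoˡ-≤ Y (≤-trans (*-monoʳ-≤ 2 (<⇒≤ hi)) (≤-reflexive (eq₁ M)))) ⟩
  (2 * M + 2) * (2 * M + 2) * Y * Y
    ≡⟨ eq₂ (2 * M + 2) Y ⟩
  ((2 * M + 2) * Y) * ((2 * M + 2) * Y)
    ≤⟨ *-mono-≤ root root ⟩
  X * X ∎
  where
  open ≤-Reasoning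
  Y X : ℕ
  Y = n′ * (2 * n + 147)
  X = 12 * n * p + n′ * (42 * n + 343)
  eq₁ : ∀ M → 2 * (2 * (suc M * suc M)) ≡ (2 * M + 2) * (2 * M + 2)
  eq₁ = solve-∀
  eq₂ : ∀ a y → a * a * y * y ≡ (a * y) * (a * y)
  eq₂ = solve-∀
  eq₃ : ∀ n M → n * (4 * n * M) + 2 * n * (n * M + M) ≡ 2 * n * (3 * n * M) + 2 * n * M
  eq₃ = solve-∀
  eq₄ : ∀ n p M → 2 * n * (6 * p + (2 * (M * M * M) + M)) + 2 * n * M ≡ 12 * n * p + 4 * n * M + 2 * n * (2 * (M * M) * M)
  eq₄ = solve-∀
  eq₅ : ∀ n M → 2 * n * (n * M) + 2 * n * M ≡ 2 * n * (n * M + M)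
  eq₅ = solve-∀
  eq₆ : ∀ n M → suc n * (4 * suc n * M) ≡ n * (4 * suc n * M) + 4 * suc n * M
  eq₆ = solve-∀
  -- The hypothesis times `2n`, with `2M³ ≤ nM`. The error `4nM` is exactly what passing from `n` to
  -- `n′ = n - 1` on the left absorbs.
  main : n * (4 * n * M) ≤ 12 * n * p + 4 * n * M
  main = +-cancelʳ-≤ (2 * n * (n * M + M)) _ _ (begin
    n * (4 * n * M) + 2 * n * (n * M + M)                                  ≡⟨ eq₃ n M ⟩
    2 * n * (3 * n * M) + 2 * n * M                                        ≤⟨ +-monoˡ-≤ (2 * n * M) (*-monoʳ-≤ (2 * n) h) ⟩
    2 * n * (6 * p + (2 * (M * M * M) + M)) + 2 * n * M                    ≡⟨ eq₄ n p M ⟩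
    12 * n * p + 4 * n * M + 2 * n * (2 * (M * M) * M)                     ≤⟨ +-monoʳ-≤ (12 * n * p + 4 * n * M) (*-monoʳ-≤ (2 * n) (≤-trans (*-monoˡ-≤ M lo) (m≤m+n (n * M) M))) ⟩
    12 * n * p + 4 * n * M + 2 * n * (n * M + M)                           ∎)
  12np : n′ * (4 * n * M) ≤ 12 * n * p
  12np = +-cancelʳ-≤ (4 * n * M) _ _ (≤-trans (≤-reflexive (sym (eq₆ n′ M))) main)
  -- The place for `4 ≤ M`: `294 M ≤ 76 · 4 M ≤ 76 M² ≤ 38 n`, and `38 = 42 - 4` is what the
  -- coefficient of `n` in `X` leaves.
  slack : 294 * M + 294 ≤ 38 * n + 343
  slack = begin
    294 * M + 294              ≤⟨ +-mono-≤ (*-monoˡ-≤ M (toWitness {a? = 294 ≤? 304} tt)) (toWitness {a? = 294 ≤? 343} tt) ⟩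
    304 * M + 343              ≡⟨ cong (_+ 343) (*-assoc 76 4 M) ⟩
    76 * (4 * M) + 343         ≤⟨ +-monoˡ-≤ 343 (*-monoʳ-≤ 76 (*-monoˡ-≤ M 4≤M)) ⟩
    76 * (M * M) + 343         ≡⟨ cong (_+ 343) (*-assoc 38 2 (M * M)) ⟩
    38 * (2 * (M * M)) + 343   ≤⟨ +-monoˡ-≤ 343 (*-monoʳ-≤ 38 lo) ⟩
    38 * n + 343               ∎
  eq₇ : ∀ k n M → (2 * M + 2) * (k * (2 * n + 147)) ≡ k * (4 * n * M) + k * (4 * n + (294 * M + 294))
  eq₇ = solve-∀
  eq₈ : ∀ n → 4 * n + (38 * n + 343) ≡ 42 * n + 343
  eq₈ = solve-∀
  root : (2 * M + 2) * Y ≤ X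
  root = begin
    (2 * M + 2) * Y                                        ≡⟨ eq₇ n′ n M ⟩
    n′ * (4 * n * M) + n′ * (4 * n + (294 * M + 294))      ≤⟨ +-mono-≤ 12np (*-monoʳ-≤ n′ (≤-trans (+-monoʳ-≤ (4 * n) slack) (≤-reflexive (eq₈ n)))) ⟩
    X                                                      ∎

lower-bound-ball : ∀ n s .{{_ : NonZero n}} → s ≤ n → (R : Routing n) → IsRouting n s R →
  1 ≤ edgeπ R → SquaredBound n (edgeπ R)
-- `32 = 2 · 4²`, so the other case has `4 ≤ M`.
lower-bound-ball n s s≤n R routing 1≤π with n <? 32
... | yes n<32 = SquaredBound-mono n 1≤π (squaredBound-small n<32)
... | no n≮32 with sqrt-half n
...   | M , lo , hi with 4 ≤? M
...     | yes 4≤M = squaredBound-large (edgeπ R) 4≤M lo hi (Ball.edgeπ-ball n s s≤n M R routing)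
...     | no 4≰M = contradiction (<-≤-trans hi (*-monoʳ-≤ 2 (*-mono-≤ (≰⇒> 4≰M) (≰⇒> 4≰M)))) n≮32

-- Existence of optimal routings

-- Routings are functions, and pointwise equal ones need not be equal; so only measures that respect
-- the given relation are minimised.
Minimizable : {A : Set} → (A → A → Set) → (A → Set) → Set
Minimizable {A} _~_ P = ∀ (μ : A → ℕ) → (∀ {a b} → a ~ b → μ a ≡ μ b) →
  Σ A λ a → P a × (∀ b → P b → μ a ≤ μ b)

minimizable-list : ∀ {A : Set} {P : A → Set} (xs : List A) → All P xs → (∀ {b} → P b → b ∈ xs) →
  ∃ P → Minimizable _≡_ P
minimizable-list xs sound complete (a , Pa) μ _ =
  argmin μ a xs , argmin-all μ Pa sound , λ b Pb → All.lookup (f[argmin]≤f[xs] {f = μ} a xs) (complete Pb)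

-- One coordinate at a time: the best tail for every head, then the best head for the resulting
-- value. Related heads may select different tails, but minimality in both directions makes the
-- values equal.
minimizable-Π : ∀ {A : Set} {m} {_~_ : Fin m → A → A → Set} {P : Fin m → A → Set} →
  (∀ i {a} → (i ~ a) a) → (∀ i → Minimizable (i ~_) (P i)) →
  Minimizable {Fin m → A} (λ f g → ∀ i → (i ~ f i) (g i)) (λ f → ∀ i → P i (f i))
minimizable-Π {m = zero} ~-refl min μ resp = (λ ()) , (λ ()) , λ _ _ → ≤-reflexive (resp λ ())
minimizable-Π {A} {suc m} {_~_} {P} ~-refl min μ resp =
  (a₀ Vector.∷ rest a₀) , Pmin , minimal
  where
  tails : ∀ a → Σ (Fin m → A) λ g → (∀ i → P (Fin.suc i) (g i)) × (∀ h → (∀ i → P (Fin.suc i) (h i)) → μ (a Vector.∷ g) ≤ μ (a Vector.∷ h))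
  tails a = minimizable-Π (~-refl ∘ Fin.suc) (min ∘ Fin.suc) (λ g → μ (a Vector.∷ g))
    (λ g~h → resp λ { Fin.zero → ~-refl Fin.zero ; (Fin.suc i) → g~h i })
  rest : A → Fin m → A
  rest = proj₁ ∘ tails
  swap-head : ∀ {a b} g → (Fin.zero ~ a) b → μ (a Vector.∷ g) ≡ μ (b Vector.∷ g)
  swap-head g a~b = resp λ { Fin.zero → a~b ; (Fin.suc i) → ~-refl (Fin.suc i) }
  head-resp : ∀ {a b} → (Fin.zero ~ a) b → μ (a Vector.∷ rest a) ≡ μ (b Vector.∷ rest b)
  head-resp {a} {b} a~b = ≤-antisym
    (≤-trans (proj₂ (proj₂ (tails a)) (rest b) (proj₁ (proj₂ (tails b)))) (≤-reflexive (swap-head (rest b) a~b)))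
    (≤-trans (proj₂ (proj₂ (tails b)) (rest a) (proj₁ (proj₂ (tails a)))) (≤-reflexive (sym (swap-head (rest a) a~b))))
  head-min : Σ A λ a → P Fin.zero a × (∀ b → P Fin.zero b → μ (a Vector.∷ rest a) ≤ μ (b Vector.∷ rest b))
  head-min = min Fin.zero (λ a → μ (a Vector.∷ rest a)) head-resp
  a₀ : A
  a₀ = proj₁ head-min
  Pmin : ∀ i → P i ((a₀ Vector.∷ rest a₀) i)
  Pmin Fin.zero = proj₁ (proj₂ head-min)
  Pmin (Fin.suc i) = proj₁ (proj₂ (tails a₀)) i
  minimal : ∀ f → (∀ i → P i (f i)) → μ (a₀ Vector.∷ rest a₀) ≤ μ f
  minimal f Pf = begin
    μ (a₀ Vector.∷ rest a₀)                         ≤⟨ proj₂ (proj₂ head-min) (f Fin.zero) (Pf Fin.zero) ⟩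
    μ (f Fin.zero Vector.∷ rest (f Fin.zero))       ≤⟨ proj₂ (proj₂ (tails (f Fin.zero))) (f ∘ Fin.suc) (Pf ∘ Fin.suc) ⟩
    μ (f Fin.zero Vector.∷ (f ∘ Fin.suc))           ≡⟨ resp (λ { Fin.zero → ~-refl Fin.zero ; (Fin.suc i) → ~-refl (Fin.suc i) }) ⟩
    μ f                                             ∎
    where open ≤-Reasoning

lookup-unique-injective : ∀ {A : Set} {xs : List A} → Unique xs → ∀ {i j} → List.lookup xs i ≡ List.lookup xs j → i ≡ j
lookup-unique-injective (_ ∷ _) {Fin.zero} {Fin.zero} eq = refl
lookup-unique-injective {xs = _ ∷ xs} (x∉ ∷ _) {Fin.zero} {Fin.suc j} eq = contradiction eq (All.lookup x∉ (∈-lookup {xs = xs} j))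
lookup-unique-injective {xs = _ ∷ xs} (x∉ ∷ _) {Fin.suc i} {Fin.zero} eq = contradiction (sym eq) (All.lookup x∉ (∈-lookup {xs = xs} i))
lookup-unique-injective (_ ∷ u) {Fin.suc i} {Fin.suc j} eq = cong Fin.suc (lookup-unique-injective u eq)

-- Pigeonhole; it confines simple paths to a finite list of candidates.
length-unique : ∀ {n} {xs : List (Fin n)} → Unique xs → length xs ≤ n
length-unique u = injective⇒≤ (lookup-unique-injective u)

listsUpTo : ∀ n → ℕ → List (List (Fin n))
listsUpTo n zero = [] ∷ []
listsUpTo n (suc k) = [] ∷ cartesianProductWith _∷_ (allFin n) (listsUpTo n k)

∈-listsUpTo : ∀ {n} k (xs : List (Fin n)) → length xs ≤ k → xs ∈ listsUpTo n k
∈-listsUpTo zero [] _ = here refl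
∈-listsUpTo (suc k) [] _ = here refl
∈-listsUpTo (suc k) (x ∷ xs) (s≤s len) = there (∈-cartesianProductWith⁺ _∷_ (∈-allFin x) (∈-listsUpTo k xs len))

step? : ∀ n d i j → Dec (Step n d i j)
step? n d i j = (toℕ i + d ℕ.≟ toℕ j) ⊎-dec (toℕ i + d ℕ.≟ toℕ j + n)

adj? : ∀ n s i j → Dec (Adj n s i j)
adj? n s i j = step? n 1 i j ⊎-dec (step? n 1 j i ⊎-dec (step? n s i j ⊎-dec step? n s j i))

walk? : ∀ n s x y p → Dec (Walk n s x y p)
walk? n s x y [] = no λ ()
walk? n s x y (a ∷ []) with x ≟ a | x ≟ y
... | yes refl | yes refl = yes single
... | no x≢a | _ = no λ { single → x≢a refl ; (step _ ()) }
... | _ | no x≢y = no λ { single → x≢y refl ; (step _ ()) }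
walk? n s x y (a ∷ b ∷ p) with x ≟ a | adj? n s x b | walk? n s b y (b ∷ p)
... | yes refl | yes adj | yes w = yes (step adj w)
... | no x≢a | _ | _ = no λ { (step _ _) → x≢a refl }
... | _ | no ¬adj | _ = no λ { (step adj w) → ¬adj (subst (Adj n s x) (head≡ w) adj) }
  where
  head≡ : ∀ {v} → Walk n s v y (b ∷ p) → v ≡ b
  head≡ single = refl
  head≡ (step _ _) = refl
... | _ | _ | no ¬w = no λ { (step _ w) → ¬w (subst (λ v → Walk n s v y (b ∷ p)) (head≡ w) w) }
  where
  head≡ : ∀ {v} → Walk n s v y (b ∷ p) → v ≡ b
  head≡ single = refl
  head≡ (step _ _) = refl

isPath? : ∀ n s x y p → Dec (IsPath n s x y p)
isPath? n s x y p = walk? n s x y p ×-dec allPairs? (λ a b → ¬? (a ≟ b)) p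

-- The diagonal carries no constraint and no load, so there all values are identified.
_≈[_,_]_ : ∀ {n} → List (Fin n) → Fin n → Fin n → List (Fin n) → Set
p ≈[ x , y ] q = ¬ x ≡ y → p ≡ q

minimizable-path : ∀ n s x y → (¬ x ≡ y → ∃ (IsPath n s x y)) →
  Minimizable (λ p q → p ≈[ x , y ] q) (λ p → ¬ x ≡ y → IsPath n s x y p)
minimizable-path n s x y path μ resp with x ≟ y
... | yes x≡y = [] , (λ x≢y → contradiction x≡y x≢y) , λ _ _ → ≤-reflexive (resp λ x≢y → contradiction x≡y x≢y)
... | no x≢y with minimizable-list candidates (all-filter (isPath? n s x y) (listsUpTo n n)) complete (path x≢y) μ (cong μ)
  where
  candidates : List (List (Fin n))
  candidates = filter (isPath? n s x y) (listsUpTo n n)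
  complete : ∀ {p} → IsPath n s x y p → p ∈ candidates
  complete {p} isPath = ∈-filter⁺ (isPath? n s x y) (∈-listsUpTo n p (length-unique (proj₂ isPath))) isPath
...   | p , isPath , minimal = p , (λ _ → isPath) , λ b Pb → minimal b (Pb x≢y)

_≈_ : ∀ {n} → Routing n → Routing n → Set
R ≈ R′ = ∀ x y → R x y ≈[ x , y ] R′ x y

minimizable-routing : ∀ n s → Σ (Routing n) (IsRouting n s) → Minimizable _≈_ (IsRouting n s)
minimizable-routing n s (R , routing) =
  minimizable-Π (λ x y _ → refl) λ x →
  minimizable-Π (λ y _ → refl) λ y →
  minimizable-path n s x y λ x≢y → R x y , routing x y x≢y

countPaths-resp : ∀ {n} {R R′ : Routing n} f → R ≈ R′ → countPaths R f ≡ countPaths R′ f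
countPaths-resp {R = R} {R′} f R≈R′ = trans (countPaths-sum R f) (trans
  (sum-cong-≗ λ x → sum-cong-≗ λ y → offDiag-cong x y λ x≢y → cong (𝟙 ∘ f) (R≈R′ x y x≢y))
  (sym (countPaths-sum R′ f)))
  where
  offDiag-cong : ∀ {n} (x y : Fin n) {j k} → (¬ x ≡ y → j ≡ k) → offDiag x y j ≡ offDiag x y k
  offDiag-cong x y h with x ≟ y
  ... | yes _ = refl
  ... | no x≢y = h x≢y

maxOver-cong : ∀ {n} {f g : Fin n → Fin n → ℕ} → (∀ u v → f u v ≡ g u v) → maxOver f ≡ maxOver g
maxOver-cong {f = f} {g} h = ≤-antisym
  (maxOver-lub f λ u v → ≤-trans (≤-reflexive (h u v)) (≤-maxOver g u v))
  (maxOver-lub g λ u v → ≤-trans (≤-reflexive (sym (h u v))) (≤-maxOver f u v))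

edgeForwardingIndex : ∀ n s → Σ (Routing n) (IsRouting n s) → ∃ (IsEdgeForwardingIndex n s)
edgeForwardingIndex n s routing
  with minimizable-routing n s routing edgeπ (λ R≈R′ → maxOver-cong λ u v → countPaths-resp (λ p → usesEdge p u v) R≈R′)
... | R , isRouting , minimal = edgeπ R , (R , isRouting , refl) , minimal

arcForwardingIndex : ∀ n s → Σ (Routing n) (IsRouting n s) → ∃ (IsArcForwardingIndex n s)
arcForwardingIndex n s routing
  with minimizable-routing n s routing arcπ (λ R≈R′ → maxOver-cong λ u v → countPaths-resp (λ p → usesArc p u v) R≈R′)
... | R , isRouting , minimal = arcπ R , (R , isRouting , refl) , minimal

-- Translation-invariant routings

_⊑_ : ∀ {n} → List (Fin n) → List (Fin n) → Set
p ⊑ q = ∀ u v → 𝟙 (usesArc p u v) ≤ 𝟙 (usesArc q u v)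

walk-from : ∀ {n s x v y q} → Walk n s v y q → Unique q → x ∈ q → ∃ λ p → IsPath n s x y p × p ⊑ q
walk-from w@single u (here refl) = _ , (w , u) , λ _ _ → ≤-refl
walk-from w@(step _ _) u (here refl) = _ , (w , u) , λ _ _ → ≤-refl
walk-from (step {u = a} {p = q} _ w) (_ ∷ uniq) (there x∈q) with walk-from w uniq x∈q
... | p , isPath , p⊑q = p , isPath , λ b c → ≤-trans (p⊑q b c) (usesArc-∷ a q b c)

-- If the start recurs in the erased tail, the part of the tail from there on is already a path. No
-- arc is added, so loads cannot grow, and the walks used below need not be shown simple.
loopErase : ∀ {n s x y p} → Walk n s x y p → ∃ λ q → IsPath n s x y q × q ⊑ p
loopErase single = _ , (single , [] ∷ []) , λ _ _ → ≤-refl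
loopErase {n} {s} {x} (step {v = v} {p = p} adj w) with loopErase w
... | q , (wq , uq) , q⊑p with any? (x ≟_) q
...   | yes x∈q with walk-from wq uq x∈q
...     | q′ , isPath , q′⊑q = q′ , isPath , λ a b → ≤-trans (q′⊑q a b) (≤-trans (q⊑p a b) (usesArc-∷ x p a b))
loopErase {n} {s} {x} (step {v = v} adj w) | q , (wq , uq) , q⊑p | no x∉q with walk-head w | walk-head wq
...     | p′ , refl | q′ , refl = x ∷ v ∷ q′ , (step adj wq , ¬Any⇒All¬ _ x∉q ∷ uq) ,
          λ a b → 𝟙-∨-mono {⌊ x ≟ a ⌋ ∧ ⌊ v ≟ b ⌋} ≤-refl (q⊑p a b)

module _ {n : ℕ} .{{_ : NonZero n}} where

  mutual
    trace : Fin n → List ℕ → List (Fin n)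
    trace x ds = x ∷ trace⁺ x ds

    trace⁺ : Fin n → List ℕ → List (Fin n)
    trace⁺ x [] = []
    trace⁺ x (d ∷ ds) = trace (shift d x) ds

  endpoint : Fin n → List ℕ → Fin n
  endpoint x [] = x
  endpoint x (d ∷ ds) = endpoint (shift d x) ds

  trace-walk : ∀ {s} {ds} → All (λ d → ∀ x → Adj n s x (shift d x)) ds → ∀ x → Walk n s x (endpoint x ds) (trace x ds)
  trace-walk [] x = single
  trace-walk (adj ∷ adjs) x = step (adj x) (trace-walk adjs (shift _ x))

  toℕ-endpoint : ∀ x ds → toℕ (endpoint x ds) ≡ (toℕ x + sumₗ ds) % n
  toℕ-endpoint x [] = trans (sym (m<n⇒m%n≡m (toℕ<n x))) (cong (_% n) (sym (+-identityʳ (toℕ x))))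
  toℕ-endpoint x (d ∷ ds) = begin
    toℕ (endpoint (shift d x) ds)               ≡⟨ toℕ-endpoint (shift d x) ds ⟩
    (toℕ (shift d x) + sumₗ ds) % n         ≡⟨ cong (λ m → (m + sumₗ ds) % n) (toℕ-shift d x) ⟩
    ((toℕ x + d) % n + sumₗ ds) % n         ≡⟨ %-+ˡ (toℕ x + d) (sumₗ ds) ⟩
    (toℕ x + d + sumₗ ds) % n               ≡⟨ cong (_% n) (+-assoc (toℕ x) d _) ⟩
    (toℕ x + (d + sumₗ ds)) % n             ∎
    where
    open ≡-Reasoning
    %-+ˡ : ∀ a b → (a % n + b) % n ≡ (a + b) % n
    %-+ˡ a b = sym (begin
      (a + b) % n                         ≡⟨ cong (λ m → (m + b) % n) (m≡m%n+[m/n]*n a n) ⟩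
      (a % n + a / n * n + b) % n         ≡⟨ cong (_% n) (trans (+-assoc (a % n) _ b) (trans (cong (a % n +_) (+-comm _ b)) (sym (+-assoc (a % n) b _)))) ⟩
      (a % n + b + a / n * n) % n         ≡⟨ [m+kn]%n≡m%n (a % n + b) (a / n) n ⟩
      (a % n + b) % n                     ∎)

  shift-step : ∀ {d} → d < n → ∀ x → Step n d x (shift d x)
  shift-step {d} d<n x with toℕ x + d <? n
  ... | yes lt = inj₁ (sym (trans (toℕ-shift d x) (m<n⇒m%n≡m lt)))
  ... | no ≮ = inj₂ (sym (begin
    toℕ (shift d x) + n                 ≡⟨ cong (_+ n) (toℕ-shift d x) ⟩
    (toℕ x + d) % n + n                 ≡⟨ cong (λ m → m % n + n) (sym (m∸n+n≡m (≮⇒≥ ≮))) ⟩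
    (toℕ x + d ∸ n + n) % n + n         ≡⟨ cong (_+ n) (trans ([m+n]%n≡m%n _ n) (m<n⇒m%n≡m lt′)) ⟩
    toℕ x + d ∸ n + n                   ≡⟨ m∸n+n≡m (≮⇒≥ ≮) ⟩
    toℕ x + d                           ∎))
    where
    open ≡-Reasoning
    lt′ : toℕ x + d ∸ n < n
    lt′ = +-cancelʳ-< n _ n (subst (_< n + n) (sym (m∸n+n≡m (≮⇒≥ ≮))) (+-mono-< (toℕ<n x) d<n))

  step-flip : ∀ {d} → d ≤ n → ∀ {x y} → Step n (n ∸ d) x y → Step n d y x
  step-flip {d} d≤n {x} {y} (inj₁ e) = inj₂ (begin
    toℕ y + d                 ≡⟨ cong (_+ d) e ⟨
    toℕ x + (n ∸ d) + d       ≡⟨ trans (+-assoc (toℕ x) _ d) (cong (toℕ x +_) (m∸n+n≡m d≤n)) ⟩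
    toℕ x + n                 ∎)
    where open ≡-Reasoning
  step-flip {d} d≤n {x} {y} (inj₂ e) = inj₁ (+-cancelʳ-≡ n _ _ (begin
    toℕ y + d + n             ≡⟨ trans (+-assoc (toℕ y) d n) (trans (cong (toℕ y +_) (+-comm d n)) (sym (+-assoc (toℕ y) n d))) ⟩
    toℕ y + n + d             ≡⟨ cong (_+ d) e ⟨
    toℕ x + (n ∸ d) + d       ≡⟨ trans (+-assoc (toℕ x) _ d) (cong (toℕ x +_) (m∸n+n≡m d≤n)) ⟩
    toℕ x + n                 ∎))
    where open ≡-Reasoning

  sum-shift : ∀ (f : Fin n → ℕ) d → sum (λ x → f (shift d x)) ≡ sum f
  sum-shift f d = begin
    ∑< n (λ z → f ((z + d) mod n))    ≡⟨ ∑<-cong n (λ z _ → cong (λ m → f (m mod n)) (+-comm z d)) ⟩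
    ∑< n (λ z → f ((d + z) mod n))    ≡⟨ ∑<-shift n (λ z → f (z mod n)) (λ z → cong f (mod-cong ([m+n]%n≡m%n z n))) d ⟩
    ∑< n (λ z → f (z mod n))          ≡⟨ sum-cong-≗ (λ x → cong f (mod-toℕ x)) ⟩
    sum f                             ∎
    where
    open ≡-Reasoning
    mod-cong : ∀ {a b} → a % n ≡ b % n → a mod n ≡ b mod n
    mod-cong {a} {b} e = toℕ-injective (trans (Fin.toℕ-fromℕ< (m%n<n a n)) (trans e (sym (Fin.toℕ-fromℕ< (m%n<n b n)))))
    mod-toℕ : ∀ x → toℕ x mod n ≡ x
    mod-toℕ x = toℕ-injective (trans (Fin.toℕ-fromℕ< (m%n<n (toℕ x) n)) (m<n⇒m%n≡m (toℕ<n x)))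

  hits : Fin n → Fin n → ℕ → ℕ
  hits u v d = 𝟙 ⌊ shift d u ≟ v ⌋

  sum-at : ∀ (u : Fin n) (f : Fin n → Bool) → sum (λ x → 𝟙 (⌊ x ≟ u ⌋ ∧ f x)) ≤ 𝟙 (f u)
  sum-at = go
    where
    go : ∀ {m} (u : Fin m) (f : Fin m → Bool) → sum (λ x → 𝟙 (⌊ x ≟ u ⌋ ∧ f x)) ≤ 𝟙 (f u)
    go {suc m} Fin.zero f = ≤-reflexive (trans (cong (𝟙 (f Fin.zero) +_) (trans (sum-const m 0) (*-zeroʳ m))) (+-identityʳ _))
    go {suc m} (Fin.suc u) f = ≤-trans (sum-mono λ x → ≤-reflexive (cong (λ b → 𝟙 (b ∧ f (Fin.suc x))) (suc-≟ x u))) (go u (f ∘ Fin.suc))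
      where
      suc-≟ : ∀ {m} (x u : Fin m) → ⌊ Fin.suc x ≟ Fin.suc u ⌋ ≡ ⌊ x ≟ u ⌋
      suc-≟ x u with x ≟ u
      ... | yes _ = refl
      ... | no _ = refl

  -- Translation is a bijection of the vertices, so for each entry `d` of the word exactly one start
  -- puts that step at `u`, and it runs along the arc only if `u + d = v`.
  sum-trace : ∀ u v ds → sum (λ x → 𝟙 (usesArc (trace x ds) u v)) ≤ sumₗ (List.map (hits u v) ds)
  sum-trace u v [] = ≤-reflexive (trans (sum-const n 0) (*-zeroʳ n))
  sum-trace u v (d ∷ ds) = begin
    sum (λ x → 𝟙 ((⌊ x ≟ u ⌋ ∧ ⌊ shift d x ≟ v ⌋) ∨ usesArc (trace (shift d x) ds) u v))
      ≤⟨ sum-mono (λ x → 𝟙-∨≤+ (⌊ x ≟ u ⌋ ∧ ⌊ shift d x ≟ v ⌋) _) ⟩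
    sum (λ x → 𝟙 (⌊ x ≟ u ⌋ ∧ ⌊ shift d x ≟ v ⌋) + 𝟙 (usesArc (trace (shift d x) ds) u v))
      ≡⟨ ∑-distrib-+ (λ x → 𝟙 (⌊ x ≟ u ⌋ ∧ ⌊ shift d x ≟ v ⌋)) (λ x → 𝟙 (usesArc (trace (shift d x) ds) u v)) ⟩
    sum (λ x → 𝟙 (⌊ x ≟ u ⌋ ∧ ⌊ shift d x ≟ v ⌋)) + sum (λ x → 𝟙 (usesArc (trace (shift d x) ds) u v))
      ≤⟨ +-mono-≤ (sum-at u (λ x → ⌊ shift d x ≟ v ⌋)) (≤-trans (≤-reflexive (sum-shift (λ x → 𝟙 (usesArc (trace x ds) u v)) d)) (sum-trace u v ds)) ⟩
    hits u v d + sumₗ (List.map (hits u v) ds) ∎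
    where open ≤-Reasoning

  module Invariant {s} (ds : ℕ → List ℕ)
    (adjs : ∀ z → All (λ d → ∀ x → Adj n s x (shift d x)) (ds z))
    (reaches : ∀ z → z < n → sumₗ (ds z) % n ≡ z) where

    displacement : Fin n → Fin n → ℕ
    displacement x y = (n ∸ toℕ x + toℕ y) % n

    endpoint-displacement : ∀ x y → endpoint x (ds (displacement x y)) ≡ y
    endpoint-displacement x y = toℕ-injective (begin
      toℕ (endpoint x (ds z))               ≡⟨ toℕ-endpoint x (ds z) ⟩
      (toℕ x + sumₗ (ds z)) % n         ≡⟨ %-distribˡ-+ (toℕ x) (sumₗ (ds z)) n ⟩
      (toℕ x % n + sumₗ (ds z) % n) % n ≡⟨ cong (λ m → (toℕ x % n + m) % n) (reaches z (m%n<n _ n)) ⟩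
      (toℕ x % n + z) % n                   ≡⟨ %-distribˡ-+ (toℕ x) (n ∸ toℕ x + toℕ y) n ⟨
      (toℕ x + (n ∸ toℕ x + toℕ y)) % n     ≡⟨ cong (_% n) (trans (sym (+-assoc (toℕ x) _ (toℕ y))) (trans (cong (_+ toℕ y) (m+[n∸m]≡n (<⇒≤ (toℕ<n x)))) (+-comm n (toℕ y)))) ⟩
      (toℕ y + n) % n                       ≡⟨ trans ([m+n]%n≡m%n (toℕ y) n) (m<n⇒m%n≡m (toℕ<n y)) ⟩
      toℕ y                                 ∎)
      where
      open ≡-Reasoning
      z : ℕ
      z = displacement x y

    walk : ∀ x y → Walk n s x y (trace x (ds (displacement x y)))
    walk x y = subst (λ e → Walk n s x e (trace x (ds (displacement x y)))) (endpoint-displacement x y) (trace-walk (adjs (displacement x y)) x)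

    routing : Routing n
    routing x y = proj₁ (loopErase (walk x y))

    isRouting : IsRouting n s routing
    isRouting x y _ = proj₁ (proj₂ (loopErase (walk x y)))

    -- For a fixed source the targets are reindexed by displacement; then the sources are summed
    -- first, one word `ds z` at a time.
    arcLoad≤ : ∀ u v → arcLoad routing u v ≤ ∑< n (λ z → sumₗ (List.map (hits u v) (ds z)))
    arcLoad≤ u v = begin
      arcLoad routing u v
        ≡⟨ countPaths-sum routing (λ p → usesArc p u v) ⟩
      sum (λ x → sum (λ y → offDiag x y (𝟙 (usesArc (routing x y) u v))))
        ≤⟨ sum-mono (λ x → sum-mono (λ y → ≤-trans (offDiag≤ x y) (proj₂ (proj₂ (loopErase (walk x y))) u v))) ⟩
      sum {n} (λ x → sum {n} (λ y → f x ((n ∸ toℕ x + toℕ y) % n)))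
        ≡⟨ sum-cong-≗ {n} (λ x → trans (∑<-shift n (λ z → f x (z % n)) (λ z → cong (f x) ([m+n]%n≡m%n z n)) (n ∸ toℕ x)) (∑<-cong n (λ z z<n → cong (f x) (m<n⇒m%n≡m z<n)))) ⟩
      sum (λ x → ∑< n (f x))
        ≡⟨ ∑-comm (λ x (z : Fin n) → f x (toℕ z)) ⟩
      ∑< n (λ z → sum (λ x → f x z))
        ≤⟨ ∑<-mono n (λ z _ → sum-trace u v (ds z)) ⟩
      ∑< n (λ z → sumₗ (List.map (hits u v) (ds z))) ∎
      where
      open ≤-Reasoning
      f : Fin n → ℕ → ℕ
      f x z = 𝟙 (usesArc (trace x (ds z)) u v)
      offDiag≤ : ∀ (x y : Fin n) {k} → offDiag x y k ≤ k
      offDiag≤ x y with x ≟ y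
      ... | yes _ = z≤n
      ... | no _ = ≤-refl

-- The nearest-multiple routing

∑<-range : ∀ {l h} f → l ≤ h → ∑< l f ≤ ∑< h f
∑<-range {l} {h} f l≤h = ≤-trans (m≤m+n _ (∑< (h ∸ l) (λ i → f (l + i))))
  (≤-reflexive (trans (sym (∑<-split l (h ∸ l) f)) (cong (λ m → ∑< m f) (m+[n∸m]≡n l≤h))))

Half : ℕ → ℕ → Set
Half n h = n ≡ h + h ⊎ n ≡ suc (h + h)

choose : ∀ {A : Set} → ℕ → (ℕ → A) → (ℕ → A) → ℕ → A
choose n f g z with z + z ≤? n
... | yes _ = f z
... | no _ = g (n ∸ z)

choose-∘ : ∀ {A B : Set} (φ : A → B) n f g z → φ (choose n f g z) ≡ choose n (φ ∘ f) (φ ∘ g) z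
choose-∘ φ n f g z with z + z ≤? n
... | yes _ = refl
... | no _ = refl

-- The reflected arguments `n ∸ z` fill `1 .. h`, or `1 .. h - 1` for even `n`. Adding the missing
-- values of `g` gives both functions the same range, which treats opposite arcs alike.
∑-choose : ∀ {n h} .{{_ : NonZero n}} f g → Half n h → ∑< n (choose n f g) ≤ ∑< (suc h) f + ∑< (suc h) g
∑-choose {n} {h} f g half = begin
  ∑< n c                                               ≡⟨ cong (λ m → ∑< m c) (sym (m+[n∸m]≡n h<n)) ⟩
  ∑< (suc h + l) c                                     ≡⟨ ∑<-split (suc h) l c ⟩
  ∑< (suc h) c + ∑< l (λ i → c (suc h + i))            ≡⟨ cong₂ _+_ (∑<-cong (suc h) low) (∑<-cong l high) ⟩
  ∑< (suc h) f + ∑< l (λ i → g (suc (l ∸ suc i)))      ≡⟨ cong (∑< (suc h) f +_) (∑<-reverse l (g ∘ suc)) ⟩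
  ∑< (suc h) f + ∑< l (g ∘ suc)                        ≤⟨ +-monoʳ-≤ (∑< (suc h) f) (≤-trans (∑<-range (g ∘ suc) l≤h) (m≤n+m _ (g 0))) ⟩
  ∑< (suc h) f + ∑< (suc h) g                          ∎
  where
  open ≤-Reasoning
  c : ℕ → ℕ
  c = choose n f g
  l : ℕ
  l = n ∸ suc h
  bounds : ∀ {n} .{{_ : NonZero n}} → Half n h → suc h ≤ n × h + h ≤ n × n ≤ suc (h + h)
  bounds (inj₁ refl) = pos h , ≤-refl , n≤1+n _
    where
    pos : ∀ h .{{_ : NonZero (h + h)}} → suc h ≤ h + h
    pos (suc h) = ≤-trans (≤-reflexive (+-comm 1 (suc h))) (+-monoʳ-≤ (suc h) (s≤s z≤n))
  bounds (inj₂ refl) = s≤s (m≤m+n h h) , n≤1+n _ , ≤-refl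
  h<n : suc h ≤ n
  h<n = proj₁ (bounds half)
  l≤h : l ≤ h
  l≤h = ≤-trans (∸-monoˡ-≤ (suc h) (proj₂ (proj₂ (bounds half)))) (≤-reflexive (m+n∸m≡n h h))
  low : ∀ z → z < suc h → c z ≡ f z
  low z z≤h with z + z ≤? n
  ... | yes _ = refl
  ... | no ≰ = contradiction (≤-trans (+-mono-≤ (s≤s⁻¹ z≤h) (s≤s⁻¹ z≤h)) (proj₁ (proj₂ (bounds half)))) ≰
  high : ∀ i → i < l → c (suc h + i) ≡ g (suc (l ∸ suc i))
  high i i<l with suc h + i + (suc h + i) ≤? n
  ... | yes le = contradiction (≤-trans (≤-trans (s≤s (≤-reflexive (sym (+-suc h h)))) (+-mono-≤ (m≤m+n (suc h) i) (m≤m+n (suc h) i))) le)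
                               (<⇒≱ (s≤s (proj₂ (proj₂ (bounds half)))))
  ... | no _ = cong g (trans (sym (∸-+-assoc n (suc h) i)) (+-∸-assoc 1 i<l))

sum-replicate : ∀ m (φ : ℕ → ℕ) d → sumₗ (List.map φ (replicate m d)) ≡ m * φ d
sum-replicate zero φ d = refl
sum-replicate (suc m) φ d = cong (φ d +_) (sum-replicate m φ d)

module Steps (n s : ℕ) .{{_ : NonZero n}} (1<s : 1 < s) (2s<n : s + s < n) where

  s<n : s < n
  s<n = ≤-<-trans (m≤m+n s s) 2s<n

  1<n : 1 < n
  1<n = <-trans 1<s s<n

  -- Negative steps are written `n ∸ s` and `n ∸ 1`, so that a word has a sum in ℕ.
  steps : ℕ → ℕ → ℕ → ℕ → List ℕ
  steps a b c d = replicate a s ++ replicate b (n ∸ s) ++ replicate c 1 ++ replicate d (n ∸ 1)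

  sum-steps : ∀ φ a b c d → sumₗ (List.map φ (steps a b c d)) ≡ a * φ s + (b * φ (n ∸ s) + (c * φ 1 + d * φ (n ∸ 1)))
  sum-steps φ a b c d =
    trans (split (replicate a s) _) (cong₂ _+_ (sum-replicate a φ s)
      (trans (split (replicate b (n ∸ s)) _) (cong₂ _+_ (sum-replicate b φ (n ∸ s))
        (trans (split (replicate c 1) _) (cong₂ _+_ (sum-replicate c φ 1) (sum-replicate d φ (n ∸ 1)))))))
    where
    split : ∀ xs ys → sumₗ (List.map φ (xs ++ ys)) ≡ sumₗ (List.map φ xs) + sumₗ (List.map φ ys)
    split xs ys = trans (cong sumₗ (map-++ φ xs ys)) (sum-++ (List.map φ xs) (List.map φ ys))

  steps-adj : ∀ a b c d → All (λ e → ∀ x → Adj n s x (shift e x)) (steps a b c d)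
  steps-adj a b c d =
    ++⁺ (replicate⁺ a λ x → inj₂ (inj₂ (inj₁ (shift-step s<n x))))
    (++⁺ (replicate⁺ b λ x → inj₂ (inj₂ (inj₂ (step-flip (<⇒≤ s<n) (shift-step (∸-monoʳ-< {n} (<-trans (s≤s z≤n) 1<s) (<⇒≤ s<n)) x)))))
    (++⁺ (replicate⁺ c λ x → inj₁ (shift-step 1<n x))
    (replicate⁺ d λ x → inj₂ (inj₁ (step-flip (<⇒≤ 1<n) (shift-step (∸-monoʳ-< {n} (s≤s z≤n) (<⇒≤ 1<n)) x))))))

  module _ (u v : Fin n) where
    private
      w : ℕ
      w = (n ∸ toℕ u + toℕ v) % n

      hit⇒≡w : ∀ {d} → d < n → shift d u ≡ v → d ≡ w
      hit⇒≡w {d} d<n refl = sym (begin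
        (n ∸ toℕ u + toℕ (shift d u)) % n         ≡⟨ cong (λ m → (n ∸ toℕ u + m) % n) (toℕ-shift d u) ⟩
        (n ∸ toℕ u + (toℕ u + d) % n) % n         ≡⟨ %-+ʳ (n ∸ toℕ u) (toℕ u + d) ⟩
        (n ∸ toℕ u + (toℕ u + d)) % n             ≡⟨ cong (_% n) (trans (sym (+-assoc (n ∸ toℕ u) (toℕ u) d)) (trans (cong (_+ d) (m∸n+n≡m (<⇒≤ (toℕ<n u)))) (+-comm n d))) ⟩
        (d + n) % n                               ≡⟨ trans ([m+n]%n≡m%n d n) (m<n⇒m%n≡m d<n) ⟩
        d                                         ∎)
        where
        open ≡-Reasoning
        %-+ʳ : ∀ a b → (a + b % n) % n ≡ (a + b) % n
        %-+ʳ a b = sym (trans (cong (λ m → (a + m) % n) (m≡m%n+[m/n]*n b n)) (trans (cong (_% n) (sym (+-assoc a (b % n) _))) ([m+kn]%n≡m%n (a + b % n) (b / n) n)))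

      hits≤ : ∀ {d} → d < n → hits u v d ≤ 𝟙 ⌊ d ℕ.≟ w ⌋
      hits≤ {d} d<n with shift d u ≟ v | d ℕ.≟ w
      ... | no _ | _ = z≤n
      ... | yes _ | yes _ = ≤-refl
      ... | yes e | no d≢w = contradiction (hit⇒≡w d<n e) d≢w

      at-most-one : ∀ w a b c d → c < a → a < b → b < d →
        𝟙 ⌊ a ℕ.≟ w ⌋ + (𝟙 ⌊ b ℕ.≟ w ⌋ + (𝟙 ⌊ c ℕ.≟ w ⌋ + 𝟙 ⌊ d ℕ.≟ w ⌋)) ≤ 1
      at-most-one w a b c d c<a a<b b<d with a ℕ.≟ w | b ℕ.≟ w | c ℕ.≟ w | d ℕ.≟ w
      ... | yes refl | yes refl | _ | _ = contradiction a<b (<-irrefl refl)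
      ... | yes refl | _ | yes refl | _ = contradiction c<a (<-irrefl refl)
      ... | yes refl | _ | _ | yes refl = contradiction (<-trans a<b b<d) (<-irrefl refl)
      ... | _ | yes refl | yes refl | _ = contradiction (<-trans c<a a<b) (<-irrefl refl)
      ... | _ | yes refl | _ | yes refl = contradiction b<d (<-irrefl refl)
      ... | _ | _ | yes refl | yes refl = contradiction (<-trans c<a (<-trans a<b b<d)) (<-irrefl refl)
      ... | yes _ | no _ | no _ | no _ = ≤-refl
      ... | no _ | yes _ | no _ | no _ = ≤-refl
      ... | no _ | no _ | yes _ | no _ = ≤-refl
      ... | no _ | no _ | no _ | yes _ = ≤-refl
      ... | no _ | no _ | no _ | no _ = z≤n

    -- `1 < s < n ∸ s < n ∸ 1`, so an arc has at most one of the four types. Its load is therefore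
    -- bounded by the larger of the two type sums, not by their total.
    hits-total : hits u v s + (hits u v (n ∸ s) + (hits u v 1 + hits u v (n ∸ 1))) ≤ 1
    hits-total = ≤-trans
      (+-mono-≤ (hits≤ s<n) (+-mono-≤ (hits≤ n∸s<n) (+-mono-≤ (hits≤ 1<n) (hits≤ (∸-monoʳ-< {n} (s≤s z≤n) (<⇒≤ 1<n))))))
      (at-most-one w s (n ∸ s) 1 (n ∸ 1) 1<s (m+n≤o⇒m≤o∸n (suc s) 2s<n) (∸-monoʳ-< 1<s (<⇒≤ s<n)))
      where
      n∸s<n : n ∸ s < n
      n∸s<n = ∸-monoʳ-< {n} (<-trans (s≤s z≤n) 1<s) (<⇒≤ s<n)

-- For k = ⌊(s-1)/2⌋ the number β z is the integer nearest to z/s, with halves rounded down.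
module Route (n s k : ℕ) .{{_ : NonZero n}} .{{_ : NonZero s}} (1<s : 1 < s) (2s<n : s + s < n) where
  open Steps n s 1<s 2s<n

  β up down : ℕ → ℕ
  β z = (k + z) / s
  up z = z ∸ β z * s
  down z = β z * s ∸ z

  forward backward route : ℕ → List ℕ
  forward z = steps (β z) 0 (up z) (down z)
  backward z = steps 0 (β z) (down z) (up z)
  route = choose n forward backward

  route-adj : ∀ z → All (λ e → ∀ x → Adj n s x (shift e x)) (route z)
  route-adj z with z + z ≤? n
  ... | yes _ = steps-adj (β z) 0 (up z) (down z)
  ... | no _ = steps-adj 0 (β (n ∸ z)) (down (n ∸ z)) (up (n ∸ z))

  -- This is `z = β z * s + up z - down z`, freed of the negative term.
  up-down : ∀ z → z + down z ≡ β z * s + up z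
  up-down z with ≤-total z (β z * s)
  ... | inj₁ z≤βs = trans (m+[n∸m]≡n z≤βs) (trans (sym (+-identityʳ _)) (cong (β z * s +_) (sym (m≤n⇒m∸n≡0 z≤βs))))
  ... | inj₂ βs≤z = trans (cong (z +_) (m≤n⇒m∸n≡0 βs≤z)) (trans (+-identityʳ z) (sym (m+[n∸m]≡n βs≤z)))

  route-reaches : ∀ z → z < n → sumₗ (route z) % n ≡ z
  route-reaches z z<n with z + z ≤? n
  ... | yes _ = trans (cong (_% n) total) (%-unique (down z) z<n)
    where
    open ≡-Reasoning
    eq : ∀ b u d m → b + (0 + (u * 1 + d * m)) ≡ (b + u) + d * m
    eq = solve-∀
    -- Each step `-1` counts as `n ∸ 1`, one `n` too many.
    total : sumₗ (forward z) ≡ z + down z * n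
    total = begin
      sumₗ (forward z)                                                ≡⟨ trans (cong sumₗ (sym (map-id (forward z)))) (sum-steps (λ x → x) (β z) 0 (up z) (down z)) ⟩
      β z * s + (0 + (up z * 1 + down z * (n ∸ 1)))                   ≡⟨ eq (β z * s) (up z) (down z) (n ∸ 1) ⟩
      β z * s + up z + down z * (n ∸ 1)                               ≡⟨ cong (_+ down z * (n ∸ 1)) (sym (up-down z)) ⟩
      z + down z + down z * (n ∸ 1)                                   ≡⟨ trans (+-assoc z _ _) (cong (z +_) (sym (*-suc (down z) (n ∸ 1)))) ⟩
      z + down z * suc (n ∸ 1)                                        ≡⟨ cong (λ m → z + down z * m) (trans (+-comm 1 (n ∸ 1)) (m∸n+n≡m (<⇒≤ 1<n))) ⟩
      z + down z * n                                                  ∎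
  ... | no _ = begin
    -- The word sums to `-w` modulo `n`; the added `n = w + z` turns this into `z` plus a multiple
    -- of `n`.
    sumₗ (backward w) % n                       ≡⟨ [m+n]%n≡m%n (sumₗ (backward w)) n ⟨
    (sumₗ (backward w) + n) % n                 ≡⟨ cong (_% n) total ⟩
    (z + (β w + up w) * n) % n                  ≡⟨ %-unique (β w + up w) z<n ⟩
    z                                           ∎
    where
    open ≡-Reasoning
    w : ℕ
    w = n ∸ z
    eq₁ : ∀ b d u m w z → 0 + (b + (d * 1 + u * m)) + (w + z) ≡ b + (w + d) + u * m + z
    eq₁ = solve-∀
    eq₂ : ∀ b t s u m z → b * t + (b * s + u) + u * m + z ≡ z + (b * (t + s) + u * (m + 1))
    eq₂ = solve-∀
    total : sumₗ (backward w) + n ≡ z + (β w + up w) * n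
    total = begin
      sumₗ (backward w) + n
        ≡⟨ cong₂ _+_ (trans (cong sumₗ (sym (map-id (backward w)))) (sum-steps (λ x → x) 0 (β w) (down w) (up w))) (sym (m∸n+n≡m (<⇒≤ z<n))) ⟩
      0 + (β w * (n ∸ s) + (down w * 1 + up w * (n ∸ 1))) + (w + z)
        ≡⟨ eq₁ (β w * (n ∸ s)) (down w) (up w) (n ∸ 1) w z ⟩
      β w * (n ∸ s) + (w + down w) + up w * (n ∸ 1) + z
        ≡⟨ cong (λ x → β w * (n ∸ s) + x + up w * (n ∸ 1) + z) (up-down w) ⟩
      β w * (n ∸ s) + (β w * s + up w) + up w * (n ∸ 1) + z
        ≡⟨ eq₂ (β w) (n ∸ s) s (up w) (n ∸ 1) z ⟩
      z + (β w * (n ∸ s + s) + up w * (n ∸ 1 + 1))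
        ≡⟨ cong₂ (λ x y → z + (β w * x + up w * y)) (m∸n+n≡m (<⇒≤ s<n)) (m∸n+n≡m (<⇒≤ 1<n)) ⟩
      z + (β w * n + up w * n)
        ≡⟨ cong (z +_) (sym (*-distribʳ-+ n (β w) (up w))) ⟩
      z + (β w + up w) * n ∎

  open Invariant {s = s} route route-adj route-reaches public using (routing; isRouting; arcLoad≤)

  -- `up` loads the `+1`-arcs in forward words and the `-1`-arcs in reflected ones, `down` the other
  -- way round; so both signs receive the same total `∑α`.
  ∑β ∑α : ℕ → ℕ
  ∑β h = ∑< (suc h) β
  ∑α h = ∑< (suc h) up + ∑< (suc h) down

  module _ {h : ℕ} (half : Half n h) where

    arcπ≤ : ∀ {X} → ∑β h ≤ X → ∑α h ≤ X → arcπ routing ≤ X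
    arcπ≤ {X} β≤ α≤ = maxOver-lub (arcLoad routing) λ u v → begin
      arcLoad routing u v
        ≤⟨ arcLoad≤ u v ⟩
      ∑< n (λ z → sumₗ (List.map (hits u v) (route z)))
        ≡⟨ ∑<-cong n (λ z _ → choose-∘ (sumₗ ∘ List.map (hits u v)) n forward backward z) ⟩
      ∑< n (choose n (sumₗ ∘ List.map (hits u v) ∘ forward) (sumₗ ∘ List.map (hits u v) ∘ backward))
        ≤⟨ ∑-choose {n} {h} _ _ half ⟩
      ∑< (suc h) (sumₗ ∘ List.map (hits u v) ∘ forward) + ∑< (suc h) (sumₗ ∘ List.map (hits u v) ∘ backward)
        ≡⟨ cong₂ _+_ (∑<-cong (suc h) (λ z _ → sum-steps (hits u v) (β z) 0 (up z) (down z)))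
                     (∑<-cong (suc h) (λ z _ → sum-steps (hits u v) 0 (β z) (down z) (up z))) ⟩
      ∑< (suc h) (λ z → β z * hits u v s + (0 + (up z * hits u v 1 + down z * hits u v (n ∸ 1)))) + ∑< (suc h) (λ z → 0 + (β z * hits u v (n ∸ s) + (down z * hits u v 1 + up z * hits u v (n ∸ 1))))
        ≡⟨ cong₂ _+_
             (trans (∑<-+ (suc h) (λ z → β z * hits u v s) (λ z → up z * hits u v 1 + down z * hits u v (n ∸ 1)))
               (cong₂ _+_ (∑-*ʳ β (hits u v s)) (trans (∑<-+ (suc h) (λ z → up z * hits u v 1) (λ z → down z * hits u v (n ∸ 1))) (cong₂ _+_ (∑-*ʳ up (hits u v 1)) (∑-*ʳ down (hits u v (n ∸ 1)))))))
             (trans (∑<-+ (suc h) (λ z → β z * hits u v (n ∸ s)) (λ z → down z * hits u v 1 + up z * hits u v (n ∸ 1)))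
               (cong₂ _+_ (∑-*ʳ β (hits u v (n ∸ s))) (trans (∑<-+ (suc h) (λ z → down z * hits u v 1) (λ z → up z * hits u v (n ∸ 1))) (cong₂ _+_ (∑-*ʳ down (hits u v 1)) (∑-*ʳ up (hits u v (n ∸ 1))))))) ⟩
      (∑β h * hits u v s + (∑U * hits u v 1 + ∑D * hits u v (n ∸ 1))) + (∑β h * hits u v (n ∸ s) + (∑D * hits u v 1 + ∑U * hits u v (n ∸ 1)))
        ≡⟨ eq (∑β h) ∑U ∑D (hits u v s) (hits u v (n ∸ s)) (hits u v 1) (hits u v (n ∸ 1)) ⟩
      ∑β h * hits u v s + (∑β h * hits u v (n ∸ s) + (∑α h * hits u v 1 + ∑α h * hits u v (n ∸ 1)))
        ≤⟨ +-mono-≤ (*-monoˡ-≤ (hits u v s) β≤) (+-mono-≤ (*-monoˡ-≤ (hits u v (n ∸ s)) β≤) (+-mono-≤ (*-monoˡ-≤ (hits u v 1) α≤) (*-monoˡ-≤ (hits u v (n ∸ 1)) α≤))) ⟩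
      X * hits u v s + (X * hits u v (n ∸ s) + (X * hits u v 1 + X * hits u v (n ∸ 1)))
        ≡⟨ eq′ X (hits u v s) (hits u v (n ∸ s)) (hits u v 1) (hits u v (n ∸ 1)) ⟩
      X * (hits u v s + (hits u v (n ∸ s) + (hits u v 1 + hits u v (n ∸ 1))))
        ≤⟨ *-monoʳ-≤ X (hits-total u v) ⟩
      X * 1
        ≡⟨ *-identityʳ X ⟩
      X ∎
      where
      open ≤-Reasoning
      ∑U ∑D : ℕ
      ∑U = ∑< (suc h) up
      ∑D = ∑< (suc h) down
      ∑-*ʳ : ∀ f c → ∑< (suc h) (λ z → f z * c) ≡ ∑< (suc h) f * c
      ∑-*ʳ f c = trans (∑<-cong (suc h) (λ z _ → *-comm (f z) c)) (trans (sum-*ˡ {suc h} c (f ∘ toℕ)) (*-comm c _))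
      eq : ∀ b u d x y z w → (b * x + (u * z + d * w)) + (b * y + (d * z + u * w)) ≡ b * x + (b * y + ((u + d) * z + (u + d) * w))
      eq = solve-∀
      eq′ : ∀ X x y z w → X * x + (X * y + (X * z + X * w)) ≡ X * (x + (y + (z + w)))
      eq′ = solve-∀

-- Its loads

∑<-id : ∀ m → 2 * ∑< m (λ i → i) + m ≡ m * m
∑<-id zero = refl
∑<-id (suc m) = begin
  2 * ∑< (suc m) (λ i → i) + suc m       ≡⟨ cong (λ x → 2 * x + suc m) (∑<-last m (λ i → i)) ⟩
  2 * (T + m) + suc m                    ≡⟨ eq₁ T m ⟩
  2 * T + m + (2 * m + 1)                ≡⟨ cong (_+ (2 * m + 1)) (∑<-id m) ⟩
  m * m + (2 * m + 1)                    ≡⟨ eq₂ m ⟩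
  suc m * suc m                          ∎
  where
  open ≡-Reasoning
  T : ℕ
  T = ∑< m (λ i → i)
  eq₁ : ∀ T m → 2 * (T + m) + suc m ≡ 2 * T + m + (2 * m + 1)
  eq₁ = solve-∀
  eq₂ : ∀ m → m * m + (2 * m + 1) ≡ suc m * suc m
  eq₂ = solve-∀

∑<-countdown : ∀ m → 2 * ∑< m (λ i → m ∸ i) ≡ m * suc m
∑<-countdown zero = refl
∑<-countdown (suc m) = begin
  2 * (suc m + ∑< m (λ i → m ∸ i))       ≡⟨ *-distribˡ-+ 2 (suc m) _ ⟩
  2 * suc m + 2 * ∑< m (λ i → m ∸ i)     ≡⟨ cong (2 * suc m +_) (∑<-countdown m) ⟩
  2 * suc m + m * suc m                  ≡⟨ eq m ⟩
  suc m * suc (suc m)                    ∎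
  where
  open ≡-Reasoning
  eq : ∀ m → 2 * suc m + m * suc m ≡ suc m * suc (suc m)
  eq = solve-∀

module _ (s : ℕ) .{{_ : NonZero s}} where

  -- `Q` blocks of length `s` have the quotients `0 .. Q - 1`, the last `t` numbers the quotient
  -- `Q`. The boundary `t = s` is allowed because even `q` with `r = s - 1` even reaches it.
  ∑-quotients : ∀ Q {t} → t ≤ s → 2 * ∑< (Q * s + t) (_/ s) + s * Q ≡ Q * (s * Q + 2 * t)
  ∑-quotients Q {t} t≤s = begin
    2 * ∑< (Q * s + t) (_/ s) + s * Q          ≡⟨ cong (λ x → 2 * x + s * Q) (trans (∑<-split (Q * s) t (_/ s)) (cong₂ _+_ blocks rest)) ⟩
    2 * (s * T + t * Q) + s * Q                ≡⟨ eq₁ s T t Q ⟩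
    s * (2 * T + Q) + 2 * (t * Q)              ≡⟨ cong (λ x → s * x + 2 * (t * Q)) (∑<-id Q) ⟩
    s * (Q * Q) + 2 * (t * Q)                  ≡⟨ eq₂ s t Q ⟩
    Q * (s * Q + 2 * t)                        ∎
    where
    open ≡-Reasoning
    T : ℕ
    T = ∑< Q (λ i → i)
    quotient : ∀ i {j} → j < s → (i * s + j) / s ≡ i
    quotient i {j} j<s = trans (cong (_/ s) (+-comm (i * s) j)) (/-unique i j<s)
    blocks : ∑< (Q * s) (_/ s) ≡ s * T
    blocks = trans (∑<-* Q s (_/ s)) (trans (∑<-cong Q (λ i _ → trans (∑<-cong s (λ j → quotient i)) (∑<-const s i))) (sum-*ˡ {Q} s toℕ))
    rest : ∑< t (λ i → (Q * s + i) / s) ≡ t * Q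
    rest = trans (∑<-cong t (λ i i<t → quotient Q (<-≤-trans i<t t≤s))) (∑<-const t Q)
    eq₁ : ∀ s T t Q → 2 * (s * T + t * Q) + s * Q ≡ s * (2 * T + Q) + 2 * (t * Q)
    eq₁ = solve-∀
    eq₂ : ∀ s t Q → s * (Q * Q) + 2 * (t * Q) ≡ Q * (s * Q + 2 * t)
    eq₂ = solve-∀

  ∑-remainders : ∀ f Q {t} → t ≤ s → ∑< (Q * s + t) (λ y → f (y % s)) ≡ Q * ∑< s f + ∑< t f
  ∑-remainders f Q {t} t≤s = trans (∑<-split (Q * s) t (λ y → f (y % s))) (cong₂ _+_
    (trans (∑<-* Q s (λ y → f (y % s))) (trans (∑<-cong Q (λ i _ → ∑<-cong s (λ j → remainder i))) (∑<-const Q (∑< s f))))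
    (∑<-cong t (λ i i<t → remainder Q (<-≤-trans i<t t≤s))))
    where
    remainder : ∀ i {j} → j < s → f ((i * s + j) % s) ≡ f j
    remainder i {j} j<s = cong f (trans (cong (_% s) (+-comm (i * s) j)) (%-unique i j<s))

module _ (k : ℕ) where

  gap : ℕ → ℕ
  gap y = (y ∸ k) + (k ∸ y)

  gap-below : ∀ {y} → y ≤ k → gap y ≡ k ∸ y
  gap-below {y} y≤k = cong (_+ (k ∸ y)) (m≤n⇒m∸n≡0 y≤k)

  ∑-gap-k : 2 * ∑< k gap ≡ k * suc k
  ∑-gap-k = trans (cong (2 *_) (∑<-cong k (λ y y<k → gap-below (<⇒≤ y<k)))) (∑<-countdown k)

  ∑-gap-above : ∀ j → 2 * ∑< (k + suc j) gap ≡ k * suc k + j * suc j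
  ∑-gap-above j = begin
    2 * ∑< (k + suc j) gap                          ≡⟨ cong (2 *_) (trans (∑<-split k (suc j) gap) (cong (∑< k gap +_) (∑<-cong (suc j) (λ i _ → gap-+ i)))) ⟩
    2 * (∑< k gap + T)                              ≡⟨ *-distribˡ-+ 2 (∑< k gap) T ⟩
    2 * ∑< k gap + 2 * T                            ≡⟨ cong₂ _+_ ∑-gap-k (+-cancelʳ-≡ (suc j) _ _ (trans (∑<-id (suc j)) (+-comm (suc j) (j * suc j)))) ⟩
    k * suc k + j * suc j                           ∎
    where
    open ≡-Reasoning
    T : ℕ
    T = ∑< (suc j) (λ i → i)
    gap-+ : ∀ i → gap (k + i) ≡ i
    gap-+ i = trans (cong₂ _+_ (m+n∸m≡n k i) (m≤n⇒m∸n≡0 (m≤m+n k i))) (+-identityʳ i)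

  ∑-gap-below : ∀ t {g} → t + g ≡ k → 2 * ∑< t gap + g * suc g ≡ k * suc k
  ∑-gap-below t {g} refl = begin
    2 * ∑< t gap + g * suc g                        ≡⟨ cong (2 * ∑< t gap +_) (∑<-countdown g) ⟨
    2 * ∑< t gap + 2 * ∑< g (λ i → g ∸ i)           ≡⟨ *-distribˡ-+ 2 (∑< t gap) _ ⟨
    2 * (∑< t gap + ∑< g (λ i → g ∸ i))             ≡⟨ cong (λ x → 2 * (∑< t gap + x)) (∑<-cong g (λ i i<g → gap-rest i<g)) ⟨
    2 * (∑< t gap + ∑< g (λ i → gap (t + i)))       ≡⟨ cong (2 *_) (∑<-split t g gap) ⟨
    2 * ∑< k gap                                    ≡⟨ ∑-gap-k ⟩
    k * suc k                                       ∎
    where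
    open ≡-Reasoning
    gap-rest : ∀ {i} → i < g → gap (t + i) ≡ g ∸ i
    gap-rest {i} i<g = trans (gap-below (+-monoʳ-≤ t (<⇒≤ i<g))) ([m+n]∸[m+o]≡n∸o t g i)

module RouteSums (n s k : ℕ) .{{_ : NonZero n}} .{{_ : NonZero s}} (1<s : 1 < s) (2s<n : s + s < n) (k<s : k < s) where
  open Route n s k 1<s 2s<n public

  module _ {h} (Q : ℕ) {t} (t≤s : t ≤ s) (N≡ : k + suc h ≡ Q * s + t) where

    -- The quotients of the numbers below `k` vanish, so the sum over `k + z` with `z ≤ h` is a sum
    -- over an initial segment.
    ∑β-formula : 2 * ∑β h + s * Q ≡ Q * (s * Q + 2 * t)
    ∑β-formula = trans (cong (λ x → 2 * x + s * Q) (sym (begin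
      ∑< (Q * s + t) (_/ s)                               ≡⟨ cong (λ m → ∑< m (_/ s)) (sym N≡) ⟩
      ∑< (k + suc h) (_/ s)                               ≡⟨ ∑<-split k (suc h) (_/ s) ⟩
      ∑< k (_/ s) + ∑β h                               ≡⟨ cong (_+ ∑β h) (trans (∑<-cong k (λ y y<k → m<n⇒m/n≡0 (<-trans y<k k<s))) (trans (∑<-const k 0) (*-zeroʳ k))) ⟩
      ∑β h                                             ∎))) (∑-quotients s Q t≤s)
      where open ≡-Reasoning

    private
      y≡ : ∀ z → k + z ≡ β z * s + (k + z) % s
      y≡ z = trans (m≡m%n+[m/n]*n (k + z) s) (+-comm ((k + z) % s) _)

      up≡ : ∀ z → up z ≡ (k + z) % s ∸ k
      up≡ z = begin
        z ∸ β z * s                               ≡⟨ [m+n]∸[m+o]≡n∸o k z (β z * s) ⟨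
        k + z ∸ (k + β z * s)                     ≡⟨ cong₂ _∸_ (y≡ z) (+-comm k (β z * s)) ⟩
        β z * s + (k + z) % s ∸ (β z * s + k)     ≡⟨ [m+n]∸[m+o]≡n∸o (β z * s) _ k ⟩
        (k + z) % s ∸ k                           ∎
        where open ≡-Reasoning

      down≡ : ∀ z → down z ≡ k ∸ (k + z) % s
      down≡ z = begin
        β z * s ∸ z                               ≡⟨ [m+n]∸[m+o]≡n∸o k (β z * s) z ⟨
        k + β z * s ∸ (k + z)                     ≡⟨ cong₂ _∸_ (+-comm k (β z * s)) (y≡ z) ⟩
        β z * s + k ∸ (β z * s + (k + z) % s)     ≡⟨ [m+n]∸[m+o]≡n∸o (β z * s) k _ ⟩
        k ∸ (k + z) % s                           ∎
        where open ≡-Reasoning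

    -- The distance from `z` to its multiple is `gap k` of the remainder of `k + z`. The term
    -- `k * suc k` on the left is twice the sum over the prepended numbers below `k`, which complete
    -- the range to an initial segment.
    ∑α-formula : 2 * ∑α h + k * suc k ≡ Q * (2 * ∑< s (gap k)) + 2 * ∑< t (gap k)
    ∑α-formula = begin
      2 * ∑α h + k * suc k
        ≡⟨ cong₂ (λ x y → 2 * x + y) gaps (sym (∑-gap-k k)) ⟩
      2 * ∑< (suc h) (λ z → gap k ((k + z) % s)) + 2 * ∑< k (gap k)
        ≡⟨ trans (sym (*-distribˡ-+ 2 (∑< (suc h) (λ z → gap k ((k + z) % s))) (∑< k (gap k)))) (cong (2 *_) (+-comm (∑< (suc h) (λ z → gap k ((k + z) % s))) (∑< k (gap k)))) ⟩
      2 * (∑< k (gap k) + ∑< (suc h) (λ z → gap k ((k + z) % s)))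
        ≡⟨ cong (λ x → 2 * (x + ∑< (suc h) (λ z → gap k ((k + z) % s)))) (∑<-cong k (λ y y<k → cong (gap k) (sym (m<n⇒m%n≡m (<-trans y<k k<s))))) ⟩
      2 * (∑< k (λ y → gap k (y % s)) + ∑< (suc h) (λ z → gap k ((k + z) % s)))
        ≡⟨ cong (2 *_) (trans (sym (∑<-split k (suc h) (λ y → gap k (y % s)))) (cong (λ m → ∑< m (λ y → gap k (y % s))) N≡)) ⟩
      2 * ∑< (Q * s + t) (λ y → gap k (y % s))
        ≡⟨ cong (2 *_) (∑-remainders s (gap k) Q t≤s) ⟩
      2 * (Q * ∑< s (gap k) + ∑< t (gap k))
        ≡⟨ eq Q (∑< s (gap k)) (∑< t (gap k)) ⟩
      Q * (2 * ∑< s (gap k)) + 2 * ∑< t (gap k) ∎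
      where
      open ≡-Reasoning
      gaps : ∑α h ≡ ∑< (suc h) (λ z → gap k ((k + z) % s))
      gaps = trans (sym (∑<-+ (suc h) up down)) (∑<-cong (suc h) (λ z _ → cong₂ _+_ (up≡ z) (down≡ z)))
      eq : ∀ Q P V → 2 * (Q * P + V) ≡ Q * (2 * P) + 2 * V
      eq = solve-∀

-- The exact loads by the parities of `q`, `s` and `r`

module _ (s q r A B : ℕ) where

  -- A is the load of the ±1-arcs, B that of the ±s-arcs. The slack of the first two bounds is too large for s = √n.
  record LoadBounds : Set where
    field
      α-bound : 8 * A + q * ε s ≤ q * (s * s) + 2 * r * s + 2 * s
      β-bound : 8 * B ≤ q * (q * s + 2 * r + 2) + s
      α-square : q ≡ s → r ≡ 0 → 8 * A + s * ε s ≤ s * (s * s)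
      β-square : q ≡ s → r ≡ 0 → 8 * B + s * ε s ≤ s * (s * s)

odd≢even : ∀ {a b} → ¬ suc (a + a) ≡ b + b
odd≢even {a} {b} e with trans (sym (ε-odd a)) (trans (cong ε e) (ε-even b))
... | ()

double-injective : ∀ {a b} → a + a ≡ b + b → a ≡ b
double-injective {a} {b} e = *-cancelˡ-≡ a b 2 (trans (cong (a +_) (+-identityʳ a)) (trans e (cong (b +_) (sym (+-identityʳ b)))))

Centre : ℕ → ℕ → Set
Centre s k = s ≡ suc (k + k) ⊎ s ≡ suc k + suc k

Centre⇒2k<s : ∀ {s k} → Centre s k → suc (k + k) ≤ s
Centre⇒2k<s (inj₁ e) = ≤-reflexive (sym e)
Centre⇒2k<s {k = k} (inj₂ e) = ≤-trans (s≤s (+-monoʳ-≤ k (n≤1+n k))) (≤-reflexive (sym e))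

Centre⇒k<s : ∀ {s k} → Centre s k → k < s
Centre⇒k<s {k = k} c = ≤-trans (s≤s (m≤m+n k k)) (Centre⇒2k<s c)

Centre⇒s≤2k+2 : ∀ {s k} → Centre s k → s ≤ suc k + suc k
Centre⇒s≤2k+2 {k = k} (inj₁ e) = ≤-trans (≤-reflexive e) (s≤s (+-monoʳ-≤ k (n≤1+n k)))
Centre⇒s≤2k+2 (inj₂ e) = ≤-reflexive e

-- For `q = 2m` half of `n` is `m * s + j` with `j = ⌊r / 2⌋`: the shifted range has `m` periods and
-- `k + suc j` further terms. `P` is the gap sum of a period. Both loads are known exactly; the
-- estimates use only `2j ≤ r`, `j < s` and `2k + 1 ≤ s`.
loadBounds-even : ∀ {s k m j r A B} P → Centre s k → j + j ≤ r → j ≤ k →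
  2 * (2 * P) + ε s ≡ s * s →
  2 * B + s * m ≡ m * (s * m + 2 * (k + suc j)) →
  2 * A ≡ m * (2 * P) + j * suc j →
  LoadBounds s (m + m) r A B
loadBounds-even {s} {k} {m} {j} {r} {A} {B} P centre 2j≤r j≤k hP hB hA = record
  { α-bound = begin
      8 * A + (m + m) * ε s                    ≡⟨ α-exact ⟩
      (m + m) * (s * s) + 2 * (j + j) * suc j  ≤⟨ +-monoʳ-≤ ((m + m) * (s * s)) (*-mono-≤ (*-monoʳ-≤ 2 2j≤r) (≤-trans (s≤s j≤k) (Centre⇒k<s centre))) ⟩
      (m + m) * (s * s) + 2 * r * s            ≤⟨ m≤m+n _ (2 * s) ⟩
      (m + m) * (s * s) + 2 * r * s + 2 * s    ∎
  ; β-bound = +-cancelʳ-≤ (4 * s * m) _ _ (begin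
      8 * B + 4 * s * m                                                      ≡⟨ β-exact ⟩
      4 * m * (s * m + 2 * (k + suc j))                                      ≡⟨ eq₁ m s k j ⟩
      4 * m * (s * m) + 4 * m + 4 * m * (j + j) + 4 * m * suc (k + k)        ≤⟨ +-mono-≤ (+-monoʳ-≤ (4 * m * (s * m) + 4 * m) (*-monoʳ-≤ (4 * m) 2j≤r)) (*-monoʳ-≤ (4 * m) (Centre⇒2k<s centre)) ⟩
      4 * m * (s * m) + 4 * m + 4 * m * r + 4 * m * s                        ≤⟨ m≤m+n _ s ⟩
      4 * m * (s * m) + 4 * m + 4 * m * r + 4 * m * s + s                    ≡⟨ eq₂ m s r ⟩
      (m + m) * ((m + m) * s + 2 * r + 2) + s + 4 * s * m                    ∎)
  ; α-square = λ { refl refl → ≤-reflexive (trans α-exact (trans (cong (λ x → s * (s * s) + 2 * (x + x) * suc x) (j≡0 {j} 2j≤r)) (+-identityʳ _))) }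
  ; β-square = λ { refl refl → +-cancelʳ-≤ (4 * s * m) _ _ (≤-reflexive (begin-equality
      8 * B + s * ε (m + m) + 4 * s * m                      ≡⟨ cong (λ x → 8 * B + x + 4 * s * m) (trans (cong (s *_) (ε-even m)) (*-zeroʳ s)) ⟩
      8 * B + 0 + 4 * s * m                                  ≡⟨ cong (_+ 4 * s * m) (+-identityʳ (8 * B)) ⟩
      8 * B + 4 * s * m                                      ≡⟨ β-exact ⟩
      4 * m * (s * m + 2 * (k + suc j))                      ≡⟨ cong (λ x → 4 * m * (s * m + 2 * (k + suc x))) (j≡0 {j} 2j≤r) ⟩
      4 * m * (s * m + 2 * (k + 1))                          ≡⟨ cong (λ x → 4 * m * (s * m + 2 * x)) (trans (+-comm k 1) (sym (m≡k+1 centre))) ⟩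
      4 * m * (s * m + 2 * m)                                ≡⟨ eq₃ m ⟩
      s * (s * s) + 4 * s * m                                ∎)) }
  }
  where
  open ≤-Reasoning
  j≡0 : ∀ {j} → j + j ≤ 0 → j ≡ 0
  j≡0 {zero} _ = refl
  m≡k+1 : Centre (m + m) k → m ≡ suc k
  m≡k+1 (inj₁ e) = contradiction (sym e) (odd≢even {k} {m})
  m≡k+1 (inj₂ e) = double-injective e
  α-exact : 8 * A + (m + m) * ε s ≡ (m + m) * (s * s) + 2 * (j + j) * suc j
  α-exact = begin-equality
    8 * A + (m + m) * ε s                                            ≡⟨ cong (_+ (m + m) * ε s) (*-assoc 4 2 A) ⟩
    4 * (2 * A) + (m + m) * ε s                                      ≡⟨ cong (λ x → 4 * x + (m + m) * ε s) hA ⟩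
    4 * (m * (2 * P) + j * suc j) + (m + m) * ε s                    ≡⟨ eq m P j (ε s) ⟩
    (m + m) * (2 * (2 * P) + ε s) + 2 * (j + j) * suc j              ≡⟨ cong (λ x → (m + m) * x + 2 * (j + j) * suc j) hP ⟩
    (m + m) * (s * s) + 2 * (j + j) * suc j                          ∎
    where
    eq : ∀ m P j e → 4 * (m * (2 * P) + j * suc j) + (m + m) * e ≡ (m + m) * (2 * (2 * P) + e) + 2 * (j + j) * suc j
    eq = solve-∀
  β-exact : 8 * B + 4 * s * m ≡ 4 * m * (s * m + 2 * (k + suc j))
  β-exact = begin-equality
    8 * B + 4 * s * m                           ≡⟨ eq B s m ⟩
    4 * (2 * B + s * m)                         ≡⟨ cong (4 *_) hB ⟩
    4 * (m * (s * m + 2 * (k + suc j)))         ≡⟨ *-assoc 4 m _ ⟨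
    4 * m * (s * m + 2 * (k + suc j))           ∎
    where
    eq : ∀ B s m → 8 * B + 4 * s * m ≡ 4 * (2 * B + s * m)
    eq = solve-∀
  eq₁ : ∀ m s k j → 4 * m * (s * m + 2 * (k + suc j)) ≡ 4 * m * (s * m) + 4 * m + 4 * m * (j + j) + 4 * m * suc (k + k)
  eq₁ = solve-∀
  eq₂ : ∀ m s r → 4 * m * (s * m) + 4 * m + 4 * m * r + 4 * m * s + s ≡ (m + m) * ((m + m) * s + 2 * r + 2) + s + 4 * s * m
  eq₂ = solve-∀
  eq₃ : ∀ m → 4 * m * ((m + m) * m + 2 * m) ≡ (m + m) * ((m + m) * (m + m)) + 4 * (m + m) * m
  eq₃ = solve-∀

-- For `q = 2m + 1` the shifted range has `suc m` periods and `t` further terms, `g` short of the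
-- centre `k = t + g`. Rounding `q / 2` up makes `8 A + q * ε s` exceed `q s²` by
-- `s² - 4 g (g + 1) - ε s`; this is the source of `2 * s` in `α-bound`.
loadBounds-odd : ∀ {s m t g r A B} P → Centre s (t + g) → (s ≡ suc ((t + g) + (t + g)) → t + t ≤ suc r) →
  (s ≡ suc (t + g) + suc (t + g) → t + t ≤ r) → r < s →
  2 * (2 * P) + ε s ≡ s * s →
  2 * B + s * suc m ≡ suc m * (s * suc m + 2 * t) →
  2 * A + g * suc g ≡ suc m * (2 * P) →
  LoadBounds s (suc (m + m)) r A B
loadBounds-odd {s} {m} {t} {g} {r} {A} {B} P centre odd-t even-t r<s hP hB hA = record
  { α-bound = +-cancelʳ-≤ (4 * (g * suc g) + ε s) _ _ (begin
      8 * A + q * ε s + (4 * (g * suc g) + ε s)                          ≡⟨ α-exact ⟩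
      q * (s * s) + s * s                                                ≤⟨ +-monoʳ-≤ (q * (s * s)) (square≤ centre odd-t even-t) ⟩
      q * (s * s) + (2 * r * s + 2 * s + (4 * (g * suc g) + ε s))        ≡⟨ assoc (q * (s * s)) (2 * r * s) (2 * s) (4 * (g * suc g) + ε s) ⟩
      q * (s * s) + 2 * r * s + 2 * s + (4 * (g * suc g) + ε s)          ∎)
  ; β-bound = +-cancelʳ-≤ (4 * s * suc m) _ _ (begin
      8 * B + 4 * s * suc m                                                                 ≡⟨ β-exact ⟩
      4 * suc m * (s * suc m) + 4 * suc m * (t + t)                                         ≤⟨ +-monoʳ-≤ (4 * suc m * (s * suc m)) (*-monoʳ-≤ (4 * suc m) 2t≤) ⟩
      4 * suc m * (s * suc m) + 4 * suc m * suc r                                           ≡⟨ eq₁ m s r ⟩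
      q * (q * s + 2 * r + 2) + (2 * q * s + s) + 2 * suc r                                 ≤⟨ +-monoʳ-≤ (q * (q * s + 2 * r + 2) + (2 * q * s + s)) (*-monoʳ-≤ 2 r<s) ⟩
      q * (q * s + 2 * r + 2) + (2 * q * s + s) + 2 * s                                     ≡⟨ eq₂ m s r ⟩
      q * (q * s + 2 * r + 2) + s + 4 * s * suc m                                           ∎)
  ; α-square = λ { refl refl → +-cancelʳ-≤ (4 * (g * suc g) + ε q) _ _ (≤-reflexive (begin-equality
      8 * A + q * ε q + (4 * (g * suc g) + ε q)          ≡⟨ α-exact ⟩
      q * (q * q) + q * q                                ≡⟨ cong (q * (q * q) +_) (eq₄ m) ⟩
      q * (q * q) + (4 * (m * suc m) + 1)                ≡⟨ cong₂ (λ x y → q * (q * q) + (4 * (x * suc x) + y)) (sym (proj₂ (square-case centre odd-t))) (sym (ε-odd m)) ⟩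
      q * (q * q) + (4 * (g * suc g) + ε q)              ∎)) }
  ; β-square = λ { refl refl → +-cancelʳ-≤ (4 * q * suc m) _ _ (≤-reflexive (begin-equality
      8 * B + q * ε q + 4 * q * suc m                    ≡⟨ cong (λ x → 8 * B + q * x + 4 * q * suc m) (ε-odd m) ⟩
      8 * B + q * 1 + 4 * q * suc m                      ≡⟨ swap (8 * B) (q * 1) (4 * q * suc m) ⟩
      8 * B + 4 * q * suc m + q * 1                      ≡⟨ cong (_+ q * 1) β-exact ⟩
      4 * suc m * (q * suc m) + 4 * suc m * (t + t) + q * 1 ≡⟨ cong (λ x → 4 * suc m * (q * suc m) + 4 * suc m * (x + x) + q * 1) (proj₁ (square-case centre odd-t)) ⟩
      4 * suc m * (q * suc m) + 4 * suc m * 0 + q * 1    ≡⟨ eq₃ m ⟩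
      q * (q * q) + 4 * q * suc m                        ∎)) }
  }
  where
  open ≤-Reasoning
  q : ℕ
  q = suc (m + m)
  2t≤ : t + t ≤ suc r
  2t≤ = [ odd-t , (λ e → ≤-trans (even-t e) (n≤1+n r)) ]′ centre
  assoc : ∀ a b c d → a + (b + c + d) ≡ a + b + c + d
  assoc = solve-∀
  swap : ∀ a b c → a + b + c ≡ a + c + b
  swap = solve-∀
  square-case : Centre q (t + g) → (q ≡ suc ((t + g) + (t + g)) → t + t ≤ 1) → t ≡ 0 × g ≡ m
  square-case (inj₂ e) _ = contradiction e (odd≢even {m} {suc (t + g)})
  square-case (inj₁ e) h = t≡0 t (h e) , sym (trans (double-injective (suc-injective e)) (cong (_+ g) (t≡0 t (h e))))
    where
    t≡0 : ∀ t → t + t ≤ 1 → t ≡ 0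
    t≡0 zero _ = refl
    t≡0 (suc t) (s≤s 2t<0) = contradiction (≤-trans (≤-reflexive (sym (+-suc t t))) 2t<0) λ ()
  α-exact : 8 * A + q * ε s + (4 * (g * suc g) + ε s) ≡ q * (s * s) + s * s
  α-exact = begin-equality
    8 * A + q * ε s + (4 * (g * suc g) + ε s)                        ≡⟨ eq A q (ε s) (g * suc g) ⟩
    4 * (2 * A + g * suc g) + suc q * ε s                            ≡⟨ cong (λ x → 4 * x + suc q * ε s) hA ⟩
    4 * (suc m * (2 * P)) + suc q * ε s                              ≡⟨ eq′ m P (ε s) ⟩
    suc q * (2 * (2 * P) + ε s)                                      ≡⟨ cong (suc q *_) hP ⟩
    s * s + q * (s * s)                                              ≡⟨ +-comm (s * s) _ ⟩
    q * (s * s) + s * s                                              ∎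
    where
    eq : ∀ A q e G → 8 * A + q * e + (4 * G + e) ≡ 4 * (2 * A + G) + suc q * e
    eq = solve-∀
    eq′ : ∀ m P e → 4 * (suc m * (2 * P)) + suc (suc (m + m)) * e ≡ suc (suc (m + m)) * (2 * (2 * P) + e)
    eq′ = solve-∀
  β-exact : 8 * B + 4 * s * suc m ≡ 4 * suc m * (s * suc m) + 4 * suc m * (t + t)
  β-exact = begin-equality
    8 * B + 4 * s * suc m                               ≡⟨ eq B s (suc m) ⟩
    4 * (2 * B + s * suc m)                             ≡⟨ cong (4 *_) hB ⟩
    4 * (suc m * (s * suc m + 2 * t))                   ≡⟨ eq′ (suc m) s t ⟩
    4 * suc m * (s * suc m) + 4 * suc m * (t + t)       ∎
    where
    eq : ∀ B s Q → 8 * B + 4 * s * Q ≡ 4 * (2 * B + s * Q)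
    eq = solve-∀
    eq′ : ∀ Q s t → 4 * (Q * (s * Q + 2 * t)) ≡ 4 * Q * (s * Q) + 4 * Q * (t + t)
    eq′ = solve-∀
  -- For odd `s` the excess factors as `2t (2t + 4g + 2)`, at most `(r + 1) · 2s`. For even `s` it
  -- is `2t (2t + 4g + 4)`, at most `r · 2s`, plus `4g + 4`, at most `2s`.
  square≤ : ∀ {s} → Centre s (t + g) → (s ≡ suc ((t + g) + (t + g)) → t + t ≤ suc r) →
    (s ≡ suc (t + g) + suc (t + g) → t + t ≤ r) →
    s * s ≤ 2 * r * s + 2 * s + (4 * (g * suc g) + ε s)
  square≤ {s} (inj₁ refl) h _ = begin
    s * s                                                  ≡⟨ eq t g ⟩
    (t + t) * (t + t + 4 * g + 2) + (4 * (g * suc g) + 1)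
      ≤⟨ +-mono-≤ (*-mono-≤ (h refl) (≤-trans (m≤m+n _ (t + t)) (≤-reflexive (eq″ t g)))) (≤-reflexive (cong (4 * (g * suc g) +_) (sym (ε-odd (t + g))))) ⟩
    suc r * (2 * s) + (4 * (g * suc g) + ε s)              ≡⟨ cong (_+ (4 * (g * suc g) + ε s)) (eq′ r s) ⟩
    2 * r * s + 2 * s + (4 * (g * suc g) + ε s)            ∎
    where
    eq : ∀ t g → suc ((t + g) + (t + g)) * suc ((t + g) + (t + g)) ≡ (t + t) * (t + t + 4 * g + 2) + (4 * (g * suc g) + 1)
    eq = solve-∀
    eq′ : ∀ r s → suc r * (2 * s) ≡ 2 * r * s + 2 * s
    eq′ = solve-∀
    eq″ : ∀ t g → t + t + 4 * g + 2 + (t + t) ≡ 2 * suc ((t + g) + (t + g))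
    eq″ = solve-∀
  square≤ {s} (inj₂ refl) _ h = begin
    s * s                                                                 ≡⟨ eq t g ⟩
    (t + t) * (t + t + 4 * g + 4) + (4 * g + 4) + (4 * (g * suc g) + 0)
      ≤⟨ +-mono-≤ (+-mono-≤ (*-mono-≤ (h refl) (≤-trans (m≤m+n _ (t + t)) (≤-reflexive (eq″ t g)))) (≤-trans (m≤m+n _ (4 * t)) (≤-reflexive (eq‴ t g))))
                  (≤-reflexive (cong (4 * (g * suc g) +_) (sym (ε-even (suc (t + g)))))) ⟩
    r * (2 * s) + 2 * s + (4 * (g * suc g) + ε s)                         ≡⟨ cong (λ x → x + 2 * s + (4 * (g * suc g) + ε s)) (eq′ r s) ⟩
    2 * r * s + 2 * s + (4 * (g * suc g) + ε s)                           ∎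
    where
    eq : ∀ t g → (suc (t + g) + suc (t + g)) * (suc (t + g) + suc (t + g)) ≡ (t + t) * (t + t + 4 * g + 4) + (4 * g + 4) + (4 * (g * suc g) + 0)
    eq = solve-∀
    eq′ : ∀ r s → r * (2 * s) ≡ 2 * r * s
    eq′ = solve-∀
    eq″ : ∀ t g → t + t + 4 * g + 4 + (t + t) ≡ 2 * (suc (t + g) + suc (t + g))
    eq″ = solve-∀
    eq‴ : ∀ t g → 4 * g + 4 + 4 * t ≡ 2 * (suc (t + g) + suc (t + g))
    eq‴ = solve-∀
  eq₁ : ∀ m s r → 4 * suc m * (s * suc m) + 4 * suc m * suc r ≡ suc (m + m) * (suc (m + m) * s + 2 * r + 2) + (2 * suc (m + m) * s + s) + 2 * suc r
  eq₁ = solve-∀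
  eq₂ : ∀ m s r → suc (m + m) * (suc (m + m) * s + 2 * r + 2) + (2 * suc (m + m) * s + s) + 2 * s ≡ suc (m + m) * (suc (m + m) * s + 2 * r + 2) + s + 4 * s * suc m
  eq₂ = solve-∀
  eq₃ : ∀ m → 4 * suc m * (suc (m + m) * suc m) + 4 * suc m * 0 + suc (m + m) * 1 ≡ suc (m + m) * (suc (m + m) * suc (m + m)) + 4 * suc (m + m) * suc m
  eq₃ = solve-∀
  eq₄ : ∀ m → suc (m + m) * suc (m + m) ≡ 4 * (m * suc m) + 1
  eq₄ = solve-∀

centre : ∀ s → 1 < s → ∃ (Centre s)
centre s 1<s with halve s
... | k , inj₂ e = k , inj₁ e
... | suc k , inj₁ e = k , inj₂ e
centre .0 () | zero , inj₁ refl

-- `k` is central in a period: the gaps are `1 .. k` below it and `1 .. k` or `1 .. k + 1` above it,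
-- in total `⌊s² / 4⌋`.
∑-gap-period : ∀ {s k} → Centre s k → 2 * (2 * ∑< s (gap k)) + ε s ≡ s * s
∑-gap-period {s} {k} (inj₁ refl) = begin
  2 * (2 * ∑< s (gap k)) + ε s               ≡⟨ cong₂ (λ x y → 2 * x + y) (trans (cong (λ m → 2 * ∑< m (gap k)) (sym (+-suc k k))) (∑-gap-above k k)) (ε-odd k) ⟩
  2 * (k * suc k + k * suc k) + 1            ≡⟨ eq k ⟩
  s * s                                      ∎
  where
  open ≡-Reasoning
  eq : ∀ k → 2 * (k * suc k + k * suc k) + 1 ≡ suc (k + k) * suc (k + k)
  eq = solve-∀
∑-gap-period {s} {k} (inj₂ refl) = begin
  2 * (2 * ∑< s (gap k)) + ε s                           ≡⟨ cong₂ (λ x y → 2 * x + y) (trans (cong (λ m → 2 * ∑< m (gap k)) (sym (+-suc k (suc k)))) (∑-gap-above k (suc k))) (ε-even (suc k)) ⟩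
  2 * (k * suc k + suc k * suc (suc k)) + 0              ≡⟨ eq k ⟩
  s * s                                                  ∎
  where
  open ≡-Reasoning
  eq : ∀ k → 2 * (k * suc k + suc k * suc (suc k)) + 0 ≡ (suc k + suc k) * (suc k + suc k)
  eq = solve-∀

module _ (n s q r : ℕ) .{{_ : NonZero n}} .{{_ : NonZero s}} (1<s : 1 < s) (2s<n : s + s < n)
         (n≡ : n ≡ q * s + r) (r<s : r < s) where

  BoundedRouting : Set
  BoundedRouting = Σ (Routing n) λ R → IsRouting n s R × ∃ λ A → ∃ λ B → LoadBounds s q r A B × arcπ R ≤ A ⊔ B

  private
    module _ (k : ℕ) (k<s : k < s) where
      open RouteSums n s k 1<s 2s<n k<s public

    build : ∀ k (k<s : k < s) {h} → Half n h → LoadBounds s q r (∑α k k<s h) (∑β k k<s h) → BoundedRouting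
    build k k<s {h} half bounds = routing k k<s , isRouting k k<s , ∑α k k<s h , ∑β k k<s h , bounds ,
      arcπ≤ k k<s {h} half (m≤n⊔m (∑α k k<s h) (∑β k k<s h)) (m≤m⊔n (∑α k k<s h) (∑β k k<s h))

  half-< : ∀ {a b} → a + a < b + b → a < b
  half-< {a} {b} h = ≰⇒> λ b≤a → contradiction h (≤⇒≯ (+-mono-≤ b≤a b≤a))

  bounded-even : ∀ {m k j} → q ≡ m + m → Centre s k → r ≡ j + j ⊎ r ≡ suc (j + j) → BoundedRouting
  bounded-even {m} {k} {j} refl c half-r = build k (Centre⇒k<s c) {m * s + j} half
    (loadBounds-even (∑< s (gap k)) c 2j≤r j≤k (∑-gap-period c)
      (∑β-formula k (Centre⇒k<s c) m t≤s N≡)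
      (+-cancelʳ-≡ (k * suc k) _ _ (begin
        2 * ∑α k (Centre⇒k<s c) (m * s + j) + k * suc k                       ≡⟨ ∑α-formula k (Centre⇒k<s c) m t≤s N≡ ⟩
        m * (2 * ∑< s (gap k)) + 2 * ∑< (k + suc j) (gap k)            ≡⟨ cong (m * (2 * ∑< s (gap k)) +_) (∑-gap-above k j) ⟩
        m * (2 * ∑< s (gap k)) + (k * suc k + j * suc j)               ≡⟨ rearr (m * (2 * ∑< s (gap k))) (k * suc k) (j * suc j) ⟩
        m * (2 * ∑< s (gap k)) + j * suc j + k * suc k                 ∎)))
    where
    open ≡-Reasoning
    rearr : ∀ a b c → a + (b + c) ≡ a + c + b
    rearr = solve-∀
    2j≤r : j + j ≤ r
    2j≤r = [ (λ e → ≤-reflexive (sym e)) , (λ e → ≤-trans (n≤1+n _) (≤-reflexive (sym e))) ]′ half-r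
    j≤k : j ≤ k
    j≤k = s≤s⁻¹ (half-< {j} {suc k} (≤-<-trans 2j≤r (<-≤-trans r<s (Centre⇒s≤2k+2 c))))
    half : Half n (m * s + j)
    half = [ (λ e → inj₁ (trans n≡ (trans (cong ((m + m) * s +_) e) (eq m s j)))) , (λ e → inj₂ (trans n≡ (trans (cong ((m + m) * s +_) e) (eq′ m s j)))) ]′ half-r
      where
      eq : ∀ m s j → (m + m) * s + (j + j) ≡ m * s + j + (m * s + j)
      eq = solve-∀
      eq′ : ∀ m s j → (m + m) * s + suc (j + j) ≡ suc (m * s + j + (m * s + j))
      eq′ = solve-∀
    t≤s : k + suc j ≤ s
    t≤s = ≤-trans (+-monoʳ-≤ k (s≤s j≤k)) (subst (_≤ s) (sym (+-suc k k)) (Centre⇒2k<s c))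
    N≡ : k + suc (m * s + j) ≡ m * s + (k + suc j)
    N≡ = eq k (m * s) j
      where
      eq : ∀ k a j → k + suc (a + j) ≡ a + (k + suc j)
      eq = solve-∀

  bounded-odd : ∀ {m k} t h → q ≡ suc (m + m) → Centre s k → t ≤ k →
    (s ≡ suc (k + k) → t + t ≤ suc r) → (s ≡ suc k + suc k → t + t ≤ r) →
    Half n h → k + suc h ≡ suc m * s + t → BoundedRouting
  bounded-odd {m} {k} t h refl c t≤k odd-t even-t half N≡ = build k (Centre⇒k<s c) {h} half
    (loadBounds-odd {g = k ∸ t} (∑< s (gap k)) (subst (Centre s) (sym t+g≡k) c)
      (subst (λ x → s ≡ suc (x + x) → t + t ≤ suc r) (sym t+g≡k) odd-t)
      (subst (λ x → s ≡ suc x + suc x → t + t ≤ r) (sym t+g≡k) even-t)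
      r<s (∑-gap-period c)
      (∑β-formula k (Centre⇒k<s c) (suc m) t≤s N≡)
      (+-cancelʳ-≡ (k * suc k) _ _ (begin
        2 * ∑α k (Centre⇒k<s c) h + (k ∸ t) * suc (k ∸ t) + k * suc k
          ≡⟨ rearr (2 * ∑α k (Centre⇒k<s c) h) ((k ∸ t) * suc (k ∸ t)) (k * suc k) ⟩
        2 * ∑α k (Centre⇒k<s c) h + k * suc k + (k ∸ t) * suc (k ∸ t)
          ≡⟨ cong (_+ (k ∸ t) * suc (k ∸ t)) (∑α-formula k (Centre⇒k<s c) (suc m) t≤s N≡) ⟩
        suc m * (2 * ∑< s (gap k)) + 2 * ∑< t (gap k) + (k ∸ t) * suc (k ∸ t)
          ≡⟨ trans (+-assoc (suc m * (2 * ∑< s (gap k))) _ _) (cong (suc m * (2 * ∑< s (gap k)) +_) (∑-gap-below k t t+g≡k)) ⟩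
        suc m * (2 * ∑< s (gap k)) + k * suc k ∎)))
    where
    open ≡-Reasoning
    t+g≡k : t + (k ∸ t) ≡ k
    t+g≡k = m+[n∸m]≡n t≤k
    t≤s : t ≤ s
    t≤s = ≤-trans t≤k (<⇒≤ (Centre⇒k<s c))
    rearr : ∀ a b c → a + b + c ≡ a + c + b
    rearr = solve-∀

  -- For odd `q = 2m + 1` half of `n` is `m s + ⌊(s + r) / 2⌋`. Adding `k + 1` completes the half
  -- period to a full one and leaves `t`, which is `⌈r / 2⌉` for odd `s` and `⌊r / 2⌋` for even `s`.
  boundedRouting : BoundedRouting
  boundedRouting with halve q | centre s 1<s | halve r
  ... | m , inj₁ q≡ | k , c | j , half-r = bounded-even {m} {k} {j} q≡ c half-r
  ... | m , inj₂ q≡ | k , inj₁ s≡ | j , inj₁ r≡ =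
    bounded-odd {m} {k} j (m * s + k + j) q≡ (inj₁ s≡) (s≤s⁻¹ (half-< {j} {suc k} (≤-<-trans (≤-reflexive (sym r≡)) (<-≤-trans r<s (Centre⇒s≤2k+2 (inj₁ s≡))))))
      (λ _ → ≤-trans (≤-reflexive (sym r≡)) (n≤1+n r)) (λ e → contradiction (trans (sym s≡) e) (odd≢even {k} {suc k}))
      (inj₂ (trans n≡ (trans (cong₂ (λ a b → a * s + b) q≡ r≡) (trans (eq m s j) (trans (cong (λ x → x + (m * s + m * s + (j + j))) s≡) (eq′ (m * s) k j))))))
      (trans (eq″ k (m * s) j) (cong (λ x → x + m * s + j) (sym s≡)))
    where
    eq : ∀ m s j → suc (m + m) * s + (j + j) ≡ s + (m * s + m * s + (j + j))
    eq = solve-∀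
    eq′ : ∀ a k j → suc (k + k) + (a + a + (j + j)) ≡ suc (a + k + j + (a + k + j))
    eq′ = solve-∀
    eq″ : ∀ k a j → k + suc (a + k + j) ≡ suc (k + k) + a + j
    eq″ = solve-∀
  -- With `s` and `r` both odd the two halves make up one more unit: `t = suc j` and `2t = suc r`,
  -- which is why odd `s` is only asked for `t + t ≤ suc r`.
  ... | m , inj₂ q≡ | k , inj₁ s≡ | j , inj₂ r≡ =
    bounded-odd {m} {k} (suc j) (m * s + k + suc j) q≡ (inj₁ s≡)
      (half-< {j} {k} (s≤s⁻¹ (≤-trans (≤-reflexive (cong suc (sym r≡))) (≤-trans r<s (≤-reflexive s≡)))))
      (λ _ → ≤-reflexive (trans (cong suc (+-suc j j)) (cong suc (sym r≡)))) (λ e → contradiction (trans (sym s≡) e) (odd≢even {k} {suc k}))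
      (inj₁ (trans n≡ (trans (cong₂ (λ a b → a * s + b) q≡ r≡) (trans (eq m s j) (trans (cong (λ x → x + (m * s + m * s + suc (j + j))) s≡) (eq′ (m * s) k j))))))
      (trans (eq″ k (m * s) (suc j)) (cong (λ x → x + m * s + suc j) (sym s≡)))
    where
    eq : ∀ m s j → suc (m + m) * s + suc (j + j) ≡ s + (m * s + m * s + suc (j + j))
    eq = solve-∀
    eq′ : ∀ a k j → suc (k + k) + (a + a + suc (j + j)) ≡ a + k + suc j + (a + k + suc j)
    eq′ = solve-∀
    eq″ : ∀ k a j → k + suc (a + k + j) ≡ suc (k + k) + a + j
    eq″ = solve-∀
  ... | m , inj₂ q≡ | k , inj₂ s≡ | j , half-r =
    bounded-odd {m} {k} j (m * s + suc k + j) q≡ (inj₂ s≡) (s≤s⁻¹ (half-< {j} {suc k} (≤-<-trans (2j≤r half-r) (<-≤-trans r<s (Centre⇒s≤2k+2 (inj₂ s≡))))))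
      (λ e → contradiction (trans (sym e) s≡) (odd≢even {k} {suc k})) (λ _ → 2j≤r half-r)
      (half half-r)
      (trans (eq″ k (m * s) j) (cong (λ x → x + m * s + j) (sym s≡)))
    where
    2j≤r : r ≡ j + j ⊎ r ≡ suc (j + j) → j + j ≤ r
    2j≤r (inj₁ e) = ≤-reflexive (sym e)
    2j≤r (inj₂ e) = ≤-trans (n≤1+n _) (≤-reflexive (sym e))
    eq : ∀ m s b → suc (m + m) * s + b ≡ s + (m * s + m * s + b)
    eq = solve-∀
    eq′ : ∀ a k j → suc k + suc k + (a + a + (j + j)) ≡ a + suc k + j + (a + suc k + j)
    eq′ = solve-∀
    eq‴ : ∀ a k j → suc k + suc k + (a + a + suc (j + j)) ≡ suc (a + suc k + j + (a + suc k + j))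
    eq‴ = solve-∀
    eq″ : ∀ k a j → k + suc (a + suc k + j) ≡ suc k + suc k + a + j
    eq″ = solve-∀
    half : r ≡ j + j ⊎ r ≡ suc (j + j) → Half n (m * s + suc k + j)
    half (inj₁ r≡) = inj₁ (trans n≡ (trans (cong₂ (λ a b → a * s + b) q≡ r≡) (trans (eq m s (j + j)) (trans (cong (λ x → x + (m * s + m * s + (j + j))) s≡) (eq′ (m * s) k j)))))
    half (inj₂ r≡) = inj₂ (trans n≡ (trans (cong₂ (λ a b → a * s + b) q≡ r≡) (trans (eq m s (suc (j + j))) (trans (cong (λ x → x + (m * s + m * s + suc (j + j))) s≡) (eq‴ (m * s) k j)))))

-- Index 0 would force `n * n ≤ ε n ≤ 1` by the cyclic bound.
edgeπ-positive : ∀ {n} s .{{_ : NonZero n}} → 1 < n → (R : Routing n) → IsRouting n s R → 1 ≤ edgeπ R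
edgeπ-positive {n} s 1<n R routing = n≢0⇒n>0 λ π≡0 → contradiction
  (≤-trans (m∸n≡0⇒m≤n (n≤0⇒n≡0 (subst (n * n ∸ ε n ≤_) (trans (cong (4 * (s + 1) *_) π≡0) (*-zeroʳ (4 * (s + 1)))) (lower-bound-cyclic n s R routing))))
    (s≤s⁻¹ (m%n<n n 2)))
  (<⇒≱ (<-≤-trans 1<n (m≤m*n n n)))

-- From the two loads to the three upper bounds

module _ {s q r A B a : ℕ} (bounds : LoadBounds s q r A B) (a≤ : a ≤ A ⊔ B) where
  open LoadBounds bounds

  private
    8a≤ : ∀ {Y} → 8 * A ≤ Y → 8 * B ≤ Y → 8 * a ≤ Y
    8a≤ {Y} hA hB = ≤-trans (*-monoʳ-≤ 8 a≤) (≤-trans (≤-reflexive (*-distribˡ-⊔ 8 A B)) (⊔-lub hA hB))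

    n∸r : ∀ {n} → n ≡ q * s + r → n ∸ r ≡ q * s
    n∸r n≡ = trans (cong (_∸ r) n≡) (m+n∸n≡m (q * s) r)

  -- `β-bound` times `s` is the claim. It also covers the `±1`-arcs, since `q` is at least `s + 2`.
  upper-bound-small : ∀ {n} → n ≡ q * s + r → r < s → (s + 1) * (s + 1) ≤ n →
    8 * s * a ≤ (n ∸ r) * (n + r + 2) + s * s
  upper-bound-small {n} n≡ r<s [s+1]²≤n = begin
    8 * s * a                                      ≡⟨ eq₁ s a ⟩
    s * (8 * a)                                    ≤⟨ *-monoʳ-≤ s (8a≤ α≤ β-bound) ⟩
    s * (q * (q * s + 2 * r + 2) + s)              ≡⟨ eq₂ s q r ⟩
    q * s * (q * s + r + r + 2) + s * s            ≡⟨ cong₂ (λ x y → x * (y + r + 2) + s * s) (sym (n∸r n≡)) (sym n≡) ⟩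
    (n ∸ r) * (n + r + 2) + s * s                  ∎
    where
    open ≤-Reasoning
    eq₁ : ∀ s a → 8 * s * a ≡ s * (8 * a)
    eq₁ = solve-∀
    eq₂ : ∀ s q r → s * (q * (q * s + 2 * r + 2) + s) ≡ q * s * (q * s + r + r + 2) + s * s
    eq₂ = solve-∀
    -- Otherwise `n < (s + 1) s + s = (s + 1)² - 1`.
    s+2≤q : s + 2 ≤ q
    s+2≤q = ≮⇒≥ λ q<s+2 → <-irrefl refl (begin-strict
      (s + 1) * (s + 1)              ≤⟨ ≤-trans [s+1]²≤n (≤-reflexive n≡) ⟩
      q * s + r                      <⟨ +-mono-≤-< (*-monoˡ-≤ s (s≤s⁻¹ (subst (q <_) (+-suc s 1) q<s+2))) r<s ⟩
      (s + 1) * s + s                ≤⟨ n≤1+n _ ⟩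
      suc ((s + 1) * s + s)          ≡⟨ eq s ⟩
      (s + 1) * (s + 1)              ∎)
      where
      eq : ∀ s → suc ((s + 1) * s + s) ≡ (s + 1) * (s + 1)
      eq = solve-∀
    s≤q : s ≤ q
    s≤q = ≤-trans (m≤m+n s 2) s+2≤q
    α≤ : 8 * A ≤ q * (q * s + 2 * r + 2) + s
    α≤ = begin
      8 * A                                                   ≤⟨ m≤m+n (8 * A) (q * ε s) ⟩
      8 * A + q * ε s                                         ≤⟨ α-bound ⟩
      q * (s * s) + 2 * r * s + 2 * s                         ≤⟨ +-mono-≤ (+-mono-≤ (≤-refl {q * (s * s)}) (*-monoʳ-≤ (2 * r) s≤q)) (*-monoʳ-≤ 2 s≤q) ⟩
      q * (s * s) + 2 * r * q + 2 * q                         ≤⟨ m≤m+n _ (q * (2 * s) + s) ⟩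
      q * (s * s) + 2 * r * q + 2 * q + (q * (2 * s) + s)     ≡⟨ eq₃ s q r ⟩
      q * ((s + 2) * s + 2 * r + 2) + s                       ≤⟨ +-monoˡ-≤ s (*-monoʳ-≤ q (+-monoˡ-≤ 2 (+-monoˡ-≤ (2 * r) (*-monoˡ-≤ s s+2≤q)))) ⟩
      q * (q * s + 2 * r + 2) + s                             ∎
      where
      eq₃ : ∀ s q r → q * (s * s) + 2 * r * q + 2 * q + (q * (2 * s) + s) ≡ q * ((s + 2) * s + 2 * r + 2) + s
      eq₃ = solve-∀

  -- Dividing `s * s` by `s` forces `q = s` and `r = 0`, where the sharper pair of bounds applies.
  upper-bound-square : ∀ {n} → n ≡ q * s + r → r < s → s * s ≡ n → 8 * a ≤ s * (n ∸ ε s)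
  upper-bound-square n≡ r<s refl = 8a≤ (move (α-square q≡s r≡0)) (move (β-square q≡s r≡0))
    where
    instance
      s≢0 : NonZero s
      s≢0 = >-nonZero (≤-<-trans z≤n r<s)
    s²≡ : s * s ≡ r + q * s
    s²≡ = trans n≡ (+-comm (q * s) r)
    q≡s : q ≡ s
    q≡s = trans (sym (/-unique q r<s)) (trans (cong (_/ s) (sym s²≡)) (m*n/n≡m s s))
    r≡0 : r ≡ 0
    r≡0 = trans (sym (%-unique q r<s)) (trans (cong (_% s) (sym s²≡)) (m*n%n≡0 s s))
    move : ∀ {x} → x + s * ε s ≤ s * (s * s) → x ≤ s * (s * s ∸ ε s)
    move {x} h = ≤-trans (m+n≤o⇒m≤o∸n x h) (≤-reflexive (sym (*-distribˡ-∸ s (s * s) (ε s))))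

  -- The roles are exchanged: `α-bound` times `s` is the claim, and `q + 2 ≤ s` makes it cover the
  -- `±s`-arcs too.
  upper-bound-large : ∀ {n} → n ≡ q * s + r → 1 < s → n ≤ (s ∸ 1) * (s ∸ 1) →
    8 * s * a ≤ s * s * (n + r + 2) ∸ ε s * (n ∸ r)
  upper-bound-large {n} n≡ 1<s n≤[s-1]² = begin
    8 * s * a                                              ≡⟨ eq₁ s a ⟩
    s * (8 * a)                                            ≤⟨ *-monoʳ-≤ s (8a≤ (m+n≤o⇒m≤o∸n (8 * A) α-bound) (m+n≤o⇒m≤o∸n (8 * B) β≤)) ⟩
    s * (Z ∸ q * ε s)                                      ≡⟨ *-distribˡ-∸ s Z (q * ε s) ⟩
    s * Z ∸ s * (q * ε s)                                  ≡⟨ cong₂ _∸_ (eq₂ s q r) (eq₃ s q (ε s)) ⟩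
    s * s * (q * s + r + r + 2) ∸ ε s * (q * s)            ≡⟨ cong₂ (λ x y → s * s * (x + r + 2) ∸ ε s * y) (sym n≡) (sym (n∸r n≡)) ⟩
    s * s * (n + r + 2) ∸ ε s * (n ∸ r)                    ∎
    where
    open ≤-Reasoning
    Z : ℕ
    Z = q * (s * s) + 2 * r * s + 2 * s
    eq₁ : ∀ s a → 8 * s * a ≡ s * (8 * a)
    eq₁ = solve-∀
    eq₂ : ∀ s q r → s * (q * (s * s) + 2 * r * s + 2 * s) ≡ s * s * (q * s + r + r + 2)
    eq₂ = solve-∀
    eq₃ : ∀ s q e → s * (q * e) ≡ e * (q * s)
    eq₃ = solve-∀
    -- With `s = u + 2`, a quotient of at least `u + 1` would give `n ≥ (u + 1)(u + 2) > (u + 1)²`.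
    q+2≤s : ∀ {s} → 1 < s → q * s + r ≤ (s ∸ 1) * (s ∸ 1) → q + 2 ≤ s
    q+2≤s {suc zero} (s≤s ()) _
    q+2≤s {suc (suc u)} _ h = subst (_≤ 2 + u) (+-comm 2 q) (s≤s (≰⇒> λ u+1≤q → <-irrefl refl (begin-strict
      suc u * suc u                  <⟨ *-monoʳ-< (suc u) (n<1+n (suc u)) ⟩
      suc u * suc (suc u)            ≤⟨ *-monoˡ-≤ (suc (suc u)) u+1≤q ⟩
      q * suc (suc u)                ≤⟨ m≤m+n _ r ⟩
      q * suc (suc u) + r            ≤⟨ h ⟩
      suc u * suc u                  ∎)))
    q+2≤s′ : q + 2 ≤ s
    q+2≤s′ = q+2≤s 1<s (≤-trans (≤-reflexive (sym n≡)) n≤[s-1]²)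
    q≤s : q ≤ s
    q≤s = ≤-trans (m≤m+n q 2) q+2≤s′
    β≤ : 8 * B + q * ε s ≤ Z
    β≤ = begin
      8 * B + q * ε s                                              ≤⟨ +-mono-≤ β-bound (≤-trans (*-monoʳ-≤ q (s≤s⁻¹ (m%n<n s 2))) (≤-reflexive (*-identityʳ q))) ⟩
      q * (q * s + 2 * r + 2) + s + q                              ≡⟨ eq₄ s q r ⟩
      q * (q * s) + 2 * r * q + (q * 2 + s + q)                    ≤⟨ +-mono-≤ (+-monoʳ-≤ (q * (q * s)) (*-monoʳ-≤ (2 * r) q≤s)) (+-mono-≤ (+-monoˡ-≤ s (*-monoʳ-≤ q (≤-trans 1<s (m≤m+n s (s + 0))))) q≤s) ⟩
      q * (q * s) + 2 * r * s + (q * (2 * s) + s + s)              ≡⟨ eq₅ s q r ⟩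
      q * ((q + 2) * s) + 2 * r * s + 2 * s                        ≤⟨ +-monoˡ-≤ (2 * s) (+-monoˡ-≤ (2 * r * s) (*-monoʳ-≤ q (*-monoˡ-≤ s q+2≤s′))) ⟩
      q * (s * s) + 2 * r * s + 2 * s                              ∎
      where
      eq₄ : ∀ s q r → q * (q * s + 2 * r + 2) + s + q ≡ q * (q * s) + 2 * r * q + (q * 2 + s + q)
      eq₄ = solve-∀
      eq₅ : ∀ s q r → q * (q * s) + 2 * r * s + (q * (2 * s) + s + s) ≡ q * ((q + 2) * s) + 2 * r * s + 2 * s
      eq₅ = solve-∀

theorem1p1 : (n s q r : ℕ) → 5 ≤ n → 1 < s → 2 * s < n
    → n ≡ q * s + r → r < s
    → Σ ℕ (λ p → Σ ℕ (λ a →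
        IsEdgeForwardingIndex n s p × IsArcForwardingIndex n s a
        -- (a): 2 ≤ s ≤ √n - 1
        × ((s + 1) * (s + 1) ≤ n →
             (n * n ∸ ε n ≤ 4 * (s + 1) * p)
             × (p ≤ 2 * a)
             × (8 * s * a ≤ (n ∸ r) * (n + r + 2) + s * s))
        -- (b): s = √n
        × (s * s ≡ n →
             (s * (n ∸ 1) ≤ 4 * p)
             × (p ≤ 2 * a)
             × (8 * a ≤ s * (n ∸ ε s)))
        -- (c): √n + 1 ≤ s < n/2
        × (n ≤ (s ∸ 1) * (s ∸ 1) →
             (n * n ∸ ε n ≤ 4 * (s + 1) * p)
             × (2 * n * ((n ∸ 1) * (2 * n + 147)) * ((n ∸ 1) * (2 * n + 147))
                  ≤ (12 * n * p + (n ∸ 1) * (42 * n + 343))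
                    * (12 * n * p + (n ∸ 1) * (42 * n + 343)))
             × (p ≤ 2 * a)
             × (8 * s * a ≤ s * s * (n + r + 2) ∸ ε s * (n ∸ r)))))
theorem1p1 n s q r 5≤n 1<s 2s<n n≡ r<s
  with boundedRouting n s q r {{>-nonZero (≤-trans (s≤s z≤n) 5≤n)}} {{>-nonZero (<-trans (s≤s z≤n) 1<s)}}
         1<s (subst (_< n) (cong (s +_) (+-identityʳ s)) 2s<n) n≡ r<s
... | R , routing , A , B , bounds , arcπR≤
  with edgeForwardingIndex n s (R , routing) | arcForwardingIndex n s (R , routing)
... | p , isP@((Rₚ , routingₚ , refl) , p-min) | a , isA@((Rₐ , routingₐ , refl) , a-min) =
  p , a , isP , isA
  , (λ [s+1]²≤n → cyclic , p≤2a , upper-bound-small bounds a≤ n≡ r<s [s+1]²≤n)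
  , (λ s²≡n → lower-bound-torus n s s²≡n Rₚ routingₚ , p≤2a , upper-bound-square bounds a≤ n≡ r<s s²≡n)
  , (λ n≤[s-1]² → cyclic
      , lower-bound-ball n s s≤n Rₚ routingₚ (edgeπ-positive s (≤-trans (s≤s (s≤s z≤n)) 5≤n) Rₚ routingₚ)
      , p≤2a , upper-bound-large bounds a≤ n≡ 1<s n≤[s-1]²)
  where
  instance
    n≢0 : NonZero n
    n≢0 = >-nonZero (≤-trans (s≤s z≤n) 5≤n)
    s≢0 : NonZero s
    s≢0 = >-nonZero (<-trans (s≤s z≤n) 1<s)
  s≤n : s ≤ n
  s≤n = ≤-trans (m≤m+n s (s + 0)) (<⇒≤ 2s<n)
  a≤ : a ≤ A ⊔ B
  a≤ = ≤-trans (a-min R routing) arcπR≤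
  -- The arc-optimal routing competes for the edge index.
  p≤2a : p ≤ 2 * a
  p≤2a = ≤-trans (p-min Rₐ routingₐ) (edgeπ≤2arcπ Rₐ)
  cyclic : n * n ∸ ε n ≤ 4 * (s + 1) * p
  cyclic = lower-bound-cyclic n s Rₚ routingₚ
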